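{- Let $A_3(n)$ denote the number of $3$-dimensional polycubes with $n$ cells, counted up to translation, and let $\lambda_3=\lim_{n\to\infty}A_3(n+1)/A_3(n)$. Then $\lambda_3 \leq 9.8073$.
   Context: A $d$-dimensional polycube of size $n$ is a set of $n$ unit cubes (cells) of the cubical lattice $\mathbb{Z}^d$ that is connected via shared $(d-1)$-dimensional faces. Two polycubes are identified if one is a translate of the other (fixed polycubes). $A_d(n)$ is the number of such polycubes of size $n$. It is known that the limit $\lambda_d=\lim_{n\to\infty}A_d(n+1)/A_d(n)$ exists and equals $\lim_{n\to\infty}A_d(n)^{1/n}$. -}

module Defs where

open import Data.Nat using (ℕ)
open import Data.Integer using (ℤ; _+_; +_)
open import Data.Product using (Σ; _×_; _,_; ∃)
open import Data.Sum using (_⊎_)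
open import Data.Fin using (Fin)
open import Data.List using (List; length)
open import Data.List.Membership.Propositional using (_∈_)
open import Data.List.Relation.Unary.Unique.Propositional using (Unique)
open import Relation.Binary.PropositionalEquality using (_≡_)
open import Function.Bundles using (_⇔_)

-- A cell of the cubical lattice ℤ³ (identified with its lexicographically
-- smallest corner).
Cell : Set
Cell = ℤ × ℤ × ℤ

Diff1 : ℤ → ℤ → Set
Diff1 a b = (b ≡ a + + 1) ⊎ (a ≡ b + + 1)

Adj : Cell → Cell → Set
Adj (x , y , z) (x' , y' , z') =
    (Diff1 x x' × y ≡ y' × z ≡ z')
  ⊎ (x ≡ x' × Diff1 y y' × z ≡ z')
  ⊎ (x ≡ x' × y ≡ y' × Diff1 z z')

data Path (P : List Cell) : Cell → Cell → Set where
  stop : ∀ {a} → Path P a a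
  step : ∀ {a b c} → Adj a b → b ∈ P → Path P b c → Path P a c

Connected : List Cell → Set
Connected P = ∀ {a b} → a ∈ P → b ∈ P → Path P a b

-- A (fixed, not yet translation-reduced) 3-dimensional polycube with n cells:
-- a finite set of n distinct cells (a duplicate-free list, read as a set),
-- connected via shared faces.
record Polycube (n : ℕ) : Set where
  field
    cells     : List Cell
    distinct  : Unique cells
    size      : length cells ≡ n
    connected : Connected cells
open Polycube public

translate : Cell → Cell → Cell
translate (a , b , c) (x , y , z) = (x + a , y + b , z + c)

_~_ : ∀ {n} → Polycube n → Polycube n → Set
P ~ Q = ∃ λ t → ∀ c → (c ∈ cells P) ⇔ (translate t c ∈ cells Q)

IsA3 : ℕ → ℕ → Set
IsA3 n k = Σ (Fin k → Polycube n) λ f →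
    (∀ (P : Polycube n) → ∃ λ i → f i ~ P)
  × (∀ i j → f i ~ f j → i ≡ j)

module Submission where

open import Defs
open import Data.Nat using (ℕ; zero; suc; pred; _+_; _*_; _∸_; _^_; _≤_; _<_; _≥_; z≤n; s≤s; NonZero; >-nonZero; _≤?_; _<?_; _!; _/_; _%_)
open import Data.Nat.DivMod using (/-monoʳ-≤; m/n≤m; m/n*n≤m; m*[n/m]≡n; m≡m%n+[m/n]*n; m%n<n; /-monoˡ-≤; m*n/n≡m)
open import Data.Nat.Divisibility using (∣-trans; m∣m*n; m≤n⇒m!∣n!)
import Data.Nat.Properties as ℕₚ
open import Data.Nat.Tactic.RingSolver using (solve-∀)
open import Data.Integer using (ℤ)
import Data.Integer as Z
import Data.Integer.Properties as ℤₚ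
open import Data.Product using (_×_; _,_; proj₁; proj₂; ∃; ∃₂; uncurry)
open import Data.Product.Properties using (≡-dec)
open import Data.Sum using (_⊎_; inj₁; inj₂; [_,_]′)
open import Data.Empty using (⊥; ⊥-elim)
open import Data.Unit using (⊤; tt)
open import Data.Bool using (true; false)
open import Data.Fin using (Fin)
open import Data.List using (List; []; _∷_; _++_; map; length; filter; concatMap; foldr; allFin; upTo; deduplicate)
import Data.List.Properties as Listₚ
open import Data.List.Membership.Propositional using (_∈_; _∉_)
open import Data.List.Membership.Propositional.Properties using (∈-++⁺ˡ; ∈-++⁺ʳ; ∈-++⁻; ∈-map⁺; ∈-map⁻; ∈-∃++; ∈-filter⁺; ∈-filter⁻; ∈-allFin; ∈-upTo⁺; ∈-upTo⁻; ∈-deduplicate⁺; ∈-deduplicate⁻; ∈-length)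
open import Data.List.Relation.Binary.Permutation.Propositional using (_↭_; ↭-refl; ↭-sym; ↭-trans)
import Data.List.Relation.Binary.Permutation.Propositional as Perm
import Data.List.Relation.Binary.Permutation.Propositional.Properties as Permₚ
open import Data.List.Relation.Unary.Any using (Any; here; there)
open import Data.List.Relation.Unary.All using (All; []; _∷_)
import Data.List.Relation.Unary.All as All
import Data.List.Relation.Unary.All.Properties as Allₚ
open import Data.List.Relation.Unary.AllPairs using (AllPairs; []; _∷_)
import Data.List.Relation.Unary.AllPairs as AP
import Data.List.Relation.Unary.AllPairs.Properties as APₚ
open import Data.List.Relation.Unary.Unique.Propositional using (Unique)
import Data.List.Relation.Unary.Unique.Propositional.Properties as Uniqueₚ
import Data.List.Relation.Unary.Unique.DecPropositional.Properties as DecUnique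
open import Function using (_∘_; id)
open import Function.Bundles using (mk⇔; Equivalence)
open import Relation.Binary.Definitions using (DecidableEquality; tri<; tri≈; tri>)
open import Relation.Binary.PropositionalEquality using (_≡_; _≢_; refl; sym; trans; cong; cong₂; subst; subst₂)
open import Relation.Nullary using (¬_; Dec; yes; no; does)
open import Relation.Nullary.Decidable using (_×-dec_; ¬?)
open import Relation.Unary using (Decidable)

-- Write a(n) for the number of polycubes with n cells.
--
-- Growth.  Explore a polycube from a root, deciding all neighbours of a cell at once and handling the straight child
-- before the lateral ones.  A lateral child then has one decided lateral neighbour besides its parent, and two if its
-- straight sibling is present.  A supersolution of the resulting three-type branching system gives a(n) ≤ C 9.75ⁿ.
--
-- Submultiplicativity.  Cutting a spanning tree at a vertex into two parts of at most 2/3 of the edges, and gluing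
-- lexicographically extreme cells for the converse, yields a(p + q) ≤ exp(O(log²(p + q))) a(p) a(q).
--
-- Log-concavity.  Count the ways of adding and removing a leaf (a cell with one neighbour), weighted by the inverse
-- number of leaves.  Cauchy–Schwarz shows that a(n + 1) / a(n) drops by at most O(1/K) in one step, provided that few
-- polycubes have at most K leaves.  Those are rare: a polycube meets many parallel slabs, in each of which a leaf can be
-- created by adding one or two cells, and this operation can be undone knowing the new leaf only.
--
-- If a(n + 1) / a(n) exceeded 9.8 for some large n, it would stay above 9.78 for a constant times log² n steps, which
-- contradicts growth 9.75 together with submultiplicativity.  All constants are effective, so the threshold is explicit.

-- The theorem bounds every late ratio and does not presuppose that the ratios converge. Exponential
-- growth alone cannot give this, since single ratios might oscillate; approximate log-concavity
-- excludes it. Call a free cell with exactly one neighbour in P a bud. If P has u buds and v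
-- leaves, the inverse-leaf weights turn `a(n + 1)` into a sum of about u/v over the polycubes of
-- size n, and bound `a(n + 2)` below by a sum of about (u/v)². Adding a bud lowers u by at most 7
-- and raises v by at most 1, which costs O(1/v). This is why polycubes with few leaves must be
-- rare. One order of magnitude, log² n, serves throughout. As 9.78/9.75 = 326/325, a window of 325
-- t steps gains at least 2^t over the growth bound, and t of order log² n outweighs the loss
-- exp(O(log² n)) of submultiplicativity. The ratio may lose 0.02 over the window, so K is a
-- multiple of its length. The number k of leaf creations and the number w of slabs have the same
-- order; some direction has w slabs once w³ < n, which holds for large n.

private variable
  A B : Set

-- Finite sums over lists, counting by injections and by codes

∑ : List A → (A → ℕ) → ℕ
∑ []       f = 0
∑ (x ∷ xs) f = f x + ∑ xs f

∑-mono : ∀ (xs : List A) {f g : A → ℕ} → (∀ {x} → x ∈ xs → f x ≤ g x) → ∑ xs f ≤ ∑ xs g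
∑-mono []       h = z≤n
∑-mono (x ∷ xs) h = ℕₚ.+-mono-≤ (h (here refl)) (∑-mono xs (h ∘ there))

∑-cong : ∀ (xs : List A) {f g : A → ℕ} → (∀ {x} → x ∈ xs → f x ≡ g x) → ∑ xs f ≡ ∑ xs g
∑-cong xs h = ℕₚ.≤-antisym (∑-mono xs (ℕₚ.≤-reflexive ∘ h)) (∑-mono xs (ℕₚ.≤-reflexive ∘ sym ∘ h))

∑-++ : ∀ (xs : List A) {ys} {f : A → ℕ} → ∑ (xs ++ ys) f ≡ ∑ xs f + ∑ ys f
∑-++ []       = refl
∑-++ (x ∷ xs) {f = f} = trans (cong (f x +_) (∑-++ xs)) (sym (ℕₚ.+-assoc (f x) _ _))

∑-const : ∀ (xs : List A) c → ∑ xs (λ _ → c) ≡ length xs * c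
∑-const []       c = refl
∑-const (x ∷ xs) c = cong (c +_) (∑-const xs c)

∑-1 : ∀ (xs : List A) → ∑ xs (λ _ → 1) ≡ length xs
∑-1 xs = trans (∑-const xs 1) (ℕₚ.*-identityʳ _)

∑-*ˡ : ∀ (xs : List A) c {f : A → ℕ} → ∑ xs (λ x → c * f x) ≡ c * ∑ xs f
∑-*ˡ []       c = sym (ℕₚ.*-zeroʳ c)
∑-*ˡ (x ∷ xs) c {f} = trans (cong (c * f x +_) (∑-*ˡ xs c)) (sym (ℕₚ.*-distribˡ-+ c (f x) _))

∑-+ : ∀ (xs : List A) {f g : A → ℕ} → ∑ xs (λ x → f x + g x) ≡ ∑ xs f + ∑ xs g
∑-+ []       = refl
∑-+ (x ∷ xs) {f} {g} = trans (cong (f x + g x +_) (∑-+ xs)) (lem (f x) (g x) (∑ xs f) (∑ xs g))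
  where
  lem : ∀ a b c d → a + b + (c + d) ≡ (a + c) + (b + d)
  lem = solve-∀

∑-map : ∀ (k : A → B) xs {f : B → ℕ} → ∑ (map k xs) f ≡ ∑ xs (f ∘ k)
∑-map k []       = refl
∑-map k (x ∷ xs) = cong (_ +_) (∑-map k xs)

∑-≤-const : ∀ (xs : List A) {f : A → ℕ} c → (∀ {x} → x ∈ xs → f x ≤ c) → ∑ xs f ≤ length xs * c
∑-≤-const xs c h = ℕₚ.≤-trans (∑-mono xs h) (ℕₚ.≤-reflexive (∑-const xs c))

-- The occurrence of `g x` is cut out of `ys` before the recursion; injectivity keeps the other
-- images inside what remains.
∑-injection : ∀ (xs : List A) (ys : List B) (g : A → B) {f : A → ℕ} {f′ : B → ℕ} → Unique xs →
  (∀ {x} → x ∈ xs → g x ∈ ys) →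
  (∀ {x x′} → x ∈ xs → x′ ∈ xs → g x ≡ g x′ → x ≡ x′) →
  (∀ {x} → x ∈ xs → f x ≤ f′ (g x)) → ∑ xs f ≤ ∑ ys f′
∑-injection []       ys g u into inj le = z≤n
∑-injection (x ∷ xs) ys g {f} {f′} (x# ∷ u) into inj le with ∈-∃++ (into (here refl))
... | as , bs , refl = ℕₚ.≤-trans
    (ℕₚ.+-mono-≤ (le (here refl))
      (∑-injection xs (as ++ bs) g u into′ (λ p q → inj (there p) (there q)) (le ∘ there)))
    (ℕₚ.≤-reflexive (trans (cong (f′ (g x) +_) (∑-++ as)) (trans (lem (f′ (g x)) (∑ as f′) (∑ bs f′)) (sym (∑-++ as)))))
  where
  lem : ∀ a b c → a + (b + c) ≡ b + (a + c)
  lem = solve-∀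
  into′ : ∀ {x′} → x′ ∈ xs → g x′ ∈ as ++ bs
  into′ {x′} p with ∈-++⁻ as (into (there p))
  ... | inj₁ q         = ∈-++⁺ˡ q
  ... | inj₂ (there q) = ∈-++⁺ʳ as q
  ... | inj₂ (here eq) = ⊥-elim (All.lookup x# p (inj (here refl) (there p) (sym eq)))

length-injection : ∀ (xs : List A) (ys : List B) (g : A → B) → Unique xs →
  (∀ {x} → x ∈ xs → g x ∈ ys) →
  (∀ {x x′} → x ∈ xs → x′ ∈ xs → g x ≡ g x′ → x ≡ x′) → length xs ≤ length ys
length-injection xs ys g u into inj = subst₂ _≤_ (∑-1 xs) (∑-1 ys)
  (∑-injection xs ys g u into inj (λ _ → ℕₚ.≤-refl))

length-⊆ : ∀ {xs ys : List A} → Unique xs → (∀ {x} → x ∈ xs → x ∈ ys) → length xs ≤ length ys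
length-⊆ {xs = xs} {ys} u s = length-injection xs ys id u s (λ _ _ e → e)

-- Counting by codes: codes may be redundant or decode to junk, as long as every element of `xs` is
-- reached.
length-cover : ∀ {A B : Set} {xs : List A} (ys : List B) (decode : B → A) → Unique xs →
  (∀ {x} → x ∈ xs → ∃ λ y → y ∈ ys × decode y ≡ x) → length xs ≤ length ys
length-cover {xs = xs} ys decode u h = subst (length xs ≤_) (Listₚ.length-map decode ys) (length-⊆ u into)
  where
  into : ∀ {x} → x ∈ xs → x ∈ map decode ys
  into x∈ with h x∈
  ... | y , y∈ , refl = ∈-map⁺ decode y∈

pairs : List A → (A → List B) → List (A × B)
pairs xs U = concatMap (λ x → map (x ,_) (U x)) xs

∈-pairs⁺ : ∀ {xs} {U : A → List B} {x s} → x ∈ xs → s ∈ U x → (x , s) ∈ pairs xs U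
∈-pairs⁺ {U = U} {x} p q = go p
  where
  go : ∀ {xs} → x ∈ xs → _ ∈ pairs xs U
  go (here refl) = ∈-++⁺ˡ (∈-map⁺ (x ,_) q)
  go {x′ ∷ _} (there p) = ∈-++⁺ʳ (map (x′ ,_) (U x′)) (go p)

∈-pairs⁻ : ∀ xs {U : A → List B} {p} → p ∈ pairs xs U → proj₁ p ∈ xs × proj₂ p ∈ U (proj₁ p)
∈-pairs⁻ (x ∷ xs) {U} p∈ with ∈-++⁻ (map (x ,_) (U x)) p∈
... | inj₂ q = let a , b = ∈-pairs⁻ xs q in there a , b
... | inj₁ q with ∈-map⁻ (x ,_) q
... | s , s∈ , refl = here refl , s∈

unique-pairs : ∀ {xs} {U : A → List B} → Unique xs → (∀ {x} → x ∈ xs → Unique (U x)) → Unique (pairs xs U)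
unique-pairs {xs = []}         []       v = []
unique-pairs {xs = x ∷ xs} {U} (x# ∷ u) v = Uniqueₚ.++⁺
  (Uniqueₚ.map⁺ (λ { refl → refl }) (v (here refl)))
  (unique-pairs u (v ∘ there))
  (λ { (p , q) → disj p q })
  where
  disj : ∀ {p} → p ∈ map (x ,_) (U x) → p ∈ pairs xs U → ⊥
  disj p q with ∈-map⁻ (x ,_) p
  ... | s , _ , refl = All.lookup x# (proj₁ (∈-pairs⁻ xs q)) refl

∑-pairs : ∀ xs (U : A → List B) {f : A × B → ℕ} → ∑ (pairs xs U) f ≡ ∑ xs (λ x → ∑ (U x) (λ s → f (x , s)))
∑-pairs []       U = refl
∑-pairs (x ∷ xs) U = trans (∑-++ (map (x ,_) (U x))) (cong₂ _+_ (∑-map (x ,_) (U x)) (∑-pairs xs U))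

length-pairs : ∀ (xs : List A) (ys : List B) → length (pairs xs (λ _ → ys)) ≡ length xs * length ys
length-pairs xs ys = trans (sym (∑-1 (pairs xs (λ _ → ys)))) (trans (∑-pairs xs (λ _ → ys))
  (trans (∑-const xs _) (cong (length xs *_) (∑-1 ys))))

select : ∀ {P : Set} → Dec P → ℕ → ℕ
select (yes _) w = w
select (no _)  w = 0

select-elim : ∀ {P : Set} (C : ℕ → Set) (d : Dec P) {w} → (P → C w) → (¬ P → C 0) → C (select d w)
select-elim C (yes p) f g = f p
select-elim C (no ¬p) f g = g ¬p

length-filter-split : ∀ {P : A → Set} (P? : Decidable P) D xs →
  length xs * D ≤ ∑ xs (λ x → select (¬? (P? x)) D) + length (filter P? xs) * D
length-filter-split P? D [] = z≤n
length-filter-split P? D (x ∷ xs) with P? x | length-filter-split P? D xs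
... | no _  | ih = ℕₚ.≤-trans (ℕₚ.+-monoʳ-≤ D ih) (ℕₚ.≤-reflexive (sym (ℕₚ.+-assoc D _ _)))
... | yes _ | ih = ℕₚ.≤-trans (ℕₚ.+-monoʳ-≤ D ih) (ℕₚ.≤-reflexive (lem D (∑ xs (λ x → select (¬? (P? x)) D)) (length (filter P? xs) * D)))
  where
  lem : ∀ a b c → a + (b + c) ≡ b + (a + c)
  lem = solve-∀

-- Cells and normal forms of polycubes

infix 4 _≟ᶜ_ _<ᶜ_

_≟ᶜ_ : DecidableEquality Cell
_≟ᶜ_ = ≡-dec Z._≟_ (≡-dec Z._≟_ Z._≟_)

open import Data.List.Membership.DecPropositional _≟ᶜ_ using (_∈?_) public

_<ᶜ_ : Cell → Cell → Set
(x , y , z) <ᶜ (x′ , y′ , z′) = x Z.< x′ ⊎ x ≡ x′ × (y Z.< y′ ⊎ y ≡ y′ × z Z.< z′)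

<ᶜ-irrefl : ∀ {c} → ¬ c <ᶜ c
<ᶜ-irrefl (inj₁ p)                   = ℤₚ.<-irrefl refl p
<ᶜ-irrefl (inj₂ (_ , inj₁ p))       = ℤₚ.<-irrefl refl p
<ᶜ-irrefl (inj₂ (_ , inj₂ (_ , p))) = ℤₚ.<-irrefl refl p

<ᶜ-trans : ∀ {a b c} → a <ᶜ b → b <ᶜ c → a <ᶜ c
<ᶜ-trans (inj₁ p) (inj₁ q) = inj₁ (ℤₚ.<-trans p q)
<ᶜ-trans (inj₁ p) (inj₂ (refl , _)) = inj₁ p
<ᶜ-trans (inj₂ (refl , _)) (inj₁ q) = inj₁ q
<ᶜ-trans (inj₂ (refl , inj₁ p)) (inj₂ (refl , inj₁ q)) = inj₂ (refl , inj₁ (ℤₚ.<-trans p q))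
<ᶜ-trans (inj₂ (refl , inj₁ p)) (inj₂ (refl , inj₂ (refl , _))) = inj₂ (refl , inj₁ p)
<ᶜ-trans (inj₂ (refl , inj₂ (refl , _))) (inj₂ (refl , inj₁ q)) = inj₂ (refl , inj₁ q)
<ᶜ-trans (inj₂ (refl , inj₂ (refl , p))) (inj₂ (refl , inj₂ (refl , q))) =
  inj₂ (refl , inj₂ (refl , ℤₚ.<-trans p q))

data Order (a b : Cell) : Set where
  less    : a <ᶜ b → Order a b
  equal   : a ≡ b → Order a b
  greater : b <ᶜ a → Order a b

order : ∀ a b → Order a b
order (x , y , z) (x′ , y′ , z′) with ℤₚ.<-cmp x x′
... | tri< p _ _ = less (inj₁ p)
... | tri> _ _ p = greater (inj₁ p)
... | tri≈ _ refl _ with ℤₚ.<-cmp y y′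
...   | tri< p _ _ = less (inj₂ (refl , inj₁ p))
...   | tri> _ _ p = greater (inj₂ (refl , inj₁ p))
...   | tri≈ _ refl _ with ℤₚ.<-cmp z z′
...     | tri< p _ _ = less (inj₂ (refl , inj₂ (refl , p)))
...     | tri> _ _ p = greater (inj₂ (refl , inj₂ (refl , p)))
...     | tri≈ _ refl _ = equal refl

0ᶜ : Cell
0ᶜ = Z.0ℤ , Z.0ℤ , Z.0ℤ

negᶜ : Cell → Cell
negᶜ (x , y , z) = Z.- x , Z.- y , Z.- z

cell-≡ : ∀ {x x′ y y′ z z′} → x ≡ x′ → y ≡ y′ → z ≡ z′ → _≡_ {A = Cell} (x , y , z) (x′ , y′ , z′)
cell-≡ refl refl refl = refl

translate-comm : ∀ s t c → translate s (translate t c) ≡ translate t (translate s c)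
translate-comm (a , b , d) (a′ , b′ , d′) (x , y , z) = cell-≡ (lem x a a′) (lem y b b′) (lem z d d′)
  where
  lem : ∀ x a b → (x Z.+ b) Z.+ a ≡ (x Z.+ a) Z.+ b
  lem x a b = trans (ℤₚ.+-assoc x b a) (trans (cong (λ i → x Z.+ i) (ℤₚ.+-comm b a)) (sym (ℤₚ.+-assoc x a b)))

translate-0 : ∀ c → translate 0ᶜ c ≡ c
translate-0 (x , y , z) = cell-≡ (ℤₚ.+-identityʳ x) (ℤₚ.+-identityʳ y) (ℤₚ.+-identityʳ z)

translate-of-0 : ∀ t → translate t 0ᶜ ≡ t
translate-of-0 (x , y , z) = cell-≡ (ℤₚ.+-identityˡ x) (ℤₚ.+-identityˡ y) (ℤₚ.+-identityˡ z)

translate-neg : ∀ t c → translate (negᶜ t) (translate t c) ≡ c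
translate-neg (a , b , d) (x , y , z) = cell-≡ (lem x a) (lem y b) (lem z d)
  where
  lem : ∀ x a → (x Z.+ a) Z.+ Z.- a ≡ x
  lem x a = trans (ℤₚ.+-assoc x a (Z.- a)) (trans (cong (λ i → x Z.+ i) (ℤₚ.+-inverseʳ a)) (ℤₚ.+-identityʳ x))

neg-translate : ∀ t c → translate t (translate (negᶜ t) c) ≡ c
neg-translate t c = trans (translate-comm t (negᶜ t) c) (translate-neg t c)

translate-assoc : ∀ s t c → translate s (translate t c) ≡ translate (translate s t) c
translate-assoc (a , b , d) (a′ , b′ , d′) (x , y , z) =
  cell-≡ (ℤₚ.+-assoc x a′ a) (ℤₚ.+-assoc y b′ b) (ℤₚ.+-assoc z d′ d)

translate-injective : ∀ t {c d} → translate t c ≡ translate t d → c ≡ d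
translate-injective t {c} {d} eq =
  trans (sym (translate-neg t c)) (trans (cong (translate (negᶜ t)) eq) (translate-neg t d))

translate-mono : ∀ t {c d} → c <ᶜ d → translate t c <ᶜ translate t d
translate-mono (a , _) (inj₁ p) = inj₁ (ℤₚ.+-monoˡ-< a p)
translate-mono (_ , b , _) (inj₂ (refl , inj₁ p)) = inj₂ (refl , inj₁ (ℤₚ.+-monoˡ-< b p))
translate-mono (_ , _ , d) (inj₂ (refl , inj₂ (refl , p))) = inj₂ (refl , inj₂ (refl , ℤₚ.+-monoˡ-< d p))

data Dir : Set where
  x⁺ x⁻ y⁺ y⁻ z⁺ z⁻ : Dir

vec : Dir → Cell
vec x⁺ = Z.1ℤ , Z.0ℤ , Z.0ℤ
vec x⁻ = Z.-1ℤ , Z.0ℤ , Z.0ℤ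
vec y⁺ = Z.0ℤ , Z.1ℤ , Z.0ℤ
vec y⁻ = Z.0ℤ , Z.-1ℤ , Z.0ℤ
vec z⁺ = Z.0ℤ , Z.0ℤ , Z.1ℤ
vec z⁻ = Z.0ℤ , Z.0ℤ , Z.-1ℤ

opp : Dir → Dir
opp x⁺ = x⁻
opp x⁻ = x⁺
opp y⁺ = y⁻
opp y⁻ = y⁺
opp z⁺ = z⁻
opp z⁻ = z⁺

move : Dir → Cell → Cell
move d c = translate (vec d) c

dirs : List Dir
dirs = x⁺ ∷ x⁻ ∷ y⁺ ∷ y⁻ ∷ z⁺ ∷ z⁻ ∷ []

∈-dirs : ∀ d → d ∈ dirs
∈-dirs x⁺ = here refl
∈-dirs x⁻ = there (here refl)
∈-dirs y⁺ = there (there (here refl))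
∈-dirs y⁻ = there (there (there (here refl)))
∈-dirs z⁺ = there (there (there (there (here refl))))
∈-dirs z⁻ = there (there (there (there (there (here refl)))))

nbrs : Cell → List Cell
nbrs c = map (λ d → move d c) dirs

move-opp : ∀ d c → move (opp d) (move d c) ≡ c
move-opp x⁺ = translate-neg (vec x⁺)
move-opp x⁻ = translate-neg (vec x⁻)
move-opp y⁺ = translate-neg (vec y⁺)
move-opp y⁻ = translate-neg (vec y⁻)
move-opp z⁺ = translate-neg (vec z⁺)
move-opp z⁻ = translate-neg (vec z⁻)

move-adj : ∀ d c → Adj c (move d c)
move-adj x⁺ (x , y , z) = inj₁ (inj₁ refl , sym (ℤₚ.+-identityʳ y) , sym (ℤₚ.+-identityʳ z))
move-adj x⁻ (x , y , z) = inj₁ (inj₂ (sym (cong proj₁ (neg-translate (vec x⁺) (x , y , z)))) , sym (ℤₚ.+-identityʳ y) , sym (ℤₚ.+-identityʳ z))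
move-adj y⁺ (x , y , z) = inj₂ (inj₁ (sym (ℤₚ.+-identityʳ x) , inj₁ refl , sym (ℤₚ.+-identityʳ z)))
move-adj y⁻ (x , y , z) = inj₂ (inj₁ (sym (ℤₚ.+-identityʳ x) , inj₂ (sym (cong (proj₁ ∘ proj₂) (neg-translate (vec y⁺) (x , y , z)))) , sym (ℤₚ.+-identityʳ z)))
move-adj z⁺ (x , y , z) = inj₂ (inj₂ (sym (ℤₚ.+-identityʳ x) , sym (ℤₚ.+-identityʳ y) , inj₁ refl))
move-adj z⁻ (x , y , z) = inj₂ (inj₂ (sym (ℤₚ.+-identityʳ x) , sym (ℤₚ.+-identityʳ y) , inj₂ (sym (cong (proj₂ ∘ proj₂) (neg-translate (vec z⁺) (x , y , z))))))

diff1-sym : ∀ {a b} → Diff1 a b → Diff1 b a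
diff1-sym (inj₁ p) = inj₂ p
diff1-sym (inj₂ p) = inj₁ p

adj-sym : ∀ {a b} → Adj a b → Adj b a
adj-sym (inj₁ (p , q , r))        = inj₁ (diff1-sym p , sym q , sym r)
adj-sym (inj₂ (inj₁ (q , p , r))) = inj₂ (inj₁ (sym q , diff1-sym p , sym r))
adj-sym (inj₂ (inj₂ (q , r , p))) = inj₂ (inj₂ (sym q , sym r , diff1-sym p))

adj-dir : ∀ {a b} → Adj a b → ∃ λ d → b ≡ move d a
adj-dir {x , y , z} (inj₁ (inj₁ refl , refl , refl)) = x⁺ , cell-≡ refl (sym (ℤₚ.+-identityʳ y)) (sym (ℤₚ.+-identityʳ z))
adj-dir {_} {bx , by , bz} (inj₁ (inj₂ refl , refl , refl)) = x⁻ , trans (sym (move-opp x⁺ (bx , by , bz))) (cong (move x⁻) {y = bx Z.+ Z.1ℤ , by , bz} (cell-≡ refl (ℤₚ.+-identityʳ by) (ℤₚ.+-identityʳ bz)))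
adj-dir {x , y , z} (inj₂ (inj₁ (refl , inj₁ refl , refl))) = y⁺ , cell-≡ (sym (ℤₚ.+-identityʳ x)) refl (sym (ℤₚ.+-identityʳ z))
adj-dir {_} {bx , by , bz} (inj₂ (inj₁ (refl , inj₂ refl , refl))) = y⁻ , trans (sym (move-opp y⁺ (bx , by , bz))) (cong (move y⁻) {y = bx , by Z.+ Z.1ℤ , bz} (cell-≡ (ℤₚ.+-identityʳ bx) refl (ℤₚ.+-identityʳ bz)))
adj-dir {x , y , z} (inj₂ (inj₂ (refl , refl , inj₁ refl))) = z⁺ , cell-≡ (sym (ℤₚ.+-identityʳ x)) (sym (ℤₚ.+-identityʳ y)) refl
adj-dir {_} {bx , by , bz} (inj₂ (inj₂ (refl , refl , inj₂ refl))) = z⁻ , trans (sym (move-opp z⁺ (bx , by , bz))) (cong (move z⁻) {y = bx , by , bz Z.+ Z.1ℤ} (cell-≡ (ℤₚ.+-identityʳ bx) (ℤₚ.+-identityʳ by) refl))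

∈-nbrs⁺ : ∀ {a b} → Adj a b → b ∈ nbrs a
∈-nbrs⁺ {a} adj with adj-dir adj
... | d , refl = ∈-map⁺ (λ d → move d a) (∈-dirs d)

∈-nbrs⁻ : ∀ {a b} → b ∈ nbrs a → Adj a b
∈-nbrs⁻ {a} b∈ with ∈-map⁻ (λ d → move d a) {xs = dirs} b∈
... | d , _ , refl = move-adj d a

adj-translate : ∀ t {a b} → Adj a b → Adj (translate t a) (translate t b)
adj-translate t {a} adj with adj-dir adj
... | d , refl = subst (Adj (translate t a)) (translate-comm (vec d) t a) (move-adj d (translate t a))

path-trans : ∀ {P a b c} → Path P a b → Path P b c → Path P a c
path-trans stop           q = q
path-trans (step adj b∈ p) q = step adj b∈ (path-trans p q)

path-map : ∀ {P Q} (f : Cell → Cell) → (∀ {a b} → Adj a b → Adj (f a) (f b)) →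
  (∀ {a} → a ∈ P → f a ∈ Q) → ∀ {a b} → Path P a b → Path Q (f a) (f b)
path-map f f-adj f-∈ stop            = stop
path-map f f-adj f-∈ (step adj b∈ p) = step (f-adj adj) (f-∈ b∈) (path-map f f-adj f-∈ p)

path-⊆ : ∀ {P Q} → (∀ {a} → a ∈ P → a ∈ Q) → ∀ {a b} → Path P a b → Path Q a b
path-⊆ = path-map id id

path-sym : ∀ {P a b} → a ∈ P → Path P a b → Path P b a
path-sym a∈ stop            = stop
path-sym a∈ (step adj b∈ p) = path-trans (path-sym b∈ p) (step (adj-sym adj) a∈ stop)

connected-from : ∀ {P} r → r ∈ P → (∀ {a} → a ∈ P → Path P r a) → Connected P
connected-from r r∈ paths a∈ b∈ = path-trans (path-sym r∈ (paths a∈)) (paths b∈)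

connected-∪ : ∀ {P Q R v} → Connected P → Connected Q → v ∈ P → v ∈ Q →
  (∀ {c} → c ∈ P → c ∈ R) → (∀ {c} → c ∈ Q → c ∈ R) → (∀ {c} → c ∈ R → c ∈ P ⊎ c ∈ Q) → Connected R
connected-∪ {v = v} cP cQ v∈P v∈Q P⊆R Q⊆R split = connected-from v (P⊆R v∈P) λ a∈ →
  [ (λ a∈P → path-⊆ P⊆R (cP v∈P a∈P)) , (λ a∈Q → path-⊆ Q⊆R (cQ v∈Q a∈Q)) ]′ (split a∈)

-- Sorted lists are canonical representatives of finite sets, so that equality of sets becomes `≡`
-- by `sorted-ext`.
Sorted : List Cell → Set
Sorted = AllPairs _<ᶜ_

insert : Cell → List Cell → List Cell
insert c [] = c ∷ []
insert c (d ∷ ds) with order c d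
... | less _    = c ∷ d ∷ ds
... | equal _   = d ∷ ds
... | greater _ = d ∷ insert c ds

∈-insert-here : ∀ c ds → c ∈ insert c ds
∈-insert-here c []       = here refl
∈-insert-here c (d ∷ ds) with order c d
... | less _    = here refl
... | equal eq  = here eq
... | greater _ = there (∈-insert-here c ds)

∈-insert-there : ∀ c {ds a} → a ∈ ds → a ∈ insert c ds
∈-insert-there c {d ∷ ds} a∈ with order c d
... | less _    = there a∈
... | equal _   = a∈
∈-insert-there c {d ∷ ds} (here eq)  | greater _ = here eq
∈-insert-there c {d ∷ ds} (there a∈) | greater _ = there (∈-insert-there c a∈)

∈-insert⁻ : ∀ c ds {a} → a ∈ insert c ds → a ≡ c ⊎ a ∈ ds
∈-insert⁻ c []       (here eq) = inj₁ eq
∈-insert⁻ c (d ∷ ds) a∈ with order c d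
∈-insert⁻ c (d ∷ ds) (here eq)  | less _    = inj₁ eq
∈-insert⁻ c (d ∷ ds) (there a∈) | less _    = inj₂ a∈
∈-insert⁻ c (d ∷ ds) a∈         | equal _   = inj₂ a∈
∈-insert⁻ c (d ∷ ds) (here eq)  | greater _ = inj₂ (here eq)
∈-insert⁻ c (d ∷ ds) (there a∈) | greater _ with ∈-insert⁻ c ds a∈
... | inj₁ eq = inj₁ eq
... | inj₂ q  = inj₂ (there q)

insert-sorted : ∀ c {ds} → Sorted ds → Sorted (insert c ds)
insert-sorted c [] = [] ∷ []
insert-sorted c {d ∷ ds} (d< ∷ s) with order c d
... | less c<d = (c<d ∷ All.map (<ᶜ-trans c<d) d<) ∷ d< ∷ s
... | equal _  = d< ∷ s
... | greater d<c = All.tabulate smaller ∷ insert-sorted c s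
  where
  smaller : ∀ {a} → a ∈ insert c ds → d <ᶜ a
  smaller a∈ with ∈-insert⁻ c ds a∈
  ... | inj₁ refl = d<c
  ... | inj₂ q    = All.lookup d< q

canon : List Cell → List Cell
canon = foldr insert []

canon-sorted : ∀ xs → Sorted (canon xs)
canon-sorted []       = []
canon-sorted (x ∷ xs) = insert-sorted x (canon-sorted xs)

∈-canon⁺ : ∀ {xs a} → a ∈ xs → a ∈ canon xs
∈-canon⁺ {x ∷ xs} (here refl) = ∈-insert-here x (canon xs)
∈-canon⁺ {x ∷ xs} (there a∈)  = ∈-insert-there x (∈-canon⁺ a∈)

∈-canon⁻ : ∀ xs {a} → a ∈ canon xs → a ∈ xs
∈-canon⁻ (x ∷ xs) a∈ with ∈-insert⁻ x (canon xs) a∈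
... | inj₁ eq = here eq
... | inj₂ q  = there (∈-canon⁻ xs q)

sorted-unique : ∀ {xs} → Sorted xs → Unique xs
sorted-unique []       = []
sorted-unique (x< ∷ s) = All.map (λ { p refl → <ᶜ-irrefl p }) x< ∷ sorted-unique s

sorted-ext : ∀ {xs ys} → Sorted xs → Sorted ys → (∀ {a} → a ∈ xs → a ∈ ys) → (∀ {a} → a ∈ ys → a ∈ xs) → xs ≡ ys
sorted-ext []       []       f g = refl
sorted-ext []       (_ ∷ _)  f g with () ← g (here refl)
sorted-ext (_ ∷ _)  []       f g with () ← f (here refl)
sorted-ext {x ∷ xs} {y ∷ ys} (x< ∷ s) (y< ∷ t) f g = cong₂ _∷_ x≡y (sorted-ext s t f′ g′)
  where
  x≡y : x ≡ y
  x≡y with f (here refl) | g (here refl)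
  ... | here eq | _        = eq
  ... | _       | here eq  = sym eq
  ... | there p | there q  = ⊥-elim (<ᶜ-irrefl (<ᶜ-trans (All.lookup x< q) (All.lookup y< p)))
  f′ : ∀ {a} → a ∈ xs → a ∈ ys
  f′ a∈ with f (there a∈)
  ... | there p = p
  ... | here eq = ⊥-elim (<ᶜ-irrefl (subst (_<ᶜ _) (trans x≡y (sym eq)) (All.lookup x< a∈)))
  g′ : ∀ {a} → a ∈ ys → a ∈ xs
  g′ a∈ with g (there a∈)
  ... | there p = p
  ... | here eq = ⊥-elim (<ᶜ-irrefl (subst (_<ᶜ _) (trans (sym x≡y) (sym eq)) (All.lookup y< a∈)))

length-canon : ∀ {xs} → Unique xs → length (canon xs) ≡ length xs
length-canon {xs} u = ℕₚ.≤-antisym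
  (length-⊆ (sorted-unique (canon-sorted xs)) (∈-canon⁻ xs))
  (length-⊆ u ∈-canon⁺)

Shift : Cell → List Cell → List Cell → Set
Shift t xs ys = (∀ {c} → c ∈ xs → translate t c ∈ ys) × (∀ {c} → c ∈ ys → translate (negᶜ t) c ∈ xs)

shift-trans : ∀ {s t xs ys zs} → Shift s xs ys → Shift t ys zs → Shift (translate t s) xs zs
shift-trans {s} {t} {zs = zs} (f , f⁻) (g , g⁻) =
  (λ {c} c∈ → subst (_∈ _) (translate-assoc t s c) (g (f c∈))) ,
  (λ {c} c∈ → subst (_∈ _) (lem c) (f⁻ (g⁻ c∈)))
  where
  lem : ∀ c → translate (negᶜ s) (translate (negᶜ t) c) ≡ translate (negᶜ (translate t s)) c
  lem c = translate-injective (translate t s) {x} {y} (trans (sym (translate-assoc t s x))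
    (trans (cong (translate t) (neg-translate s (translate (negᶜ t) c))) (trans (neg-translate t c) (sym (neg-translate (translate t s) c)))))
    where
    x y : Cell
    x = translate (negᶜ s) (translate (negᶜ t) c)
    y = translate (negᶜ (translate t s)) c

shift-sym : ∀ {t xs ys} → Shift t xs ys → Shift (negᶜ t) ys xs
shift-sym {t} (f , g) = g , λ {c} c∈ → subst (_∈ _) (lem c) (f c∈)
  where
  lem : ∀ c → translate t c ≡ translate (negᶜ (negᶜ t)) c
  lem c = translate-injective (negᶜ t) (trans (translate-neg t c) (sym (neg-translate (negᶜ t) c)))

shift-connected : ∀ {t xs ys} → Shift t xs ys → Connected xs → Connected ys
shift-connected {t} {xs} {ys} (f , g) conn {a} {b} a∈ b∈ =
  subst₂ (Path ys) (neg-translate t a) (neg-translate t b)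
    (path-map (translate t) (adj-translate t) f (conn (g a∈) (g b∈)))

-- The normal form of a translation class: the lexicographically least cell sits at the origin.
record Standard (n : ℕ) (xs : List Cell) : Set where
  constructor standard
  field
    sorted : Sorted xs
    0∈     : 0ᶜ ∈ xs
    0≤     : ∀ {c} → c ∈ xs → ¬ c <ᶜ 0ᶜ
    conn   : Connected xs
    len    : length xs ≡ n

-- A nonzero translation would carry the origin of one of the two sets below the least cell of the
-- other.
shift-unique : ∀ {t m n xs ys} → Standard m xs → Standard n ys → Shift t xs ys → xs ≡ ys
shift-unique {t} {xs = xs} {ys} X Y (f , g) = sorted-ext X.sorted Y.sorted f′ g′
  where
  module X = Standard X
  module Y = Standard Y
  t≡0 : t ≡ 0ᶜ
  t≡0 with order t 0ᶜ
  ... | equal eq  = eq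
  ... | less t<0  = ⊥-elim (Y.0≤ (subst (_∈ ys) (translate-of-0 t) (f X.0∈)) t<0)
  ... | greater 0<t = ⊥-elim (X.0≤ (subst (_∈ xs) refl (g Y.0∈))
    (subst (translate (negᶜ t) 0ᶜ <ᶜ_) (trans (cong (translate (negᶜ t)) (sym (translate-of-0 t))) (translate-neg t 0ᶜ)) (translate-mono (negᶜ t) 0<t)))
  f′ : ∀ {a} → a ∈ xs → a ∈ ys
  f′ {a} a∈ = subst (_∈ ys) (trans (cong (λ s → translate s a) t≡0) (translate-0 a)) (f a∈)
  g′ : ∀ {a} → a ∈ ys → a ∈ xs
  g′ {a} a∈ = subst (_∈ xs) (trans (cong (λ s → translate (negᶜ s) a) t≡0) (translate-0 a)) (g a∈)

recentre : List Cell → List Cell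
recentre []       = []
recentre (m ∷ ms) = map (translate (negᶜ m)) (m ∷ ms)

normalise : List Cell → List Cell
normalise xs = recentre (canon xs)

normalise-standard : ∀ {n} xs → Unique xs → Connected xs → length xs ≡ suc n →
  Standard (suc n) (normalise xs) × ∃ λ t → Shift t xs (normalise xs)
normalise-standard {n} xs u conn len = go (canon xs) (canon-sorted xs) ∈-canon⁺ (∈-canon⁻ xs) (trans (length-canon u) len)
  where
  go : ∀ ys → Sorted ys → (∀ {a} → a ∈ xs → a ∈ ys) → (∀ {a} → a ∈ ys → a ∈ xs) → length ys ≡ suc n →
    Standard (suc n) (recentre ys) × ∃ λ t → Shift t xs (recentre ys)
  go ys@(m ∷ ms) s@(m< ∷ _) into from len′ =
    standard (APₚ.map⁺ (AP.map (translate-mono (negᶜ m)) s))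
      (here (sym m-m)) nonneg (shift-connected shift conn) (trans (Listₚ.length-map _ ys) len′)
    , negᶜ m , shift
    where
    m-m : translate (negᶜ m) m ≡ 0ᶜ
    m-m = trans (cong (translate (negᶜ m)) (sym (translate-of-0 m))) (translate-neg m 0ᶜ)
    shift : Shift (negᶜ m) xs (recentre ys)
    proj₁ shift c∈ = ∈-map⁺ (translate (negᶜ m)) (into c∈)
    proj₂ shift c∈ with ∈-map⁻ (translate (negᶜ m)) {xs = ys} c∈
    ... | d , d∈ , refl = subst (_∈ xs) (sym (translate-neg (negᶜ m) d)) (from d∈)
    nonneg : ∀ {c} → c ∈ recentre ys → ¬ c <ᶜ 0ᶜ
    nonneg c∈ c<0 with ∈-map⁻ (translate (negᶜ m)) {xs = ys} c∈
    ... | d , here refl , refl = <ᶜ-irrefl (subst (_<ᶜ 0ᶜ) m-m c<0)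
    ... | d , there d∈ , refl = <ᶜ-irrefl (<ᶜ-trans c<0 (subst (_<ᶜ translate (negᶜ m) d) m-m (translate-mono (negᶜ m) (All.lookup m< d∈))))

-- Enumerations by normal forms and supermultiplicativity

record Enumeration (n k : ℕ) : Set where
  field
    list     : List (List Cell)
    unique   : Unique list
    sound    : ∀ {P} → P ∈ list → Standard n P
    complete : ∀ {P} → Standard n P → P ∈ list
    card     : length list ≡ k
open Enumeration public

shift→~ : ∀ {n t} (P Q : Polycube n) → Shift t (cells P) (cells Q) → P ~ Q
shift→~ {t = t} P Q (f , g) = t , λ c → mk⇔ f (λ c∈ → subst (_∈ cells P) (translate-neg t c) (g c∈))

~→shift : ∀ {n} (P Q : Polycube n) → P ~ Q → ∃ λ t → Shift t (cells P) (cells Q)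
~→shift P Q (t , h) = t , (λ {c} → Equivalence.to (h c)) ,
  λ {c} c∈ → Equivalence.from (h (translate (negᶜ t) c)) (subst (_∈ cells Q) (sym (neg-translate t c)) c∈)

enumeration : ∀ {n k} → IsA3 (suc n) k → Enumeration (suc n) k
enumeration {n} {k} (f , onto , inj) = record
  { list     = map form (allFin k)
  ; unique   = Uniqueₚ.map⁺ (λ {i} {j} → form-injective i j) (Uniqueₚ.allFin⁺ k)
  ; sound    = λ P∈ → let i , _ , eq = ∈-map⁻ form P∈ in subst (Standard (suc n)) (sym eq) (proj₁ (spec (f i)))
  ; complete = comp
  ; card     = trans (Listₚ.length-map form (allFin k)) (Listₚ.length-tabulate {n = k} id)
  }
  where
  spec : (P : Polycube (suc n)) → Standard (suc n) (normalise (cells P)) × ∃ λ t → Shift t (cells P) (normalise (cells P))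
  spec P = normalise-standard (cells P) (distinct P) (connected P) (Polycube.size P)
  form : Fin k → List Cell
  form i = normalise (cells (f i))
  form-injective : ∀ i j → form i ≡ form j → i ≡ j
  form-injective i j eq with spec (f i) | spec (f j)
  ... | _ , s , si | _ , t , tj = inj i j (shift→~ (f i) (f j)
    (shift-trans si (shift-sym (subst (Shift t (cells (f j))) (sym eq) tj))))
  comp : ∀ {P} → Standard (suc n) P → P ∈ map form (allFin k)
  comp {P} std = shifted (onto poly)
    where
    open Standard std
    poly : Polycube (suc n)
    poly = record { cells = P ; distinct = sorted-unique sorted ; size = len ; connected = conn }
    shifted : (∃ λ i → f i ~ poly) → P ∈ map form (allFin k)
    shifted (i , eqv) with ~→shift (f i) poly eqv | spec (f i)
    ... | s , sh | stdᵢ , t , shᵢ = subst (_∈ map form (allFin k))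
      (shift-unique stdᵢ std (shift-trans (shift-sym shᵢ) sh)) (∈-map⁺ form (∈-allFin i))

last : Cell → List Cell → Cell
last x []       = x
last x (y ∷ ys) = last y ys

last-∈ : ∀ x xs → last x xs ∈ x ∷ xs
last-∈ x []       = here refl
last-∈ x (y ∷ ys) = there (last-∈ y ys)

last-max : ∀ {x xs} → Sorted (x ∷ xs) → ∀ {c} → c ∈ x ∷ xs → c ≡ last x xs ⊎ c <ᶜ last x xs
last-max {x} {[]}     s         (here eq)  = inj₁ eq
last-max {x} {y ∷ ys} (x< ∷ s)  (here refl) = inj₂ (All.lookup x< (last-∈ y ys))
last-max {x} {y ∷ ys} (_ ∷ s)   (there c∈) = last-max s c∈

-- The first cell of the second list is laid on the last cell of the first and listed once. All
-- other translated cells come later in the order, so plain concatenation stays sorted and the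
-- lengths tell where to cut it again.
join : List Cell → List Cell → List Cell
join (x ∷ xs) (_ ∷ ys) = (x ∷ xs) ++ map (translate (last x xs)) ys
join _        _        = []

shift-map : ∀ t xs → Shift t xs (map (translate t) xs)
shift-map t xs = ∈-map⁺ (translate t) , λ c∈ → let d , d∈ , eq = ∈-map⁻ (translate t) {xs = xs} c∈ in
  subst (_∈ xs) (sym (trans (cong (translate (negᶜ t)) eq) (translate-neg t d))) d∈

standard-head : ∀ {n y ys} → Standard n (y ∷ ys) → y ≡ 0ᶜ
standard-head std with Standard.0∈ std | Standard.sorted std
... | here eq  | _      = sym eq
... | there 0∈ | y< ∷ _ = ⊥-elim (Standard.0≤ std (here refl) (All.lookup y< 0∈))

join-standard : ∀ {j k X Y} → Standard (suc j) X → Standard (suc k) Y → Standard (suc (j + k)) (join X Y)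
join-standard {X = []} std _ with () ← Standard.0∈ std
join-standard {X = _ ∷ _} {[]} _ std with () ← Standard.0∈ std
join-standard {j} {k} {X@(x ∷ xs)} {Y@(y ∷ ys)} stdX stdY with standard-head stdY
... | refl = standard
  (APₚ.++⁺ X.sorted sorted′ (All.tabulate λ a∈ → All.tabulate λ b∈ → below a∈ b∈))
  (∈-++⁺ˡ X.0∈) nonneg
  (connected-∪ {P = X} {Q = map (translate l) Y} X.conn (shift-connected (shift-map l Y) Y.conn) (last-∈ x xs) (here (sym (translate-of-0 l)))
    ∈-++⁺ˡ into split)
  (trans (Listₚ.length-++ X) (cong₂ _+_ X.len (trans (Listₚ.length-map _ ys) (ℕₚ.suc-injective Y.len))))
  where
  module X = Standard stdX
  module Y = Standard stdY
  l = last x xs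
  sorted′ : Sorted (map (translate l) ys)
  sorted′ with _ ∷ s ← Y.sorted = APₚ.map⁺ (AP.map (translate-mono l) s)
  l< : ∀ {b} → b ∈ map (translate l) ys → l <ᶜ b
  l< b∈ with d , d∈ , refl ← ∈-map⁻ (translate l) {xs = ys} b∈ | 0< ∷ _ ← Y.sorted =
    subst (_<ᶜ translate l d) (translate-of-0 l) (translate-mono l (All.lookup 0< d∈))
  below : ∀ {a b} → a ∈ X → b ∈ map (translate l) ys → a <ᶜ b
  below a∈ b∈ with last-max X.sorted a∈
  ... | inj₁ refl = l< b∈
  ... | inj₂ a<l  = <ᶜ-trans a<l (l< b∈)
  nonneg : ∀ {c} → c ∈ join X Y → ¬ c <ᶜ 0ᶜ
  nonneg c∈ c<0 with ∈-++⁻ X c∈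
  ... | inj₁ c∈X = X.0≤ c∈X c<0
  ... | inj₂ c∈Y = X.0≤ (last-∈ x xs) (<ᶜ-trans (l< c∈Y) c<0)
  into : ∀ {c} → c ∈ map (translate l) Y → c ∈ join X Y
  into (here refl) = ∈-++⁺ˡ (subst (_∈ X) (sym (translate-of-0 l)) (last-∈ x xs))
  into (there c∈)  = ∈-++⁺ʳ X c∈
  split : ∀ {c} → c ∈ join X Y → c ∈ X ⊎ c ∈ map (translate l) Y
  split c∈ with ∈-++⁻ X c∈
  ... | inj₁ p = inj₁ p
  ... | inj₂ p = inj₂ (there p)

++-injective : ∀ {A : Set} (xs xs′ : List A) {ys ys′} → length xs ≡ length xs′ → xs ++ ys ≡ xs′ ++ ys′ → xs ≡ xs′ × ys ≡ ys′
++-injective []       []         _  eq = refl , eq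
++-injective (x ∷ xs) (x′ ∷ xs′) le eq with Listₚ.∷-injective eq
... | refl , eq′ with ++-injective xs xs′ (ℕₚ.suc-injective le) eq′
... | refl , eq″ = refl , eq″

join-injective : ∀ {j k X Y X′ Y′} → Standard (suc j) X → Standard (suc k) Y → Standard (suc j) X′ → Standard (suc k) Y′ →
  join X Y ≡ join X′ Y′ → X ≡ X′ × Y ≡ Y′
join-injective {X = []} std _ _ _ _ with () ← Standard.0∈ std
join-injective {X = _ ∷ _} {[]} _ std _ _ _ with () ← Standard.0∈ std
join-injective {X = _ ∷ _} {_ ∷ _} {[]} _ _ std _ _ with () ← Standard.0∈ std
join-injective {X = _ ∷ _} {_ ∷ _} {_ ∷ _} {[]} _ _ _ std _ with () ← Standard.0∈ std
join-injective {X = x ∷ xs} {y ∷ ys} {x′ ∷ xs′} {y′ ∷ ys′} sX sY sX′ sY′ eq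
  with ++-injective (x ∷ xs) (x′ ∷ xs′) (trans (Standard.len sX) (sym (Standard.len sX′))) eq
... | refl , eq′ = refl , cong₂ _∷_ (trans (standard-head sY) (sym (standard-head sY′)))
  (Listₚ.map-injective (translate-injective (last x xs)) eq′)

-- Joining shares one cell, so the number of cells minus one is additive. This is why sizes are
-- written as successors here and in every later family `b`.
supermultiplicative : ∀ {j k a b c} → Enumeration (suc j) a → Enumeration (suc k) b → Enumeration (suc (j + k)) c → a * b ≤ c
supermultiplicative {a = a} {b} ea eb ec = subst₂ _≤_ count (card ec)
  (length-injection (pairs (list ea) (λ _ → list eb)) (list ec) (uncurry join)
    (unique-pairs (unique ea) (λ _ → unique eb))
    (λ p∈ → complete ec (join-standard (sound ea (proj₁ (∈-pairs⁻ (list ea) p∈))) (sound eb (proj₂ (∈-pairs⁻ (list ea) p∈)))))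
    λ p∈ q∈ eq → let p₁ , p₂ = ∈-pairs⁻ (list ea) p∈ ; q₁ , q₂ = ∈-pairs⁻ (list ea) q∈ in
      uncurry (cong₂ _,_) (join-injective (sound ea p₁) (sound eb p₂) (sound ea q₁) (sound eb q₂) eq))
  where
  count : length (pairs (list ea) (λ _ → list eb)) ≡ a * b
  count = trans (length-pairs (list ea) (list eb)) (cong₂ _*_ (card ea) (card eb))

-- Balanced splittings

unique-↭ : ∀ {A : Set} {xs ys : List A} → xs ↭ ys → Unique xs → Unique ys
unique-↭ Perm.refl         u                    = u
unique-↭ (Perm.prep x p)   (x# ∷ u)             = Permₚ.All-resp-↭ p x# ∷ unique-↭ p u
unique-↭ (Perm.swap x y p) ((x≢y ∷ x#) ∷ y# ∷ u) =
  ((x≢y ∘ sym) ∷ Permₚ.All-resp-↭ p y#) ∷ Permₚ.All-resp-↭ p x# ∷ unique-↭ p u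
unique-↭ (Perm.trans p q)  u                    = unique-↭ q (unique-↭ p u)

-- `graft` hangs one more branch at the root, so that the branches of the root can be peeled off one
-- at a time.
data Tree : Cell → List Cell → Set where
  node  : ∀ c → Tree c (c ∷ [])
  graft : ∀ {c d xs ys} → Tree c xs → Tree d ys → Adj c d → Tree c (ys ++ xs)

root-∈ : ∀ {c xs} → Tree c xs → c ∈ xs
root-∈ (node c)                = here refl
root-∈ (graft {ys = ys} t _ _) = ∈-++⁺ʳ ys (root-∈ t)

root-path : ∀ {c xs} → Tree c xs → ∀ {a} → a ∈ xs → Path xs c a
root-path (node c) (here refl) = stop
root-path (graft {ys = ys} t u e) a∈ with ∈-++⁻ ys a∈
... | inj₁ a∈ys = step e (∈-++⁺ˡ (root-∈ u)) (path-⊆ ∈-++⁺ˡ (root-path u a∈ys))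
... | inj₂ a∈xs = path-⊆ (∈-++⁺ʳ ys) (root-path t a∈xs)

attach : ∀ {c xs a b} → Tree c xs → a ∈ xs → Adj a b → ∃ λ zs → Tree c zs × zs ↭ b ∷ xs
attach {b = b} (node c) (here refl) e = b ∷ c ∷ [] , graft (node c) (node b) e , ↭-refl
attach {b = b} (graft {xs = xs} {ys} t u e′) a∈ e with ∈-++⁻ ys a∈
... | inj₁ a∈ys with attach u a∈ys e
...   | zs , u′ , perm = zs ++ xs , graft t u′ e′ , Permₚ.++⁺ʳ xs perm
attach {b = b} (graft {xs = xs} {ys} t u e′) a∈ e | inj₂ a∈xs with attach t a∈xs e
...   | zs , t′ , perm = ys ++ zs , graft t′ u e′ , ↭-trans (Permₚ.++⁺ˡ ys perm) (Permₚ.shift b ys xs)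

crossing : ∀ {P xs a c} → Path P a c → a ∈ xs → c ∉ xs → ∃₂ λ a′ b → a′ ∈ xs × b ∈ P × b ∉ xs × Adj a′ b
crossing stop a∈ c∉ = ⊥-elim (c∉ a∈)
crossing {xs = xs} {a} (step {b = b} e b∈ p) a∈ c∉ with b ∈? xs
... | yes b∈xs = crossing p b∈xs c∉
... | no  b∉xs = a , b , a∈ , b∈ , b∉xs , e

missing : ∀ {P xs} → Unique P → length xs < length P → ∃ λ c → c ∈ P × c ∉ xs
missing {P} {xs} u lt with All.all? (_∈? xs) P
... | yes all = ⊥-elim (ℕₚ.<⇒≱ lt (length-⊆ u (All.lookup all)))
... | no ¬all = find (Allₚ.¬All⇒Any¬ (_∈? xs) P ¬all)
  where
  find : ∀ {P} → Any (λ c → c ∉ xs) P → ∃ λ c → c ∈ P × c ∉ xs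
  find (here p)  = _ , here refl , p
  find (there p) = let c , c∈ , c∉ = find p in c , there c∈ , c∉

Spanning : Cell → List Cell → Set
Spanning r P = ∃ λ zs → Tree r zs × Unique zs × (∀ {a} → a ∈ zs → a ∈ P) × length zs ≡ length P

spanning-tree : ∀ {P r} → Connected P → Unique P → r ∈ P → Spanning r P
spanning-tree {P} {r} conn u r∈ = grow (length P ∸ 1) (node r) ([] ∷ []) (λ { (here refl) → r∈ }) (lem r∈)
  where
  lem : ∀ {P : List Cell} {r} → r ∈ P → 1 + (length P ∸ 1) ≡ length P
  lem (here _)  = refl
  lem (there _) = refl
  grow : ∀ k {xs} → Tree r xs → Unique xs → (∀ {a} → a ∈ xs → a ∈ P) → length xs + k ≡ length P → Spanning r P
  grow zero    {xs} t v xs⊆ eq = xs , t , v , xs⊆ , trans (sym (ℕₚ.+-identityʳ _)) eq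
  grow (suc k) {xs} t v xs⊆ eq with missing u (subst (suc (length xs) ≤_) (trans (sym (ℕₚ.+-suc (length xs) k)) eq) (ℕₚ.m≤m+n (suc (length xs)) k))
  ... | c , c∈ , c∉ with crossing (conn r∈ c∈) (root-∈ t) c∉
  ... | a , b , a∈ , b∈ , b∉ , e with attach t a∈ e
  ... | zs , t′ , perm = grow k t′ v′ zs⊆ len′
    where
    v′ : Unique zs
    v′ = unique-↭ (↭-sym perm) (All.tabulate (λ { p refl → b∉ p }) ∷ v)
    zs⊆ : ∀ {a} → a ∈ zs → a ∈ P
    zs⊆ a∈ with Permₚ.∈-resp-↭ perm a∈
    ... | here refl = b∈
    ... | there p   = xs⊆ p
    len′ : length zs + k ≡ length P
    len′ = trans (cong (_+ k) (Permₚ.↭-length perm)) (trans (sym (ℕₚ.+-suc (length xs) k)) eq)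

-- The pivot is omitted from `us` but belongs to `xs`. Counted in edges of a tree with `M` edges,
-- the parts have sizes `length us` and `length xs` minus one, and both are at most two thirds of
-- `M`.
record Split (M : ℕ) (P : List Cell) : Set where
  constructor split
  field
    pivot : Cell
    us xs : List Cell
    path-us : ∀ {a} → a ∈ us → Path (pivot ∷ us) pivot a
    path-xs : ∀ {a} → a ∈ xs → Path xs pivot a
    pivot∈  : pivot ∈ xs
    perm    : us ++ xs ↭ P
    us-size : 3 * length us ≤ 2 * M
    xs-size : 3 * length xs ≤ 2 * M + 3

complement-size : ∀ {a b M} → a + b ≡ suc M → M ≤ 3 * a → 3 * b ≤ 2 * M + 3
complement-size {a} {b} {M} eq le = ℕₚ.+-cancelʳ-≤ M _ _ (begin
  3 * b + M       ≤⟨ ℕₚ.+-monoʳ-≤ (3 * b) le ⟩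
  3 * b + 3 * a   ≡⟨ lem a b ⟩
  3 * (a + b)     ≡⟨ cong (3 *_) eq ⟩
  3 * suc M       ≡⟨ lem′ M ⟩
  2 * M + 3 + M   ∎)
  where
  open ℕₚ.≤-Reasoning
  lem : ∀ a b → 3 * b + 3 * a ≡ 3 * (a + b)
  lem = solve-∀
  lem′ : ∀ M → 3 * suc M ≡ 2 * M + 3 + M
  lem′ = solve-∀

branch-size : ∀ {u d M} → 3 * u < M → 2 * M < 3 * (u + d) → M ≤ 3 * d
branch-size {u} {d} {M} lt lt′ = ℕₚ.<⇒≤ (ℕₚ.+-cancelˡ-< M _ _ (begin-strict
  M + M           ≡⟨ lem M ⟩
  2 * M           <⟨ lt′ ⟩
  3 * (u + d)     ≡⟨ ℕₚ.*-distribˡ-+ 3 u d ⟩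
  3 * u + 3 * d   ≤⟨ ℕₚ.+-monoˡ-≤ (3 * d) (ℕₚ.<⇒≤ lt) ⟩
  M + 3 * d       ∎))
  where
  open ℕₚ.≤-Reasoning
  lem : ∀ M → M + M ≡ 2 * M
  lem = solve-∀

-- The hypotheses give 3b ≤ M + 2, which is at most 2M exactly when M ≥ 2.
remainder-size : ∀ {a b M} → a + b ≡ suc M → 2 * M < 3 * a → 2 ≤ M → 3 * b ≤ 2 * M
remainder-size {a} {b} {M} eq lt 2≤ = ℕₚ.+-cancelʳ-≤ (suc (2 * M)) _ _ (begin
  3 * b + suc (2 * M)   ≤⟨ ℕₚ.+-monoʳ-≤ (3 * b) lt ⟩
  3 * b + 3 * a         ≡⟨ lem a b ⟩
  3 * (a + b)           ≡⟨ cong (3 *_) eq ⟩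
  3 * suc M             ≡⟨ lem′ M ⟩
  2 + (M + suc (2 * M)) ≤⟨ ℕₚ.+-monoˡ-≤ _ 2≤ ⟩
  M + (M + suc (2 * M)) ≡⟨ lem″ M ⟩
  2 * M + suc (2 * M)   ∎)
  where
  open ℕₚ.≤-Reasoning
  lem : ∀ a b → 3 * b + 3 * a ≡ 3 * (a + b)
  lem = solve-∀
  lem′ : ∀ M → 3 * suc M ≡ 2 + (M + suc (2 * M))
  lem′ = solve-∀
  lem″ : ∀ M → M + (M + suc (2 * M)) ≡ 2 * M + suc (2 * M)
  lem″ = solve-∀

-- Search for a centroid. `us` is what has been set aside, hanging at the current root. If it
-- reaches a third of the edges, the cut is here. Otherwise the next branch `ys` is added to `us` if
-- the two fit into two thirds. If they do not, `ys` exceeds a third: it is cut off alone when it is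
-- at most two thirds, and else the search moves to its root with everything else set aside. At a
-- bare root `us` would have all `M` edges, more than it may.
balanced-split : ∀ {c xs M} → Tree c xs → ∀ us → (∀ {a} → a ∈ us → Path (c ∷ us) c a) →
  length us + length xs ≡ suc M → 2 ≤ M → 3 * length us ≤ 2 * M → Split M (us ++ xs)
balanced-split {M = M} (node c) us paths eq 2≤M le = ⊥-elim (ℕₚ.<⇒≱ (lem M (ℕₚ.≤-trans (s≤s z≤n) 2≤M))
    (subst (λ n → 3 * n ≤ 2 * M) (ℕₚ.suc-injective (trans (sym (ℕₚ.+-comm (length us) 1)) eq)) le))
  where
  lem : ∀ M → 1 ≤ M → 2 * M < 3 * M
  lem M 1≤M = subst (_≤ 3 * M) (ℕₚ.+-comm (2 * M) 1) (subst (2 * M + 1 ≤_) (lem′ M) (ℕₚ.+-monoʳ-≤ (2 * M) 1≤M))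
    where
    lem′ : ∀ M → 2 * M + M ≡ 3 * M
    lem′ = solve-∀
balanced-split {c} {M = M} T@(graft {d = d} {xs} {ys} t u e) us paths eq 2≤M le with M ≤? 3 * length us
... | yes M≤ = split c us (ys ++ xs) paths (root-path T) (root-∈ T) ↭-refl le (complement-size {length us} eq M≤)
... | no M≰ with 3 * (length us + length ys) ≤? 2 * M
...   | yes fits = record { Split rest ; perm = ↭-trans (Split.perm rest) perm′ }
  where
  perm′ : (ys ++ us) ++ xs ↭ us ++ (ys ++ xs)
  perm′ = ↭-trans (Permₚ.++⁺ʳ xs (Permₚ.++-comm ys us)) (Permₚ.++-assoc us ys xs)
  paths′ : ∀ {a} → a ∈ ys ++ us → Path (c ∷ ys ++ us) c a
  paths′ a∈ with ∈-++⁻ ys a∈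
  ... | inj₁ a∈ys = step e (there (∈-++⁺ˡ (root-∈ u))) (path-⊆ (there ∘ ∈-++⁺ˡ) (root-path u a∈ys))
  ... | inj₂ a∈us = path-⊆ (λ { (here p) → here p ; (there p) → there (∈-++⁺ʳ ys p) }) (paths a∈us)
  lenyu : length (ys ++ us) ≡ length us + length ys
  lenyu = trans (Listₚ.length-++ ys) (ℕₚ.+-comm (length ys) _)
  rest : Split M ((ys ++ us) ++ xs)
  rest = balanced-split t (ys ++ us) paths′
    (trans (cong (_+ length xs) lenyu) (trans (ℕₚ.+-assoc (length us) _ _) (trans (cong (length us +_) (sym (Listₚ.length-++ ys))) eq)))
    2≤M (subst (λ n → 3 * n ≤ 2 * M) (sym lenyu) fits)
...   | no ¬fits with 3 * length ys ≤? 2 * M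
...     | yes ys≤ = split c ys (us ++ xs)
            (λ a∈ → step e (there (root-∈ u)) (path-⊆ there (root-path u a∈)))
            paths-ux (∈-++⁺ʳ us (root-∈ t)) perm′ ys≤ (complement-size {length ys} (size-ux eq) (branch-size {length us} (ℕₚ.≰⇒> M≰) (ℕₚ.≰⇒> ¬fits)))
  where
  perm′ : ys ++ (us ++ xs) ↭ us ++ (ys ++ xs)
  perm′ = ↭-trans (↭-sym (Permₚ.++-assoc ys us xs)) (↭-trans (Permₚ.++⁺ʳ xs (Permₚ.++-comm ys us)) (Permₚ.++-assoc us ys xs))
  size-ux : length us + length (ys ++ xs) ≡ suc M → length ys + length (us ++ xs) ≡ suc M
  size-ux eq = trans (sym (Listₚ.length-++ ys)) (trans (Permₚ.↭-length perm′) (trans (Listₚ.length-++ us) eq))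
  paths-ux : ∀ {a} → a ∈ us ++ xs → Path (us ++ xs) c a
  paths-ux a∈ with ∈-++⁻ us a∈
  ... | inj₁ p = path-⊆ (λ { (here refl) → ∈-++⁺ʳ us (root-∈ t) ; (there q) → ∈-++⁺ˡ q }) (paths p)
  ... | inj₂ p = path-⊆ (∈-++⁺ʳ us) (root-path t p)
...     | no ys≰ = record { Split rest ; perm = ↭-trans (Split.perm rest) perm′ }
  where
  perm′ : (us ++ xs) ++ ys ↭ us ++ (ys ++ xs)
  perm′ = ↭-trans (Permₚ.++-assoc us xs ys) (Permₚ.++⁺ˡ us (Permₚ.++-comm xs ys))
  paths-ux : ∀ {a} → a ∈ us ++ xs → Path (us ++ xs) c a
  paths-ux a∈ with ∈-++⁻ us a∈
  ... | inj₁ p = path-⊆ (λ { (here refl) → ∈-++⁺ʳ us (root-∈ t) ; (there q) → ∈-++⁺ˡ q }) (paths p)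
  ... | inj₂ p = path-⊆ (∈-++⁺ʳ us) (root-path t p)
  size-ux : length (us ++ xs) + length ys ≡ suc M
  size-ux = trans (sym (Listₚ.length-++ (us ++ xs))) (trans (Permₚ.↭-length perm′) (trans (Listₚ.length-++ us) eq))
  rest : Split M ((us ++ xs) ++ ys)
  rest = balanced-split u (us ++ xs)
    (λ a∈ → step (adj-sym e) (there (∈-++⁺ʳ us (root-∈ t))) (path-⊆ there (paths-ux a∈)))
    size-ux 2≤M (remainder-size {length ys} (trans (ℕₚ.+-comm (length ys) _) size-ux) (ℕₚ.≰⇒> ys≰) 2≤M)

-- Submultiplicativity up to a quasi-polynomial factor

normalise-shift : ∀ {n t P zs} → Standard n P → Shift t P zs → normalise zs ≡ P
normalise-shift {P = []} std _ with () ← Standard.0∈ std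
normalise-shift {t = t} {P@(p ∷ ps)} {zs} std (f , g) with standard-head std
... | refl = trans (cong recentre canon≡) (trans (sym (Listₚ.map-∘ P)) (trans (Listₚ.map-cong back P) (Listₚ.map-id P)))
  where
  canon≡ : canon zs ≡ map (translate t) P
  canon≡ = sorted-ext (canon-sorted zs) (APₚ.map⁺ (AP.map (translate-mono t) (Standard.sorted std)))
    (λ {a} a∈ → subst (_∈ map (translate t) P) (neg-translate t a) (∈-map⁺ (translate t) (g (∈-canon⁻ zs a∈))))
    (λ a∈ → let d , d∈ , eq = ∈-map⁻ (translate t) {xs = P} a∈ in subst (_∈ canon zs) (sym eq) (∈-canon⁺ (f d∈)))
  back : ∀ c → translate (negᶜ (translate t 0ᶜ)) (translate t c) ≡ c
  back c = trans (cong (λ s → translate (negᶜ s) (translate t c)) (translate-of-0 t)) (translate-neg t c)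

shift-to-origin : ∀ {s c xs ys} → Shift s xs ys → Shift (negᶜ c) xs (map (translate (negᶜ (translate s c))) ys)
shift-to-origin {s} {c} {xs} {ys} sh = subst (λ t → Shift t xs (map (translate (negᶜ (translate s c))) ys)) eq (shift-trans sh (shift-map (negᶜ (translate s c)) ys))
  where
  eq : translate (negᶜ (translate s c)) s ≡ negᶜ c
  eq = translate-injective (translate s c) {translate (negᶜ (translate s c)) s} {negᶜ c} (trans (neg-translate (translate s c) s)
    (sym (trans (sym (translate-assoc s c (negᶜ c))) (trans (cong (translate s) c-c) (translate-of-0 s)))))
    where
    c-c : translate c (negᶜ c) ≡ 0ᶜ
    c-c = trans (cong (translate c) (sym (translate-of-0 (negᶜ c)))) (neg-translate c 0ᶜ)

shift-∪ : ∀ {t P A B A′ B′} → (∀ {a} → a ∈ P → a ∈ A ⊎ a ∈ B) → (∀ {a} → a ∈ A → a ∈ P) → (∀ {a} → a ∈ B → a ∈ P) →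
  Shift t A A′ → Shift t B B′ → Shift t P (A′ ++ B′)
shift-∪ {A′ = A′} cover A⊆ B⊆ (f , g) (f′ , g′) =
  (λ a∈ → [ ∈-++⁺ˡ ∘ f , ∈-++⁺ʳ A′ ∘ f′ ]′ (cover a∈)) ,
  (λ a∈ → [ A⊆ ∘ g , B⊆ ∘ g′ ]′ (∈-++⁻ A′ a∈))

Pointed : Set
Pointed = List Cell × Cell

centre : Pointed → List Cell
centre (X , v) = map (translate (negᶜ v)) X

-- Both marked cells are moved to the origin, where the pieces overlap; normalising merges the
-- repeated pivot and restores the normal form.
glue : ℕ × Pointed × Pointed → List Cell
glue (_ , X , Y) = normalise (centre X ++ centre Y)

module _ {b : ℕ → ℕ} (E : ∀ n → Enumeration (suc n) (b n)) where

  pointed : ℕ → List Pointed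
  pointed j = pairs (list (E j)) id

  length-pointed : ∀ j → length (pointed j) ≡ b j * suc j
  length-pointed j = trans (sym (∑-1 (pointed j))) (trans (∑-pairs (list (E j)) id)
    (trans (∑-cong (list (E j)) len)
      (trans (∑-const (list (E j)) (suc j)) (cong (_* suc j) (card (E j))))))
    where
    len : ∀ {P} → P ∈ list (E j) → ∑ P (λ _ → 1) ≡ suc j
    len {P} P∈ = trans (∑-1 P) (Standard.len (sound (E j) P∈))

  Balanced : ℕ → ℕ → Set
  Balanced M j = 3 * j ≤ 2 * M × 3 * (M ∸ j) ≤ 2 * M

  balanced? : ∀ M → Decidable (Balanced M)
  balanced? M j = (3 * j ≤? 2 * M) ×-dec (3 * (M ∸ j) ≤? 2 * M)

  sizes : ℕ → List ℕ
  sizes M = filter (balanced? M) (upTo (suc M))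

  codes : ℕ → List (ℕ × Pointed × Pointed)
  codes M = pairs (sizes M) (λ j → pairs (pointed j) (λ _ → pointed (M ∸ j)))

  covered : ∀ {M P} → 2 ≤ M → P ∈ list (E M) → ∃ λ q → q ∈ codes M × glue q ≡ P
  covered {M} {P} 2≤M P∈ with spanning-tree (Standard.conn std) (sorted-unique (Standard.sorted std)) (Standard.0∈ std)
    where std = sound (E M) P∈
  ... | zs , tree , uzs , zs⊆ , len with balanced-split tree [] (λ ()) (trans len (Standard.len (sound (E M) P∈))) 2≤M z≤n
  ... | split v us xs path-us path-xs v∈ perm us≤ xs≤ = (j , (normalise (v ∷ us) , translate s v) , (normalise xs , translate t v)) , code∈ ,
      normalise-shift std (shift-∪ cover A⊆ B⊆ (shift-to-origin {s} {v} shX) (shift-to-origin {t} {v} shY))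
    where
    std = sound (E M) P∈
    j = length us
    u-all : Unique (us ++ xs)
    u-all = unique-↭ (Perm.↭-sym perm) uzs
    total : length us + length xs ≡ suc M
    total = trans (sym (Listₚ.length-++ us)) (trans (Permₚ.↭-length perm) (trans len (Standard.len std)))
    u-us : ∀ us → Unique (us ++ xs) → v ∈ xs → Unique (v ∷ us)
    u-us []       _        _  = [] ∷ []
    u-us (a ∷ us) (a# ∷ u) v∈ with u-us us u v∈
    ... | v# ∷ u′ = ((λ { refl → All.lookup a# (∈-++⁺ʳ us v∈) refl }) ∷ v#) ∷ Allₚ.++⁻ˡ us a# ∷ u′
    u-xs : ∀ us → Unique (us ++ xs) → Unique xs
    u-xs []       u       = u
    u-xs (_ ∷ us) (_ ∷ u) = u-xs us u
    j≤M : j ≤ M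
    j≤M = ℕₚ.≤-pred (subst (suc j ≤_) (trans (ℕₚ.+-comm (length xs) j) total) (ℕₚ.+-monoˡ-≤ j (∈-length v∈)))
    len-xs : length xs ≡ suc (M ∸ j)
    len-xs = ℕₚ.+-cancelˡ-≡ j _ _ (trans total (sym (trans (ℕₚ.+-suc j (M ∸ j)) (cong suc (ℕₚ.m+[n∸m]≡n j≤M)))))
    X = normalise-standard (v ∷ us) (u-us us u-all v∈) (connected-from v (here refl) (λ { (here refl) → stop ; (there a∈) → path-us a∈ })) refl
    Y = normalise-standard xs (u-xs us u-all) (connected-from v v∈ path-xs) len-xs
    s = proj₁ (proj₂ X)
    t = proj₁ (proj₂ Y)
    shX = proj₂ (proj₂ X)
    shY = proj₂ (proj₂ Y)
    bal : Balanced M j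
    bal = us≤ , ℕₚ.+-cancelʳ-≤ 3 _ _ (subst (_≤ 2 * M + 3) (trans (cong (3 *_) len-xs) (trans (ℕₚ.*-suc 3 (M ∸ j)) (ℕₚ.+-comm 3 _))) xs≤)
    code∈ : (j , (normalise (v ∷ us) , translate s v) , (normalise xs , translate t v)) ∈ codes M
    code∈ = ∈-pairs⁺ (∈-filter⁺ (balanced? M) (∈-upTo⁺ (s≤s j≤M)) bal)
      (∈-pairs⁺ (∈-pairs⁺ (complete (E j) (proj₁ X)) (proj₁ shX (here refl)))
                (∈-pairs⁺ (complete (E (M ∸ j)) (proj₁ Y)) (proj₁ shY v∈)))
    back : ∀ {a} → a ∈ us ++ xs → a ∈ P
    back a∈ = zs⊆ (Permₚ.∈-resp-↭ perm a∈)
    P⊆zs : ∀ {a} → a ∈ P → a ∈ zs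
    P⊆zs {a} a∈ with a ∈? zs
    ... | yes p = p
    ... | no ¬p = ⊥-elim (ℕₚ.<-irrefl len (length-⊆ {xs = a ∷ zs} (All.tabulate (λ { q refl → ¬p q }) ∷ uzs) (λ { (here refl) → a∈ ; (there q) → zs⊆ q })))
    cover : ∀ {a} → a ∈ P → a ∈ v ∷ us ⊎ a ∈ xs
    cover a∈ = [ inj₁ ∘ there , inj₂ ]′ (∈-++⁻ us (Permₚ.∈-resp-↭ (Perm.↭-sym perm) (P⊆zs a∈)))
    A⊆ : ∀ {a} → a ∈ v ∷ us → a ∈ P
    A⊆ (here refl) = back (∈-++⁺ʳ us v∈)
    A⊆ (there a∈)  = back (∈-++⁺ˡ a∈)
    B⊆ : ∀ {a} → a ∈ xs → a ∈ P
    B⊆ a∈ = back (∈-++⁺ʳ us a∈)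

  -- One factor `suc M` counts the sizes `j`, the other two the marked cells of the two parts.
  split-bound : ∀ {M X} → 2 ≤ M → (∀ {j} → j ≤ M → Balanced M j → b j * b (M ∸ j) ≤ X) → b M ≤ suc M * (suc M * suc M * X)
  split-bound {M} {X} 2≤M h = begin
    b M                             ≡⟨ sym (card (E M)) ⟩
    length (list (E M))             ≤⟨ length-cover (codes M) glue (unique (E M)) (covered 2≤M) ⟩
    length (codes M)                ≡⟨ trans (sym (∑-1 (codes M))) (∑-pairs (sizes M) _) ⟩
    ∑ (sizes M) (λ j → ∑ (pairs (pointed j) (λ _ → pointed (M ∸ j))) (λ _ → 1))
                                    ≤⟨ ∑-≤-const (sizes M) (suc M * suc M * X) each ⟩
    length (sizes M) * (suc M * suc M * X)
                                    ≤⟨ ℕₚ.*-monoˡ-≤ _ (ℕₚ.≤-trans (Listₚ.length-filter (balanced? M) (upTo (suc M))) (ℕₚ.≤-reflexive (Listₚ.length-upTo (suc M)))) ⟩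
    suc M * (suc M * suc M * X)     ∎
    where
    open ℕₚ.≤-Reasoning
    each : ∀ {j} → j ∈ sizes M → ∑ (pairs (pointed j) (λ _ → pointed (M ∸ j))) (λ _ → 1) ≤ suc M * suc M * X
    each {j} j∈ with ∈-filter⁻ (balanced? M) {xs = upTo (suc M)} j∈
    ... | j∈′ , bal with ℕₚ.≤-pred (∈-upTo⁻ j∈′)
    ... | j≤M = begin
      ∑ (pairs (pointed j) (λ _ → pointed (M ∸ j))) (λ _ → 1)
        ≡⟨ trans (∑-pairs (pointed j) _) (∑-const (pointed j) _) ⟩
      length (pointed j) * ∑ (pointed (M ∸ j)) (λ _ → 1)
        ≡⟨ cong₂ _*_ (length-pointed j) (trans (∑-1 (pointed (M ∸ j))) (length-pointed (M ∸ j))) ⟩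
      b j * suc j * (b (M ∸ j) * suc (M ∸ j))
        ≤⟨ ℕₚ.*-mono-≤ (ℕₚ.*-monoʳ-≤ (b j) (s≤s j≤M)) (ℕₚ.*-monoʳ-≤ (b (M ∸ j)) (s≤s (ℕₚ.m∸n≤m M j))) ⟩
      b j * suc M * (b (M ∸ j) * suc M)
        ≡⟨ lem (b j) (b (M ∸ j)) (suc M) ⟩
      suc M * suc M * (b j * b (M ∸ j))
        ≤⟨ ℕₚ.*-monoʳ-≤ (suc M * suc M) (h j≤M bal) ⟩
      suc M * suc M * X ∎
      where
      lem : ∀ x y m → x * m * (y * m) ≡ m * m * (x * y)
      lem = solve-∀

  b0-positive : 1 ≤ b 0
  b0-positive = subst (1 ≤_) (card (E 0)) (∈-length (complete (E 0) single))
    where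
    single : Standard 1 (0ᶜ ∷ [])
    single = standard ([] ∷ []) (here refl) (λ { (here refl) → <ᶜ-irrefl }) (λ { (here refl) (here refl) → stop }) refl

  supermult : ∀ j k → b j * b k ≤ b (j + k)
  supermult j k = supermultiplicative (E j) (E k) (E (j + k))

  -- Balanced parts j and M - j need not match p and q. If j ≤ q, the other part is cut inductively
  -- into p and q - j, and supermultiplicativity merges j with q - j into q; if j > q, the part j is
  -- cut into q and j - q, and j - q merges with M - j into p. Only one part is ever cut again, so
  -- each of the at most `d` levels of shrinking by 2/3 costs a single factor `K`.
  submult : ∀ K d M → M * 2 ^ d ≤ 3 ^ d → suc M * (suc M * suc M) ≤ K → ∀ p q → p + q ≡ M → b M ≤ K ^ d * (b p * b q)
  submult K d M Md≤ M³≤ p q eq with 2 ≤? M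
  submult K d M Md≤ M³≤ p q eq | no M≱2 = ℕₚ.≤-trans (trivial p q eq) (ℕₚ.m≤n*m _ (K ^ d) {{ℕₚ.m^n≢0 K d {{>-nonZero (ℕₚ.≤-trans (s≤s z≤n) M³≤)}}}})
    where
    trivial : ∀ p q → p + q ≡ M → b M ≤ b p * b q
    trivial zero q refl = ℕₚ.≤-trans (ℕₚ.≤-reflexive (sym (ℕₚ.*-identityˡ (b q)))) (ℕₚ.*-monoˡ-≤ (b q) b0-positive)
    trivial p zero refl = subst (λ n → b n ≤ b p * b 0) (sym (ℕₚ.+-identityʳ p)) (ℕₚ.≤-trans (ℕₚ.≤-reflexive (sym (ℕₚ.*-identityʳ (b p)))) (ℕₚ.*-monoʳ-≤ (b p) b0-positive))
    trivial (suc p) (suc q) refl = ⊥-elim (M≱2 (s≤s (subst (1 ≤_) (sym (ℕₚ.+-suc p q)) (s≤s z≤n))))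
  submult K zero M Md≤ M³≤ p q eq | yes 2≤M = ⊥-elim (ℕₚ.<⇒≱ 2≤M (subst (_≤ 1) (ℕₚ.*-identityʳ M) Md≤))
  submult K (suc d) M Md≤ M³≤ p q eq | yes 2≤M = begin
    b M                           ≤⟨ split-bound 2≤M each ⟩
    suc M * (suc M * suc M * X)   ≡⟨ sym (ℕₚ.*-assoc (suc M) (suc M * suc M) X) ⟩
    suc M * (suc M * suc M) * X   ≤⟨ ℕₚ.*-monoˡ-≤ X M³≤ ⟩
    K * X                         ≡⟨ sym (ℕₚ.*-assoc K (K ^ d) _) ⟩
    K * K ^ d * (b p * b q)       ∎
    where
    open ℕₚ.≤-Reasoning
    X = K ^ d * (b p * b q)
    small : ∀ {j} → 3 * j ≤ 2 * M → j * 2 ^ d ≤ 3 ^ d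
    small {j} le = ℕₚ.*-cancelˡ-≤ 3 (begin
      3 * (j * 2 ^ d)   ≡⟨ sym (ℕₚ.*-assoc 3 j _) ⟩
      3 * j * 2 ^ d     ≤⟨ ℕₚ.*-monoˡ-≤ (2 ^ d) le ⟩
      2 * M * 2 ^ d     ≡⟨ lem M (2 ^ d) ⟩
      M * (2 * 2 ^ d)   ≤⟨ Md≤ ⟩
      3 * 3 ^ d         ∎)
      where
      lem : ∀ a c → 2 * a * c ≡ a * (2 * c)
      lem = solve-∀
    cube : ∀ {j} → j ≤ M → suc j * (suc j * suc j) ≤ K
    cube le = ℕₚ.≤-trans (ℕₚ.*-mono-≤ (s≤s le) (ℕₚ.*-mono-≤ (s≤s le) (s≤s le))) M³≤
    each : ∀ {j} → j ≤ M → Balanced M j → b j * b (M ∸ j) ≤ X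
    each {j} j≤M (s₁ , s₂) with j ≤? q
    ... | yes j≤q = begin
      b j * b (M ∸ j)
        ≤⟨ ℕₚ.*-monoʳ-≤ (b j) (submult K d (M ∸ j) (small {M ∸ j} s₂) (cube (ℕₚ.m∸n≤m M j)) p (q ∸ j) (sym (trans (cong (_∸ j) (sym eq)) (ℕₚ.+-∸-assoc p j≤q)))) ⟩
      b j * (K ^ d * (b p * b (q ∸ j)))
        ≡⟨ lem (b j) (K ^ d) (b p) (b (q ∸ j)) ⟩
      K ^ d * (b p * (b j * b (q ∸ j)))
        ≤⟨ ℕₚ.*-monoʳ-≤ (K ^ d) (ℕₚ.*-monoʳ-≤ (b p) (subst (λ n → b j * b (q ∸ j) ≤ b n) (ℕₚ.m+[n∸m]≡n j≤q) (supermult j (q ∸ j)))) ⟩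
      X ∎
      where
      lem : ∀ x k y z → x * (k * (y * z)) ≡ k * (y * (x * z))
      lem = solve-∀
    ... | no j≰q = begin
      b j * b (M ∸ j)
        ≤⟨ ℕₚ.*-monoˡ-≤ (b (M ∸ j)) (submult K d j (small {j} s₁) (cube j≤M) q (j ∸ q) (ℕₚ.m+[n∸m]≡n q≤j)) ⟩
      K ^ d * (b q * b (j ∸ q)) * b (M ∸ j)
        ≡⟨ lem (K ^ d) (b q) (b (j ∸ q)) (b (M ∸ j)) ⟩
      K ^ d * ((b (j ∸ q) * b (M ∸ j)) * b q)
        ≤⟨ ℕₚ.*-monoʳ-≤ (K ^ d) (ℕₚ.*-monoˡ-≤ (b q) (subst (λ n → b (j ∸ q) * b (M ∸ j) ≤ b n) rest (supermult (j ∸ q) (M ∸ j)))) ⟩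
      X ∎
      where
      q≤j : q ≤ j
      q≤j = ℕₚ.<⇒≤ (ℕₚ.≰⇒> j≰q)
      lem : ∀ k x y z → k * (x * y) * z ≡ k * ((y * z) * x)
      lem = solve-∀
      rest : (j ∸ q) + (M ∸ j) ≡ p
      rest = ℕₚ.+-cancelʳ-≡ q _ _ (trans (lem′ (j ∸ q) (M ∸ j) q) (trans (cong (_+ (M ∸ j)) (ℕₚ.m+[n∸m]≡n q≤j)) (trans (ℕₚ.m+[n∸m]≡n j≤M) (sym eq))))
        where
        lem′ : ∀ a c q → a + c + q ≡ (q + a) + c
        lem′ = solve-∀

-- Exploration

laterals : Dir → List Dir
laterals x⁺ = y⁺ ∷ y⁻ ∷ z⁺ ∷ z⁻ ∷ []
laterals x⁻ = y⁺ ∷ y⁻ ∷ z⁺ ∷ z⁻ ∷ []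
laterals y⁺ = x⁺ ∷ x⁻ ∷ z⁺ ∷ z⁻ ∷ []
laterals y⁻ = x⁺ ∷ x⁻ ∷ z⁺ ∷ z⁻ ∷ []
laterals z⁺ = x⁺ ∷ x⁻ ∷ y⁺ ∷ y⁻ ∷ []
laterals z⁻ = x⁺ ∷ x⁻ ∷ y⁺ ∷ y⁻ ∷ []

private
  ∈₁ : ∀ {A : Set} {a b c d : A} → a ∈ a ∷ b ∷ c ∷ d ∷ []
  ∈₁ = here refl
  ∈₂ : ∀ {A : Set} {a b c d : A} → b ∈ a ∷ b ∷ c ∷ d ∷ []
  ∈₂ = there (here refl)
  ∈₃ : ∀ {A : Set} {a b c d : A} → c ∈ a ∷ b ∷ c ∷ d ∷ []
  ∈₃ = there (there (here refl))
  ∈₄ : ∀ {A : Set} {a b c d : A} → d ∈ a ∷ b ∷ c ∷ d ∷ []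
  ∈₄ = there (there (there (here refl)))

  pattern at₁ = here refl
  pattern at₂ = there (here refl)
  pattern at₃ = there (there (here refl))
  pattern at₄ = there (there (there (here refl)))

laterals-sym : ∀ {d} e → d ∈ laterals e → e ∈ laterals d × opp e ∈ laterals d
laterals-sym x⁺ at₁ = ∈₁ , ∈₂
laterals-sym x⁺ at₂ = ∈₁ , ∈₂
laterals-sym x⁺ at₃ = ∈₁ , ∈₂
laterals-sym x⁺ at₄ = ∈₁ , ∈₂
laterals-sym x⁻ at₁ = ∈₂ , ∈₁
laterals-sym x⁻ at₂ = ∈₂ , ∈₁
laterals-sym x⁻ at₃ = ∈₂ , ∈₁
laterals-sym x⁻ at₄ = ∈₂ , ∈₁
laterals-sym y⁺ at₁ = ∈₁ , ∈₂
laterals-sym y⁺ at₂ = ∈₁ , ∈₂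
laterals-sym y⁺ at₃ = ∈₃ , ∈₄
laterals-sym y⁺ at₄ = ∈₃ , ∈₄
laterals-sym y⁻ at₁ = ∈₂ , ∈₁
laterals-sym y⁻ at₂ = ∈₂ , ∈₁
laterals-sym y⁻ at₃ = ∈₄ , ∈₃
laterals-sym y⁻ at₄ = ∈₄ , ∈₃
laterals-sym z⁺ at₁ = ∈₃ , ∈₄
laterals-sym z⁺ at₂ = ∈₃ , ∈₄
laterals-sym z⁺ at₃ = ∈₃ , ∈₄
laterals-sym z⁺ at₄ = ∈₃ , ∈₄
laterals-sym z⁻ at₁ = ∈₄ , ∈₃
laterals-sym z⁻ at₂ = ∈₄ , ∈₃
laterals-sym z⁻ at₃ = ∈₄ , ∈₃
laterals-sym z⁻ at₄ = ∈₄ , ∈₃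

opp-≢ : ∀ e → opp e ≢ e
opp-≢ x⁺ ()
opp-≢ x⁻ ()
opp-≢ y⁺ ()
opp-≢ y⁻ ()
opp-≢ z⁺ ()
opp-≢ z⁻ ()

vec-dir : Cell → Dir
vec-dir (ℤ.pos 0 , ℤ.pos 0 , ℤ.pos _)        = z⁺
vec-dir (ℤ.pos 0 , ℤ.pos 0 , ℤ.negsuc _)     = z⁻
vec-dir (ℤ.pos 0 , ℤ.pos (suc _) , _)        = y⁺
vec-dir (ℤ.pos 0 , ℤ.negsuc _ , _)           = y⁻
vec-dir (ℤ.pos (suc _) , _ , _)              = x⁺
vec-dir (ℤ.negsuc _ , _ , _)                 = x⁻

vec-dir-vec : ∀ d → vec-dir (vec d) ≡ d
vec-dir-vec x⁺ = refl
vec-dir-vec x⁻ = refl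
vec-dir-vec y⁺ = refl
vec-dir-vec y⁻ = refl
vec-dir-vec z⁺ = refl
vec-dir-vec z⁻ = refl

translate-swap : ∀ s t → translate s t ≡ translate t s
translate-swap (a , b , c) (x , y , z) = cell-≡ (ℤₚ.+-comm x a) (ℤₚ.+-comm y b) (ℤₚ.+-comm z c)

move-injective : ∀ c {d d′} → move d c ≡ move d′ c → d ≡ d′
move-injective c {d} {d′} eq = trans (sym (vec-dir-vec d)) (trans (cong vec-dir vec≡) (vec-dir-vec d′))
  where
  vec≡ : vec d ≡ vec d′
  vec≡ = translate-injective c {vec d} {vec d′} (trans (translate-swap c (vec d)) (trans eq (translate-swap (vec d′) c)))

laterals-unique : ∀ e → Unique (laterals e)
laterals-unique x⁺ = ((λ ()) ∷ (λ ()) ∷ (λ ()) ∷ []) ∷ ((λ ()) ∷ (λ ()) ∷ []) ∷ ((λ ()) ∷ []) ∷ [] ∷ []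
laterals-unique x⁻ = ((λ ()) ∷ (λ ()) ∷ (λ ()) ∷ []) ∷ ((λ ()) ∷ (λ ()) ∷ []) ∷ ((λ ()) ∷ []) ∷ [] ∷ []
laterals-unique y⁺ = ((λ ()) ∷ (λ ()) ∷ (λ ()) ∷ []) ∷ ((λ ()) ∷ (λ ()) ∷ []) ∷ ((λ ()) ∷ []) ∷ [] ∷ []
laterals-unique y⁻ = ((λ ()) ∷ (λ ()) ∷ (λ ()) ∷ []) ∷ ((λ ()) ∷ (λ ()) ∷ []) ∷ ((λ ()) ∷ []) ∷ [] ∷ []
laterals-unique z⁺ = ((λ ()) ∷ (λ ()) ∷ (λ ()) ∷ []) ∷ ((λ ()) ∷ (λ ()) ∷ []) ∷ ((λ ()) ∷ []) ∷ [] ∷ []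
laterals-unique z⁻ = ((λ ()) ∷ (λ ()) ∷ (λ ()) ∷ []) ∷ ((λ ()) ∷ (λ ()) ∷ []) ∷ ((λ ()) ∷ []) ∷ [] ∷ []

length-laterals : ∀ e → length (laterals e) ≡ 4
length-laterals x⁺ = refl
length-laterals x⁻ = refl
length-laterals y⁺ = refl
length-laterals y⁻ = refl
length-laterals z⁺ = refl
length-laterals z⁻ = refl

e∉laterals : ∀ e → e ∉ laterals e
e∉laterals x⁺ (there (there (there (there ()))))
e∉laterals x⁻ (there (there (there (there ()))))
e∉laterals y⁺ (there (there (there (there ()))))
e∉laterals y⁻ (there (there (there (there ()))))
e∉laterals z⁺ (there (there (there (there ()))))
e∉laterals z⁻ (there (there (there (there ()))))

data Position (e : Dir) : Dir → Set where
  ahead : Position e e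
  behind     : Position e (opp e)
  sideways  : ∀ {d} → d ∈ laterals e → Position e d

position : ∀ e d → Position e d
position x⁺ x⁺ = ahead
position x⁺ x⁻ = behind
position x⁺ y⁺ = sideways ∈₁
position x⁺ y⁻ = sideways ∈₂
position x⁺ z⁺ = sideways ∈₃
position x⁺ z⁻ = sideways ∈₄
position x⁻ x⁺ = behind
position x⁻ x⁻ = ahead
position x⁻ y⁺ = sideways ∈₁
position x⁻ y⁻ = sideways ∈₂
position x⁻ z⁺ = sideways ∈₃
position x⁻ z⁻ = sideways ∈₄
position y⁺ x⁺ = sideways ∈₁
position y⁺ x⁻ = sideways ∈₂
position y⁺ y⁺ = ahead
position y⁺ y⁻ = behind
position y⁺ z⁺ = sideways ∈₃
position y⁺ z⁻ = sideways ∈₄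
position y⁻ x⁺ = sideways ∈₁
position y⁻ x⁻ = sideways ∈₂
position y⁻ y⁺ = behind
position y⁻ y⁻ = ahead
position y⁻ z⁺ = sideways ∈₃
position y⁻ z⁻ = sideways ∈₄
position z⁺ x⁺ = sideways ∈₁
position z⁺ x⁻ = sideways ∈₂
position z⁺ y⁺ = sideways ∈₃
position z⁺ y⁻ = sideways ∈₄
position z⁺ z⁺ = ahead
position z⁺ z⁻ = behind
position z⁻ x⁺ = sideways ∈₁
position z⁻ x⁻ = sideways ∈₂
position z⁻ y⁺ = sideways ∈₃
position z⁻ y⁻ = sideways ∈₄
position z⁻ z⁺ = behind
position z⁻ z⁻ = ahead

sublists : ∀ {A : Set} → List A → List (List A)
sublists []       = [] ∷ []
sublists (d ∷ ds) = map (d ∷_) (sublists ds) ++ sublists ds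

filter-∈-sublists : ∀ {A : Set} {P : A → Set} (P? : Decidable P) ds → filter P? ds ∈ sublists ds
filter-∈-sublists P? []       = here refl
filter-∈-sublists P? (d ∷ ds) with does (P? d)
... | true  = ∈-++⁺ˡ (∈-map⁺ (d ∷_) (filter-∈-sublists P? ds))
... | false = ∈-++⁺ʳ (map (d ∷_) (sublists ds)) (filter-∈-sublists P? ds)

sublists-⊆ : ∀ {A : Set} (ds : List A) {T} → T ∈ sublists ds → ∀ {d} → d ∈ T → d ∈ ds
sublists-⊆ [] (here refl) ()
sublists-⊆ (d ∷ ds) T∈ a∈ with ∈-++⁻ (map (d ∷_) (sublists ds)) T∈
... | inj₂ T∈′ = there (sublists-⊆ ds T∈′ a∈)
... | inj₁ T∈′ with ∈-map⁻ (d ∷_) T∈′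
sublists-⊆ (d ∷ ds) T∈ (here refl) | inj₁ _ | U , U∈ , refl = here refl
sublists-⊆ (d ∷ ds) T∈ (there a∈)  | inj₁ _ | U , U∈ , refl = there (sublists-⊆ ds U∈ a∈)

-- The binomial theorem for sums over subsets, with denominators D cleared.
∑-sublists : ∀ {A : Set} D Y (ds : List A) {L} H G (x : List A → ℕ) → length ds ≤ L →
  (∀ {T} → T ∈ sublists ds → x T * (H * D ^ length T) ≤ G * Y ^ length T) →
  ∑ (sublists ds) x * (H * D ^ L) ≤ G * (D + Y) ^ L
∑-sublists D Y [] {L} H G x le h = begin
  (x [] + 0) * (H * D ^ L)    ≡⟨ lem (x []) H (D ^ L) ⟩
  x [] * (H * 1) * D ^ L      ≤⟨ ℕₚ.*-monoˡ-≤ (D ^ L) (h (here refl)) ⟩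
  G * 1 * D ^ L               ≡⟨ cong (_* D ^ L) (ℕₚ.*-identityʳ G) ⟩
  G * D ^ L                   ≤⟨ ℕₚ.*-monoʳ-≤ G (ℕₚ.^-monoˡ-≤ L (ℕₚ.m≤m+n D Y)) ⟩
  G * (D + Y) ^ L             ∎
  where
  open ℕₚ.≤-Reasoning
  lem : ∀ a h d → (a + 0) * (h * d) ≡ a * (h * 1) * d
  lem = solve-∀
∑-sublists D Y (d ∷ ds) {suc L} H G x (s≤s le) h = begin
  ∑ (map (d ∷_) (sublists ds) ++ sublists ds) x * (H * (D * D ^ L))
    ≡⟨ cong (_* (H * (D * D ^ L))) (trans (∑-++ (map (d ∷_) (sublists ds))) (cong (_+ ∑ (sublists ds) x) (∑-map (d ∷_) (sublists ds)))) ⟩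
  (∑ (sublists ds) (λ T → x (d ∷ T)) + ∑ (sublists ds) x) * (H * (D * D ^ L))
    ≡⟨ lem (∑ (sublists ds) (λ T → x (d ∷ T))) (∑ (sublists ds) x) H D (D ^ L) ⟩
  ∑ (sublists ds) (λ T → x (d ∷ T)) * (H * D * D ^ L) + D * (∑ (sublists ds) x * (H * D ^ L))
    ≤⟨ ℕₚ.+-mono-≤
        (∑-sublists D Y ds (H * D) (G * Y) (λ T → x (d ∷ T)) le
          (λ {T} T∈ → subst₂ _≤_ (cong (x (d ∷ T) *_) (sym (ℕₚ.*-assoc H D _))) (sym (ℕₚ.*-assoc G Y _)) (h (∈-++⁺ˡ (∈-map⁺ (d ∷_) T∈)))))
        (ℕₚ.*-monoʳ-≤ D (∑-sublists D Y ds H G x le (λ T∈ → h (∈-++⁺ʳ (map (d ∷_) (sublists ds)) T∈)))) ⟩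
  G * Y * (D + Y) ^ L + D * (G * (D + Y) ^ L)
    ≡⟨ lem′ G Y D ((D + Y) ^ L) ⟩
  G * ((D + Y) * (D + Y) ^ L) ∎
  where
  open ℕₚ.≤-Reasoning
  lem : ∀ a b h d l → (a + b) * (h * (d * l)) ≡ a * (h * d * l) + d * (b * (h * l))
  lem = solve-∀
  lem′ : ∀ g y d p → g * y * p + d * (g * p) ≡ g * ((d + y) * p)
  lem′ = solve-∀

-- k₀, k₁, k₂ guarantee that at least 0, 1, 2 of the four lateral neighbours of a queued cell are decided when it is processed.
data Kind : Set where
  k₀ k₁ k₂ : Kind

Entry : Set
Entry = Cell × Dir × Kind

Known : Kind → Cell → Dir → List Cell → Set
Known k₀ c e K = ⊤
Known k₁ c e K = ∃ λ d → d ∈ laterals e × move d c ∈ K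
Known k₂ c e K = ∃₂ λ d d′ → d ≢ d′ × (d ∈ laterals e × move d c ∈ K) × (d′ ∈ laterals e × move d′ c ∈ K)

-- An entry `(c , e , k)` is an occupied cell reached from its parent by a step in direction `e`.
-- Each entry is judged in the state in which its turn comes, with the neighbours of all earlier
-- entries already decided. This is how a straight child helps the lateral children queued behind
-- it.
Valid : List Entry → List Cell → Set
Valid [] K = ⊤
Valid ((c , e , k) ∷ Q) K =
  (c ∈ K × move (opp e) c ∈ K × (∀ d → move d (move (opp e) c) ∈ K) × Known k c e K) × Valid Q (nbrs c ++ K)

known-⊆ : ∀ k {c e K K′} → (∀ {a} → a ∈ K → a ∈ K′) → Known k c e K → Known k c e K′
known-⊆ k₀ s _ = tt
known-⊆ k₁ s (d , d∈ , p) = d , d∈ , s p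
known-⊆ k₂ s (d , d′ , ne , (d∈ , p) , (d′∈ , p′)) = d , d′ , ne , (d∈ , s p) , (d′∈ , s p′)

++-⊆ʳ : ∀ (xs : List Cell) {K K′ : List Cell} → (∀ {a} → a ∈ K → a ∈ K′) → ∀ {a} → a ∈ xs ++ K → a ∈ xs ++ K′
++-⊆ʳ xs s a∈ = [ ∈-++⁺ˡ , ∈-++⁺ʳ xs ∘ s ]′ (∈-++⁻ xs a∈)

valid-⊆ : ∀ Q {K K′} → (∀ {a} → a ∈ K → a ∈ K′) → Valid Q K → Valid Q K′
valid-⊆ [] s _ = tt
valid-⊆ ((c , e , k) ∷ Q) s ((c∈ , p∈ , np , kn) , v) = (s c∈ , s p∈ , s ∘ np , known-⊆ k s kn) , valid-⊆ Q (++-⊆ʳ (nbrs c) s) v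

children : Kind → Cell → List Dir → List Entry
children k c = map (λ d → move d c , d , k)

sites : Cell → List Dir → List Cell
sites c = map (λ d → move d c)

free : List Cell → Cell → Dir → List Dir
free K c e = filter (λ d → ¬? (move d c ∈? K)) (laterals e)

-- `K` holds the decided cells and `O` the occupied ones; `m` limits the number of cells processed.
-- The two families of branches leave the straight neighbour empty or occupy it. The second is tried
-- even if that neighbour was decided before, a surplus that an upper bound tolerates.
explore : ℕ → List Entry → List Cell → List Cell → List (List Cell)
explore m       []                K O = O ∷ []
explore zero    (_ ∷ _)           K O = []
explore (suc m) ((c , e , k) ∷ Q) K O =
  concatMap (λ T → explore m (children k₁ c T ++ Q) (nbrs c ++ K) (sites c T ++ O)) (sublists (free K c e)) ++
  concatMap (λ T → explore m ((move e c , e , k₀) ∷ children k₂ c T ++ Q) (nbrs c ++ K) (move e c ∷ sites c T ++ O)) (sublists (free K c e))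

-- (17, 13, 10) / 39 is a supersolution of y_k = (4/39) ((1 + y₁)^(4-k) + y₀ (1 + y₂)^(4-k)).
weight : Kind → ℕ
weight k₀ = 17
weight k₁ = 13
weight k₂ = 10

spare : Kind → ℕ
spare k₀ = 4
spare k₁ = 3
spare k₂ = 2

weights : List Entry → ℕ
weights []                = 1
weights ((_ , _ , k) ∷ Q) = weight k * weights Q

-- Each undecided lateral contributes a factor 1 + y: this is 52/39 with 52 = 39 + 13 if the
-- straight child is absent, and 49/39 with 49 = 39 + 10 if it is present, when it contributes 17/39
-- itself.
supersolution : ∀ k → 4 * (39 * 52 ^ spare k + 17 * 49 ^ spare k) ≤ 39 * weight k * 39 ^ spare k
supersolution k₀ = ℕₚ.≤ᵇ⇒≤ _ _ tt
supersolution k₁ = ℕₚ.≤ᵇ⇒≤ _ _ tt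
supersolution k₂ = ℕₚ.≤ᵇ⇒≤ _ _ tt

free-⊆ : ∀ K c e {d} → d ∈ free K c e → d ∈ laterals e × move d c ∉ K
free-⊆ K c e d∈ = ∈-filter⁻ (λ d → ¬? (move d c ∈? K)) {xs = laterals e} d∈

free-unique : ∀ K c e → Unique (free K c e)
free-unique K c e = Uniqueₚ.filter⁺ (λ d → ¬? (move d c ∈? K)) (laterals-unique e)

length-free : ∀ k {K c e} → Known k c e K → length (free K c e) ≤ spare k
length-free k₀ {K} {c} {e} _ = subst (length (free K c e) ≤_) (length-laterals e)
  (length-⊆ (free-unique K c e) (proj₁ ∘ free-⊆ K c e))
length-free k₁ {K} {c} {e} (d , d∈ , p) = ℕₚ.≤-pred (subst (suc (length (free K c e)) ≤_) (length-laterals e)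
  (length-⊆ (All.tabulate (λ { q refl → proj₂ (free-⊆ K c e q) p }) ∷ free-unique K c e)
    (λ { (here refl) → d∈ ; (there q) → proj₁ (free-⊆ K c e q) })))
length-free k₂ {K} {c} {e} (d , d′ , ne , (d∈ , p) , (d′∈ , p′)) = ℕₚ.≤-pred (ℕₚ.≤-pred (subst (suc (suc (length (free K c e))) ≤_) (length-laterals e)
  (length-⊆ ((ne ∷ All.tabulate (λ { q refl → proj₂ (free-⊆ K c e q) p })) ∷ All.tabulate (λ { q refl → proj₂ (free-⊆ K c e q) p′ }) ∷ free-unique K c e)
    (λ { (here refl) → d∈ ; (there (here refl)) → d′∈ ; (there (there q)) → proj₁ (free-⊆ K c e q) }))))

child-valid : ∀ {c K} d → c ∈ K → (∀ d′ → move d′ c ∈ K) →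
  move d c ∈ K × move (opp d) (move d c) ∈ K × (∀ d′ → move d′ (move (opp d) (move d c)) ∈ K)
child-valid {c} {K} d c∈ n∈ = n∈ d , subst (_∈ K) (sym (move-opp d c)) c∈ , λ d′ → subst (λ a → move d′ a ∈ K) (sym (move-opp d c)) (n∈ d′)

children-valid : ∀ k {c K Q} T → c ∈ K → (∀ d → move d c ∈ K) → (∀ {d} → d ∈ T → Known k (move d c) d K) →
  Valid Q K → Valid (children k c T ++ Q) K
children-valid k [] c∈ n∈ kn v = v
children-valid k {c} {Q = Q} (d ∷ T) c∈ n∈ kn v with child-valid d c∈ n∈
... | p , q , r = (p , q , r , kn (here refl)) ,
  children-valid k T (∈-++⁺ʳ (nbrs (move d c)) c∈) (∈-++⁺ʳ (nbrs (move d c)) ∘ n∈)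
    (known-⊆ k (∈-++⁺ʳ (nbrs (move d c))) ∘ kn ∘ there) (valid-⊆ Q (∈-++⁺ʳ (nbrs (move d c))) v)

move-∈-nbrs : ∀ d c → move d c ∈ nbrs c
move-∈-nbrs d c = ∈-map⁺ (λ d → move d c) (∈-dirs d)

module Step {c e k Q K} (v : Valid ((c , e , k) ∷ Q) K) {T} (T⊆ : ∀ {d} → d ∈ T → d ∈ laterals e) where
  c∈ : c ∈ nbrs c ++ K
  c∈ = ∈-++⁺ʳ (nbrs c) (proj₁ (proj₁ v))
  n∈ : ∀ d → move d c ∈ nbrs c ++ K
  n∈ d = ∈-++⁺ˡ (move-∈-nbrs d c)
  -- The lateral child in direction d touches the neighbour in direction d of the parent of c.
  shared : ∀ {d} → d ∈ T → opp e ∈ laterals d × move (opp e) (move d c) ∈ K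
  shared {d} d∈ = proj₂ (laterals-sym e (T⊆ d∈)) , subst (_∈ K) (translate-comm (vec d) (vec (opp e)) c) (proj₁ (proj₂ (proj₂ (proj₁ v))) d)
  valid₁ : Valid (children k₁ c T ++ Q) (nbrs c ++ K)
  valid₁ = children-valid k₁ T c∈ n∈ (λ {d} d∈ → opp e , proj₁ (shared d∈) , ∈-++⁺ʳ (nbrs c) (proj₂ (shared d∈))) (proj₂ v)
  -- The second decided lateral of the child in direction `d` lies in direction `e`: it is also the
  -- neighbour in direction `d` of the straight child, whose neighbours are decided first.
  valid₂ : Valid ((move e c , e , k₀) ∷ children k₂ c T ++ Q) (nbrs c ++ K)
  valid₂ with child-valid e c∈ n∈
  ... | p , q , r = (p , q , r , tt) ,
    children-valid k₂ T (∈-++⁺ʳ (nbrs (move e c)) c∈) (∈-++⁺ʳ (nbrs (move e c)) ∘ n∈)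
      (λ {d} d∈ → opp e , e , opp-≢ e , (proj₁ (shared d∈) , ∈-++⁺ʳ (nbrs (move e c)) (∈-++⁺ʳ (nbrs c) (proj₂ (shared d∈)))) ,
        (proj₁ (laterals-sym e (T⊆ d∈)) , ∈-++⁺ˡ (subst (_∈ nbrs (move e c)) (translate-comm (vec d) (vec e) c) (move-∈-nbrs d (move e c)))))
      (valid-⊆ Q (∈-++⁺ʳ (nbrs (move e c))) (proj₂ v))

weights-children : ∀ k c T Q → weights (children k c T ++ Q) ≡ weight k ^ length T * weights Q
weights-children k c []      Q = sym (ℕₚ.*-identityˡ _)
weights-children k c (d ∷ T) Q = trans (cong (weight k *_) (weights-children k c T Q)) (sym (ℕₚ.*-assoc (weight k) _ _))

length-children : ∀ k c T Q → length (children k c T ++ Q) ≡ length T + length Q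
length-children k c T Q = trans (Listₚ.length-++ (children k c T)) (cong (_+ length Q) (Listₚ.length-map _ T))

length-concatMap : ∀ {A B : Set} (f : A → List B) xs → length (concatMap f xs) ≡ ∑ xs (length ∘ f)
length-concatMap f []       = refl
length-concatMap f (x ∷ xs) = trans (Listₚ.length-++ (f x)) (cong (length (f x) +_) (length-concatMap f xs))

-- In fractions: at most (39/4)^m outcomes times the product of `weight k` / 39 over the queue.
-- Processing a cell spends one factor 39/4, and `supersolution` says that this pays for its
-- children. The extra power `39 ^ L` clears the denominators of the sums over subsets and is
-- cancelled.
explore-bound : ∀ m Q {K} O → Valid Q K → length (explore m Q K O) * (4 ^ m * 39 ^ length Q) ≤ 39 ^ m * weights Q
explore-bound m [] O v = begin
  1 * (4 ^ m * 1)   ≡⟨ trans (ℕₚ.*-identityˡ _) (ℕₚ.*-identityʳ _) ⟩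
  4 ^ m             ≤⟨ ℕₚ.^-monoˡ-≤ m (ℕₚ.≤ᵇ⇒≤ 4 39 tt) ⟩
  39 ^ m            ≡⟨ sym (ℕₚ.*-identityʳ _) ⟩
  39 ^ m * 1        ∎
  where open ℕₚ.≤-Reasoning
explore-bound zero (_ ∷ _) O v = z≤n
explore-bound (suc m) ((c , e , k) ∷ Q) {K} O v = ℕₚ.*-cancelʳ-≤ _ _ (39 ^ L) {{ℕₚ.m^n≢0 39 L}} (begin
  length (concatMap f₁ S ++ concatMap f₂ S) * (4 * 4 ^ m * (39 * 39 ^ q)) * 39 ^ L
    ≡⟨ cong (λ n → n * (4 * 4 ^ m * (39 * 39 ^ q)) * 39 ^ L) (trans (Listₚ.length-++ (concatMap f₁ S)) (cong₂ _+_ (length-concatMap f₁ S) (length-concatMap f₂ S))) ⟩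
  (N₁ + N₂) * (4 * 4 ^ m * (39 * 39 ^ q)) * 39 ^ L
    ≡⟨ lem₁ N₁ N₂ (4 ^ m) (39 ^ q) (39 ^ L) ⟩
  4 * (39 * (N₁ * (4 ^ m * 39 ^ q * 39 ^ L)) + N₂ * (4 ^ m * (39 * 39 ^ q) * 39 ^ L))
    ≤⟨ ℕₚ.*-monoʳ-≤ 4 (ℕₚ.+-mono-≤ (ℕₚ.*-monoʳ-≤ 39 bound₁) bound₂) ⟩
  4 * (39 * (39 ^ m * w * 52 ^ L) + 39 ^ m * (17 * w) * 49 ^ L)
    ≡⟨ lem₂ (39 ^ m) w (52 ^ L) (49 ^ L) ⟩
  39 ^ m * w * (4 * (39 * 52 ^ L + 17 * 49 ^ L))
    ≤⟨ ℕₚ.*-monoʳ-≤ (39 ^ m * w) (supersolution k) ⟩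
  39 ^ m * w * (39 * weight k * 39 ^ L)
    ≡⟨ lem₃ (39 ^ m) w (weight k) (39 ^ L) ⟩
  39 * 39 ^ m * (weight k * w) * 39 ^ L ∎)
  where
  open ℕₚ.≤-Reasoning
  L = spare k
  q = length Q
  w = weights Q
  S = sublists (free K c e)
  f₁ f₂ : List Dir → List (List Cell)
  f₁ T = explore m (children k₁ c T ++ Q) (nbrs c ++ K) (sites c T ++ O)
  f₂ T = explore m ((move e c , e , k₀) ∷ children k₂ c T ++ Q) (nbrs c ++ K) (move e c ∷ sites c T ++ O)
  N₁ = ∑ S (length ∘ f₁)
  N₂ = ∑ S (length ∘ f₂)
  ≤L : length (free K c e) ≤ L
  ≤L = length-free k (proj₂ (proj₂ (proj₂ (proj₁ v))))
  T⊆ : ∀ {T} → T ∈ S → ∀ {d} → d ∈ T → d ∈ laterals e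
  T⊆ T∈ d∈ = proj₁ (free-⊆ K c e (sublists-⊆ (free K c e) T∈ d∈))
  lem₁ : ∀ a b x y l → (a + b) * (4 * x * (39 * y)) * l ≡ 4 * (39 * (a * (x * y * l)) + b * (x * (39 * y) * l))
  lem₁ = solve-∀
  lem₂ : ∀ x w a b → 4 * (39 * (x * w * a) + x * (17 * w) * b) ≡ x * w * (4 * (39 * a + 17 * b))
  lem₂ = solve-∀
  lem₃ : ∀ x w a l → x * w * (39 * a * l) ≡ 39 * x * (a * w) * l
  lem₃ = solve-∀
  bound₁ : N₁ * (4 ^ m * 39 ^ q * 39 ^ L) ≤ 39 ^ m * w * 52 ^ L
  bound₁ = ∑-sublists 39 13 (free K c e) (4 ^ m * 39 ^ q) (39 ^ m * w) (length ∘ f₁) ≤L λ {T} T∈ → begin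
    length (f₁ T) * (4 ^ m * 39 ^ q * 39 ^ length T)
      ≡⟨ cong (length (f₁ T) *_) (trans (lem (4 ^ m) (39 ^ q) (39 ^ length T)) (cong (4 ^ m *_) (trans (sym (ℕₚ.^-distribˡ-+-* 39 (length T) q)) (cong (39 ^_) (sym (length-children k₁ c T Q)))))) ⟩
    length (f₁ T) * (4 ^ m * 39 ^ length (children k₁ c T ++ Q))
      ≤⟨ explore-bound m (children k₁ c T ++ Q) (sites c T ++ O) (Step.valid₁ v (T⊆ T∈)) ⟩
    39 ^ m * weights (children k₁ c T ++ Q)
      ≡⟨ trans (cong (39 ^ m *_) (weights-children k₁ c T Q)) (lem′ (39 ^ m) (13 ^ length T) w) ⟩
    39 ^ m * w * 13 ^ length T ∎
    where
    lem : ∀ a b t → a * b * t ≡ a * (t * b)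
    lem = solve-∀
    lem′ : ∀ a t w → a * (t * w) ≡ a * w * t
    lem′ = solve-∀
  bound₂ : N₂ * (4 ^ m * (39 * 39 ^ q) * 39 ^ L) ≤ 39 ^ m * (17 * w) * 49 ^ L
  bound₂ = ∑-sublists 39 10 (free K c e) (4 ^ m * (39 * 39 ^ q)) (39 ^ m * (17 * w)) (length ∘ f₂) ≤L λ {T} T∈ → begin
    length (f₂ T) * (4 ^ m * (39 * 39 ^ q) * 39 ^ length T)
      ≡⟨ cong (length (f₂ T) *_) (trans (lem (4 ^ m) (39 ^ q) (39 ^ length T)) (cong (λ n → 4 ^ m * (39 * n)) (trans (sym (ℕₚ.^-distribˡ-+-* 39 (length T) q)) (cong (39 ^_) (sym (length-children k₂ c T Q)))))) ⟩
    length (f₂ T) * (4 ^ m * (39 * 39 ^ length (children k₂ c T ++ Q)))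
      ≤⟨ explore-bound m ((move e c , e , k₀) ∷ children k₂ c T ++ Q) (move e c ∷ sites c T ++ O) (Step.valid₂ v (T⊆ T∈)) ⟩
    39 ^ m * (17 * weights (children k₂ c T ++ Q))
      ≡⟨ trans (cong (λ n → 39 ^ m * (17 * n)) (weights-children k₂ c T Q)) (lem′ (39 ^ m) (10 ^ length T) w) ⟩
    39 ^ m * (17 * w) * 10 ^ length T ∎
    where
    lem : ∀ a b t → a * (39 * b) * t ≡ a * (39 * (t * b))
    lem = solve-∀
    lem′ : ∀ a t w → a * (17 * (t * w)) ≡ a * (17 * w) * t
    lem′ = solve-∀

-- Completeness of the exploration

Same : List Cell → List Cell → Set
Same P R = (∀ {a} → a ∈ P → a ∈ R) × (∀ {a} → a ∈ R → a ∈ P)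

-- The state of a run whose choices follow `P`. By `fuel`, `m` is the number of cells of `P` that
-- are queued or not yet found, and each call processes one cell.
record Partial (P : List Cell) (m : ℕ) (Q : List Entry) (K O : List Cell) : Set where
  field
    O⊆P    : ∀ {a} → a ∈ O → a ∈ P
    P∩K⊆O  : ∀ {a} → a ∈ P → a ∈ K → a ∈ O
    O⊆K    : ∀ {a} → a ∈ O → a ∈ K
    closed : ∀ {a} → a ∈ O → a ∈ map proj₁ Q ⊎ (∀ d → move d a ∈ K)
    O!     : Unique O
    fuel   : m + length O ≡ length P + length Q
    0∈O    : 0ᶜ ∈ O

∈-concatMap : ∀ {A B : Set} (f : A → List B) {xs x y} → x ∈ xs → y ∈ f x → y ∈ concatMap f xs
∈-concatMap f {x ∷ xs} (here refl) y∈ = ∈-++⁺ˡ y∈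
∈-concatMap f {x ∷ xs} (there x∈) y∈  = ∈-++⁺ʳ (f x) (∈-concatMap f x∈ y∈)

∈-sites⁻ : ∀ c T {a} → a ∈ sites c T → ∃ λ d → d ∈ T × a ≡ move d c
∈-sites⁻ c T a∈ = ∈-map⁻ (λ d → move d c) {xs = T} a∈

sites⊆nbrs : ∀ c T {a} → a ∈ sites c T → a ∈ nbrs c
sites⊆nbrs c T a∈ = let d , _ , eq = ∈-sites⁻ c T a∈ in subst (_∈ nbrs c) (sym eq) (move-∈-nbrs d c)

∈-nbrs⇒dir : ∀ c {a} → a ∈ nbrs c → ∃ λ d → a ≡ move d c
∈-nbrs⇒dir c a∈ = let d , _ , eq = ∈-map⁻ (λ d → move d c) {xs = dirs} a∈ in d , eq

queue-cells : ∀ k c T Q → map proj₁ (children k c T ++ Q) ≡ sites c T ++ map proj₁ Q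
queue-cells k c []      Q = refl
queue-cells k c (d ∷ T) Q = cong (move d c ∷_) (queue-cells k c T Q)

sites-unique : ∀ c {T} → Unique T → Unique (sites c T)
sites-unique c = Uniqueₚ.map⁺ (move-injective c)

module _ {P : List Cell} (conn : Connected P) where

  closed-path : ∀ {K O} → (∀ {a} → a ∈ P → a ∈ K → a ∈ O) → (∀ {a} → a ∈ O → ∀ d → move d a ∈ K) →
    ∀ {a b} → Path P a b → a ∈ O → b ∈ O
  closed-path h cl stop            a∈ = a∈
  closed-path h cl (step adj b∈ p) a∈ with adj-dir adj
  ... | d , refl = closed-path h cl p (h b∈ (cl a∈ d))

  taken : List Cell → Cell → Dir → List Dir
  taken K c e = filter (λ d → move d c ∈? P) (free K c e)

  taken⁻ : ∀ K c e {d} → d ∈ taken K c e → (d ∈ laterals e × move d c ∉ K) × move d c ∈ P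
  taken⁻ K c e d∈ = let p , q = ∈-filter⁻ (λ d → move d c ∈? P) {xs = free K c e} d∈ in free-⊆ K c e p , q

  taken⁺ : ∀ K c e {d} → d ∈ laterals e → move d c ∉ K → move d c ∈ P → move d c ∈ sites c (taken K c e)
  taken⁺ K c e d∈ ∉K ∈P = ∈-map⁺ (λ d → move d c)
    (∈-filter⁺ (λ d → move d c ∈? P) (∈-filter⁺ (λ d → ¬? (move d c ∈? K)) d∈ ∉K) ∈P)

  -- When the queue is empty, the occupied cells contain every neighbour in `P` of each of them, so
  -- connectedness makes them all of `P`. Fuel cannot run out earlier, because then more distinct
  -- cells would be occupied than `P` has.
  explore-covers : ∀ m Q {K O} → Valid Q K → Partial P m Q K O → ∃ λ R → R ∈ explore m Q K O × Same P R
  explore-covers m [] {K} {O} v part = O , here refl ,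
    (λ a∈ → closed-path P∩K⊆O (λ o∈ → [ (λ ()) , id ]′ (closed o∈)) (conn (O⊆P 0∈O) a∈) 0∈O) , O⊆P
    where open Partial part
  explore-covers zero (q ∷ Q) {O = O} v part = ⊥-elim (ℕₚ.<⇒≱ (subst (length P <_) (sym fuel) (subst (suc (length P) ≤_) (sym (ℕₚ.+-suc (length P) (length Q))) (s≤s (ℕₚ.m≤m+n (length P) (length Q)))))
    (length-⊆ O! O⊆P))
    where open Partial part
  explore-covers (suc m) ((c , e , k) ∷ Q) {K} {O} v part with (move e c ∈? P) ×-dec ¬? (move e c ∈? K)
  -- A straight neighbour that is in `P` but was decided before is already in `O`, so the run treats
  -- it as absent.
  ... | no ¬s = let R , R∈ , same = explore-covers m (children k₁ c T ++ Q) (Step.valid₁ v T⊆) part′ in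
      R , ∈-++⁺ˡ (∈-concatMap _ (filter-∈-sublists (λ d → move d c ∈? P) (free K c e)) R∈) , same
    where
    open Partial part
    T = taken K c e
    T⁻ = λ {d} → taken⁻ K c e {d}
    T⊆ : ∀ {d} → d ∈ T → d ∈ laterals e
    T⊆ = proj₁ ∘ proj₁ ∘ T⁻
    sites⊆P : ∀ {a} → a ∈ sites c T → a ∈ P
    sites⊆P a∈ = let d , d∈ , eq = ∈-sites⁻ c T a∈ in subst (_∈ P) (sym eq) (proj₂ (T⁻ d∈))
    part′ : Partial P m (children k₁ c T ++ Q) (nbrs c ++ K) (sites c T ++ O)
    part′ = record
      { O⊆P = [ sites⊆P , O⊆P ]′ ∘ ∈-++⁻ (sites c T)
      ; P∩K⊆O = λ a∈P a∈K → decided a∈P (∈-++⁻ (nbrs c) a∈K)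
      ; O⊆K = [ ∈-++⁺ˡ ∘ sites⊆nbrs c T , ∈-++⁺ʳ (nbrs c) ∘ O⊆K ]′ ∘ ∈-++⁻ (sites c T)
      ; closed = λ a∈ → subst (λ q → _ ∈ q ⊎ _) (sym (queue-cells k₁ c T Q)) ([ inj₁ ∘ ∈-++⁺ˡ , old ]′ (∈-++⁻ (sites c T) a∈))
      ; O! = Uniqueₚ.++⁺ (sites-unique c (Uniqueₚ.filter⁺ (λ d → move d c ∈? P) (free-unique K c e))) O!
          (λ { (p , q) → let d , d∈ , eq = ∈-sites⁻ c T p in proj₂ (proj₁ (T⁻ d∈)) (O⊆K (subst (_∈ O) eq q)) })
      ; fuel = trans (cong (m +_) (trans (Listₚ.length-++ (sites c T)) (cong (_+ length O) (Listₚ.length-map _ T))))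
          (trans (lem m (length T) (length O)) (trans (cong (λ n → length T + pred n) fuel)
            (trans (cong (λ n → length T + pred n) (ℕₚ.+-suc (length P) (length Q)))
              (trans (lem (length T) (length P) (length Q)) (cong (length P +_) (sym (length-children k₁ c T Q)))))))
      ; 0∈O = ∈-++⁺ʳ (sites c T) 0∈O
      }
      where
      lem : ∀ a b c → a + (b + c) ≡ b + (a + c)
      lem = solve-∀
      old : ∀ {a} → a ∈ O → a ∈ sites c T ++ map proj₁ Q ⊎ (∀ d → move d a ∈ nbrs c ++ K)
      old a∈ with closed a∈
      ... | inj₁ (here refl) = inj₂ (λ d → ∈-++⁺ˡ (move-∈-nbrs d c))
      ... | inj₁ (there q)   = inj₁ (∈-++⁺ʳ (sites c T) q)
      ... | inj₂ h           = inj₂ (∈-++⁺ʳ (nbrs c) ∘ h)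
      decided : ∀ {a} → a ∈ P → a ∈ nbrs c ⊎ a ∈ K → a ∈ sites c T ++ O
      decided a∈P (inj₂ a∈K) = ∈-++⁺ʳ (sites c T) (P∩K⊆O a∈P a∈K)
      decided {a} a∈P (inj₁ a∈n) with a ∈? K | ∈-nbrs⇒dir c a∈n
      ... | yes a∈K | _ = ∈-++⁺ʳ (sites c T) (P∩K⊆O a∈P a∈K)
      ... | no a∉K | d , refl with position e d
      ...   | ahead = ⊥-elim (¬s (a∈P , a∉K))
      ...   | behind = ⊥-elim (a∉K (proj₁ (proj₂ (proj₁ v))))
      ...   | sideways d∈ = ∈-++⁺ˡ (taken⁺ K c e d∈ a∉K a∈P)
  ... | yes (s∈P , s∉K) = let R , R∈ , same = explore-covers m ((move e c , e , k₀) ∷ children k₂ c T ++ Q) (Step.valid₂ v T⊆) part′ in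
      R , ∈-++⁺ʳ (concatMap (λ T → explore m (children k₁ c T ++ Q) (nbrs c ++ K) (sites c T ++ O)) (sublists (free K c e)))
        (∈-concatMap _ (filter-∈-sublists (λ d → move d c ∈? P) (free K c e)) R∈) , same
    where
    open Partial part
    T = taken K c e
    T⁻ = λ {d} → taken⁻ K c e {d}
    T⊆ : ∀ {d} → d ∈ T → d ∈ laterals e
    T⊆ = proj₁ ∘ proj₁ ∘ T⁻
    sites⊆P : ∀ {a} → a ∈ sites c T → a ∈ P
    sites⊆P a∈ = let d , d∈ , eq = ∈-sites⁻ c T a∈ in subst (_∈ P) (sym eq) (proj₂ (T⁻ d∈))
    s = move e c
    part′ : Partial P m ((s , e , k₀) ∷ children k₂ c T ++ Q) (nbrs c ++ K) (s ∷ sites c T ++ O)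
    part′ = record
      { O⊆P = λ { (here refl) → s∈P ; (there a∈) → [ sites⊆P , O⊆P ]′ (∈-++⁻ (sites c T) a∈) }
      ; P∩K⊆O = λ a∈P a∈K → decided a∈P (∈-++⁻ (nbrs c) a∈K)
      ; O⊆K = λ { (here refl) → ∈-++⁺ˡ (move-∈-nbrs e c) ; (there a∈) → [ ∈-++⁺ˡ ∘ sites⊆nbrs c T , ∈-++⁺ʳ (nbrs c) ∘ O⊆K ]′ (∈-++⁻ (sites c T) a∈) }
      ; closed = λ { (here refl) → inj₁ (here refl)
                   ; (there a∈) → subst (λ q → _ ∈ s ∷ q ⊎ _) (sym (queue-cells k₂ c T Q)) ([ inj₁ ∘ there ∘ ∈-++⁺ˡ , old ]′ (∈-++⁻ (sites c T) a∈)) }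
      ; O! = All.tabulate (λ { a∈ refl → [ (λ p → let d , d∈ , eq = ∈-sites⁻ c T p in e∉laterals e (subst (_∈ laterals e) (sym (move-injective c eq)) (T⊆ d∈)))
                                       , (λ q → s∉K (O⊆K q)) ]′ (∈-++⁻ (sites c T) a∈) })
          ∷ Uniqueₚ.++⁺ (sites-unique c (Uniqueₚ.filter⁺ (λ d → move d c ∈? P) (free-unique K c e))) O!
          (λ { (p , q) → let d , d∈ , eq = ∈-sites⁻ c T p in proj₂ (proj₁ (T⁻ d∈)) (O⊆K (subst (_∈ O) eq q)) })
      ; fuel = trans (cong (λ n → m + suc n) (trans (Listₚ.length-++ (sites c T)) (cong (_+ length O) (Listₚ.length-map _ T))))
          (trans (lem m (length T) (length O)) (trans (cong (length T +_) fuel)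
              (trans (lem′ (length T) (length P) (length Q)) (cong (λ n → length P + suc n) (sym (length-children k₂ c T Q))))))
      ; 0∈O = there (∈-++⁺ʳ (sites c T) 0∈O)
      }
      where
      lem : ∀ a b c → a + suc (b + c) ≡ b + suc (a + c)
      lem = solve-∀
      lem′ : ∀ a b c → a + (b + suc c) ≡ b + suc (a + c)
      lem′ = solve-∀
      old : ∀ {a} → a ∈ O → a ∈ s ∷ sites c T ++ map proj₁ Q ⊎ (∀ d → move d a ∈ nbrs c ++ K)
      old a∈ with closed a∈
      ... | inj₁ (here refl) = inj₂ (λ d → ∈-++⁺ˡ (move-∈-nbrs d c))
      ... | inj₁ (there q)   = inj₁ (there (∈-++⁺ʳ (sites c T) q))
      ... | inj₂ h           = inj₂ (∈-++⁺ʳ (nbrs c) ∘ h)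
      decided : ∀ {a} → a ∈ P → a ∈ nbrs c ⊎ a ∈ K → a ∈ s ∷ sites c T ++ O
      decided a∈P (inj₂ a∈K) = there (∈-++⁺ʳ (sites c T) (P∩K⊆O a∈P a∈K))
      decided {a} a∈P (inj₁ a∈n) with a ∈? K | ∈-nbrs⇒dir c a∈n
      ... | yes a∈K | _ = there (∈-++⁺ʳ (sites c T) (P∩K⊆O a∈P a∈K))
      ... | no a∉K | d , refl with position e d
      ...   | ahead = here refl
      ...   | behind = ⊥-elim (a∉K (proj₁ (proj₂ (proj₁ v))))
      ...   | sideways d∈ = there (∈-++⁺ˡ (taken⁺ K c e d∈ a∉K a∈P))

explore-root : ℕ → List Dir → List (List Cell)
explore-root m T = explore m (children k₀ 0ᶜ T ++ []) (0ᶜ ∷ nbrs 0ᶜ) (sites 0ᶜ T ++ 0ᶜ ∷ [])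

candidates : ℕ → List (List Cell)
candidates m = concatMap (explore-root m) (sublists dirs)

dirs-unique : Unique dirs
dirs-unique = ((λ ()) ∷ (λ ()) ∷ (λ ()) ∷ (λ ()) ∷ (λ ()) ∷ []) ∷ ((λ ()) ∷ (λ ()) ∷ (λ ()) ∷ (λ ()) ∷ []) ∷
  ((λ ()) ∷ (λ ()) ∷ (λ ()) ∷ []) ∷ ((λ ()) ∷ (λ ()) ∷ []) ∷ ((λ ()) ∷ []) ∷ [] ∷ []

root-valid : ∀ T → Valid (children k₀ 0ᶜ T ++ []) (0ᶜ ∷ nbrs 0ᶜ)
root-valid T = children-valid k₀ T (here refl) (λ d → there (move-∈-nbrs d 0ᶜ)) (λ _ → tt) tt

-- The root has no incoming direction: its six neighbours are all of kind `k₀`, and 56 = 39 + 17.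
candidates-bound : ∀ m → length (candidates m) * (4 ^ m * 39 ^ 6) ≤ 39 ^ m * 56 ^ 6
candidates-bound m = subst (λ n → n * (4 ^ m * 39 ^ 6) ≤ 39 ^ m * 56 ^ 6) (sym (length-concatMap (explore-root m) (sublists dirs)))
  (∑-sublists 39 17 dirs (4 ^ m) (39 ^ m) (length ∘ explore-root m) ℕₚ.≤-refl λ {T} _ →
    subst₂ _≤_ (cong (λ n → length (explore-root m T) * (4 ^ m * 39 ^ n)) (trans (length-children k₀ 0ᶜ T []) (ℕₚ.+-identityʳ _)))
      (cong (39 ^ m *_) (trans (weights-children k₀ 0ᶜ T []) (ℕₚ.*-identityʳ _)))
      (explore-bound m (children k₀ 0ᶜ T ++ []) (sites 0ᶜ T ++ 0ᶜ ∷ []) (root-valid T)))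

candidates-cover : ∀ {m P} → Standard (suc m) P → ∃ λ R → R ∈ candidates m × canon R ≡ P
candidates-cover {m} {P} std with explore-covers conn m (children k₀ 0ᶜ T ++ []) (root-valid T) part
  where
  open Standard std
  T = filter (λ d → move d 0ᶜ ∈? P) dirs
  T⁻ : ∀ {d} → d ∈ T → move d 0ᶜ ∈ P
  T⁻ d∈ = proj₂ (∈-filter⁻ (λ d → move d 0ᶜ ∈? P) {xs = dirs} d∈)
  part : Partial P m (children k₀ 0ᶜ T ++ []) (0ᶜ ∷ nbrs 0ᶜ) (sites 0ᶜ T ++ 0ᶜ ∷ [])
  part = record
    { O⊆P = λ a∈ → [ (λ p → let d , d∈ , eq = ∈-sites⁻ 0ᶜ T p in subst (_∈ P) (sym eq) (T⁻ d∈)) , (λ { (here refl) → 0∈ }) ]′ (∈-++⁻ (sites 0ᶜ T) a∈)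
    ; P∩K⊆O = λ { a∈P (here refl) → ∈-++⁺ʳ (sites 0ᶜ T) (here refl)
                ; a∈P (there a∈n) → near a∈P (∈-nbrs⇒dir 0ᶜ a∈n) }
    ; O⊆K = λ a∈ → [ (λ p → there (sites⊆nbrs 0ᶜ T p)) , (λ { (here refl) → here refl }) ]′ (∈-++⁻ (sites 0ᶜ T) a∈)
    ; closed = λ a∈ → [ (λ p → inj₁ (subst (_ ∈_) (sym (queue-cells k₀ 0ᶜ T [])) (∈-++⁺ˡ p))) , (λ { (here refl) → inj₂ (λ d → there (move-∈-nbrs d 0ᶜ)) }) ]′ (∈-++⁻ (sites 0ᶜ T) a∈)
    ; O! = Uniqueₚ.++⁺ (sites-unique 0ᶜ (Uniqueₚ.filter⁺ (λ d → move d 0ᶜ ∈? P) dirs-unique)) ([] ∷ [])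
        (λ { (p , here refl) → let d , d∈ , eq = ∈-sites⁻ 0ᶜ T p in move-≢0 d (sym eq) })
    ; fuel = trans (cong (m +_) (trans (Listₚ.length-++ (sites 0ᶜ T)) (cong (_+ 1) (Listₚ.length-map _ T))))
        (trans (lem m (length T)) (cong₂ _+_ (sym len) (sym (length-children k₀ 0ᶜ T []))))
    ; 0∈O = ∈-++⁺ʳ (sites 0ᶜ T) (here refl)
    }
    where
    lem : ∀ m t → m + (t + 1) ≡ suc m + (t + 0)
    lem = solve-∀
    move-≢0 : ∀ d → move d 0ᶜ ≢ 0ᶜ
    move-≢0 x⁺ ()
    move-≢0 x⁻ ()
    move-≢0 y⁺ ()
    move-≢0 y⁻ ()
    move-≢0 z⁺ ()
    move-≢0 z⁻ ()
    near : ∀ {a} → a ∈ P → (∃ λ d → a ≡ move d 0ᶜ) → a ∈ sites 0ᶜ T ++ 0ᶜ ∷ []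
    near a∈P (d , refl) = ∈-++⁺ˡ (∈-map⁺ (λ d → move d 0ᶜ) (∈-filter⁺ (λ d → move d 0ᶜ ∈? P) (∈-dirs d) a∈P))
... | R , R∈ , P⊆R , R⊆P = R , ∈-concatMap (explore-root m) (filter-∈-sublists (λ d → move d 0ᶜ ∈? P) dirs) R∈ ,
  sorted-ext (canon-sorted R) (Standard.sorted std) (R⊆P ∘ ∈-canon⁻ R) (∈-canon⁺ ∘ P⊆R)

growth-bound : ∀ {m a} → Enumeration (suc m) a → a * (4 ^ m * 39 ^ 6) ≤ 39 ^ m * 56 ^ 6
growth-bound {m} {a} E = ℕₚ.≤-trans (ℕₚ.*-monoˡ-≤ _ (subst (_≤ length (candidates m)) (card E)
    (length-cover (candidates m) canon (unique E) (λ P∈ → candidates-cover (sound E P∈))))) (candidates-bound m)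

-- Leaves and buds

nbrs-unique : ∀ c → Unique (nbrs c)
nbrs-unique c = sites-unique c dirs-unique

degree : List Cell → Cell → ℕ
degree P c = length (filter (_∈? P) (nbrs c))

degree-mono : ∀ {P Q c} → (∀ {a} → a ∈ nbrs c → a ∈ P → a ∈ Q) → degree P c ≤ degree Q c
degree-mono {P} {Q} {c} h = length-⊆ (Uniqueₚ.filter⁺ (_∈? P) (nbrs-unique c)) λ a∈ →
  let p , q = ∈-filter⁻ (_∈? P) {xs = nbrs c} a∈ in ∈-filter⁺ (_∈? Q) p (h p q)

degree-≤1 : ∀ {P c a b} → degree P c ≤ 1 → a ∈ nbrs c → a ∈ P → b ∈ nbrs c → b ∈ P → a ≡ b
degree-≤1 {P} {c} {a} {b} ≤1 an aP bn bP with a ≟ᶜ b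
... | yes eq = eq
... | no a≢b = ⊥-elim (ℕₚ.<⇒≱ (length-⊆ {xs = a ∷ b ∷ []} {filter (_∈? P) (nbrs c)} ((a≢b ∷ []) ∷ [] ∷ [])
    (λ { (here refl) → ∈-filter⁺ (_∈? P) an aP ; (there (here refl)) → ∈-filter⁺ (_∈? P) bn bP })) ≤1)

degree-≥1 : ∀ {P c a} → a ∈ nbrs c → a ∈ P → 1 ≤ degree P c
degree-≥1 {P} {c} {a} an aP = length-⊆ {xs = a ∷ []} {filter (_∈? P) (nbrs c)} ([] ∷ []) (λ { (here refl) → ∈-filter⁺ (_∈? P) an aP })

neighbour : ∀ {P c} → 1 ≤ degree P c → ∃ λ a → a ∈ nbrs c × a ∈ P
neighbour {P} {c} 1≤ with filter (_∈? P) (nbrs c) in eq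
... | a ∷ as = a , ∈-filter⁻ (_∈? P) {xs = nbrs c} (subst (a ∈_) (sym eq) (here refl))

move-≢ : ∀ c → c ∉ nbrs c
move-≢ c c∈ with ∈-map⁻ (λ d → move d c) {xs = dirs} c∈
... | d , _ , eq = vec-≢0 d (translate-injective c {vec d} {0ᶜ} (trans (translate-swap c (vec d)) (trans (sym eq) (sym (translate-of-0 c)))))
  where
  vec-≢0 : ∀ d → vec d ≢ 0ᶜ
  vec-≢0 x⁺ ()
  vec-≢0 x⁻ ()
  vec-≢0 y⁺ ()
  vec-≢0 y⁻ ()
  vec-≢0 z⁺ ()
  vec-≢0 z⁻ ()

nbrs-sym : ∀ {a b} → a ∈ nbrs b → b ∈ nbrs a
nbrs-sym {a} {b} a∈ = ∈-nbrs⁺ (adj-sym (∈-nbrs⁻ {b} {a} a∈))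

_<ᶜ?_ : ∀ a b → Dec (a <ᶜ b)
a <ᶜ? b with order a b
... | less p    = yes p
... | equal refl = no <ᶜ-irrefl
... | greater q = no (λ p → <ᶜ-irrefl (<ᶜ-trans p q))

-- The origin is never added or removed, so all polycubes stay anchored at it.
IsLeaf : List Cell → Cell → Set
IsLeaf P c = c ≢ 0ᶜ × degree P c ≤ 1

leaf? : ∀ P → Decidable (IsLeaf P)
leaf? P c = ¬? (c ≟ᶜ 0ᶜ) ×-dec (degree P c ≤? 1)

leaves : List Cell → List Cell
leaves P = filter (leaf? P) P

IsBud : List Cell → Cell → Set
IsBud P s = s ∉ P × 0ᶜ <ᶜ s × degree P s ≡ 1

bud? : ∀ P → Decidable (IsBud P)
bud? P s = ¬? (s ∈? P) ×-dec ((0ᶜ <ᶜ? s) ×-dec (degree P s ℕₚ.≟ 1))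

buds : List Cell → List Cell
buds P = filter (bud? P) (deduplicate _≟ᶜ_ (concatMap nbrs P))

∈-buds⁺ : ∀ {P s} → IsBud P s → s ∈ buds P
∈-buds⁺ {P} {s} bud@(_ , _ , deg) with neighbour {P} {s} (ℕₚ.≤-reflexive (sym deg))
... | a , an , aP = ∈-filter⁺ (bud? P) (∈-deduplicate⁺ _≟ᶜ_ (into aP)) bud
  where
  into : ∀ {P} → a ∈ P → s ∈ concatMap nbrs P
  into {b ∷ P} (here refl) = ∈-++⁺ˡ (nbrs-sym {a} {s} an)
  into {b ∷ P} (there p)   = ∈-++⁺ʳ (nbrs b) (into p)

∈-buds⁻ : ∀ {P s} → s ∈ buds P → IsBud P s
∈-buds⁻ {P} s∈ = proj₂ (∈-filter⁻ (bud? P) {xs = deduplicate _≟ᶜ_ (concatMap nbrs P)} s∈)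

buds-unique : ∀ P → Unique (buds P)
buds-unique P = Uniqueₚ.filter⁺ (bud? P) (DecUnique.deduplicate-! _≟ᶜ_ (concatMap nbrs P))

∈-leaves⁻ : ∀ {P c} → c ∈ leaves P → c ∈ P × IsLeaf P c
∈-leaves⁻ {P} c∈ = ∈-filter⁻ (leaf? P) {xs = P} c∈

leaves-unique : ∀ {n P} → Standard n P → Unique (leaves P)
leaves-unique {P = P} std = Uniqueₚ.filter⁺ (leaf? P) (sorted-unique (Standard.sorted std))

remove : Cell → List Cell → List Cell
remove c = filter (λ a → ¬? (a ≟ᶜ c))

∈-remove⁻ : ∀ {c Q a} → a ∈ remove c Q → a ∈ Q × a ≢ c
∈-remove⁻ {c} {Q} = ∈-filter⁻ (λ a → ¬? (a ≟ᶜ c)) {xs = Q}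

∈-remove⁺ : ∀ {c Q a} → a ∈ Q → a ≢ c → a ∈ remove c Q
∈-remove⁺ {c} = ∈-filter⁺ (λ a → ¬? (a ≟ᶜ c))

remove-sorted : ∀ c {Q} → Sorted Q → Sorted (remove c Q)
remove-sorted c = APₚ.filter⁺ (λ a → ¬? (a ≟ᶜ c))

remove-insert : ∀ {s P} → Sorted P → s ∉ P → remove s (insert s P) ≡ P
remove-insert {s} {P} sP s∉ = sorted-ext (remove-sorted s (insert-sorted s sP)) sP
  (λ a∈ → let p , q = ∈-remove⁻ {s} {insert s P} a∈ in [ ⊥-elim ∘ q , id ]′ (∈-insert⁻ s P p))
  (λ a∈ → ∈-remove⁺ (∈-insert-there s a∈) (λ { refl → s∉ a∈ }))

insert-remove : ∀ {c Q} → Sorted Q → c ∈ Q → insert c (remove c Q) ≡ Q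
insert-remove {c} {Q} sQ c∈ = sorted-ext (insert-sorted c (remove-sorted c sQ)) sQ
  (λ a∈ → [ (λ { refl → c∈ }) , proj₁ ∘ ∈-remove⁻ {c} {Q} ]′ (∈-insert⁻ c (remove c Q) a∈))
  back
  where
  back : ∀ {a} → a ∈ Q → a ∈ insert c (remove c Q)
  back {a} a∈ with a ≟ᶜ c
  ... | yes refl = ∈-insert-here c (remove c Q)
  ... | no a≢c  = ∈-insert-there c (∈-remove⁺ a∈ a≢c)

length-insert : ∀ {s P} → Sorted P → s ∉ P → length (insert s P) ≡ suc (length P)
length-insert {s} {P} sP s∉ = ℕₚ.≤-antisym
  (length-⊆ (sorted-unique (insert-sorted s sP)) (λ a∈ → [ here , there ]′ (∈-insert⁻ s P a∈)))
  (length-⊆ {xs = s ∷ P} (All.tabulate (λ { a∈ refl → s∉ a∈ }) ∷ sorted-unique sP)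
    (λ { (here refl) → ∈-insert-here s P ; (there a∈) → ∈-insert-there s a∈ }))

insert-standard : ∀ {n P s} → Standard n P → s ∉ P → 0ᶜ <ᶜ s → (∃ λ a → a ∈ nbrs s × a ∈ P) → Standard (suc n) (insert s P)
insert-standard {P = P} {s} std s∉ 0<s (q , qn , qP) = standard (insert-sorted s sorted) (∈-insert-there s 0∈)
  (λ a∈ a<0 → [ (λ { refl → <ᶜ-irrefl (<ᶜ-trans 0<s a<0) }) , (λ aP → 0≤ aP a<0) ]′ (∈-insert⁻ s P a∈))
  (connected-from q (∈-insert-there s qP) paths)
  (trans (length-insert sorted s∉) (cong suc len))
  where
  open Standard std
  paths : ∀ {a} → a ∈ insert s P → Path (insert s P) q a
  paths a∈ with ∈-insert⁻ s P a∈
  ... | inj₁ refl = step (∈-nbrs⁻ (nbrs-sym {q} {s} qn)) (∈-insert-here s P) stop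
  ... | inj₂ aP   = path-⊆ (∈-insert-there s) (conn qP aP)

-- A path through a cell of degree at most 1 must leave it to the cell it came from, so the detour
-- can be cut out.
path-avoiding : ∀ {Q c a b} → degree Q c ≤ 1 → a ∈ Q → a ≢ c → b ≢ c → Path Q a b → Path (remove c Q) a b
path-avoiding deg a∈ a≢ b≢ stop = stop
path-avoiding {Q} {c} deg a∈ a≢ b≢ (step {b = x} e x∈ p) with x ≟ᶜ c
... | no x≢ = step e (∈-remove⁺ x∈ x≢) (path-avoiding deg x∈ x≢ b≢ p)
path-avoiding {Q} {c} deg a∈ a≢ b≢ (step e x∈ stop) | yes refl = ⊥-elim (b≢ refl)
path-avoiding {Q} {c} {a} deg a∈ a≢ b≢ (step e x∈ (step {b = y} e′ y∈ p)) | yes refl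
  with degree-≤1 {Q} {c} deg (∈-nbrs⁺ (adj-sym e)) a∈ (∈-nbrs⁺ e′) y∈
... | refl = path-avoiding deg a∈ a≢ b≢ p

leaf-neighbour : ∀ {n Q c} → Standard n Q → c ∈ Q → c ≢ 0ᶜ → ∃ λ a → a ∈ nbrs c × a ∈ remove c Q
leaf-neighbour {Q = Q} {c} std c∈ c≢0 with Standard.conn std c∈ (Standard.0∈ std)
... | stop = ⊥-elim (c≢0 refl)
... | step {b = x} e x∈ _ = x , ∈-nbrs⁺ e , ∈-remove⁺ x∈ (λ { refl → move-≢ c (∈-nbrs⁺ e) })

remove-standard : ∀ {n Q c} → Standard (suc n) Q → c ∈ Q → IsLeaf Q c → Standard n (remove c Q)
remove-standard {Q = Q} {c} std c∈ (c≢0 , deg) = standard (remove-sorted c sorted) (∈-remove⁺ 0∈ (c≢0 ∘ sym))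
  (λ a∈ → 0≤ (proj₁ (∈-remove⁻ {c} {Q} a∈)))
  (λ a∈ b∈ → let aQ , a≢ = ∈-remove⁻ {c} {Q} a∈ ; bQ , b≢ = ∈-remove⁻ {c} {Q} b∈ in path-avoiding deg aQ a≢ b≢ (conn aQ bQ))
  (ℕₚ.suc-injective (trans (sym (trans (cong length (sym (insert-remove sorted c∈))) (length-insert (remove-sorted c sorted) (λ q → proj₂ (∈-remove⁻ {c} {Q} q) refl)))) len))
  where open Standard std

bud-of-remove : ∀ {n Q c} → Standard n Q → c ∈ Q → IsLeaf Q c → IsBud (remove c Q) c
bud-of-remove {Q = Q} {c} std c∈ (c≢0 , deg) = (λ p → proj₂ (∈-remove⁻ {c} {Q} p) refl) , 0<c ,
  ℕₚ.≤-antisym (ℕₚ.≤-trans (degree-mono {remove c Q} {Q} {c} (λ _ p → proj₁ (∈-remove⁻ {c} {Q} p))) deg)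
    (let a , an , a∈ = leaf-neighbour std c∈ c≢0 in degree-≥1 {remove c Q} {c} an a∈)
  where
  0<c : 0ᶜ <ᶜ c
  0<c with order 0ᶜ c
  ... | less p     = p
  ... | equal eq   = ⊥-elim (c≢0 (sym eq))
  ... | greater q  = ⊥-elim (Standard.0≤ std c∈ q)

bud-standard : ∀ {n P s} → Standard n P → IsBud P s → Standard (suc n) (insert s P)
bud-standard {P = P} {s} std (s∉ , 0<s , deg) = insert-standard std s∉ 0<s (neighbour {P} {s} (ℕₚ.≤-reflexive (sym deg)))

leaf-of-insert : ∀ {P s} → IsBud P s → IsLeaf (insert s P) s
leaf-of-insert {P} {s} (s∉ , 0<s , deg) = (λ { refl → <ᶜ-irrefl 0<s }) ,
  subst (degree (insert s P) s ≤_) deg (degree-mono {insert s P} {P} {s} (λ an a∈ → [ (λ { refl → ⊥-elim (move-≢ s an) }) , id ]′ (∈-insert⁻ s P a∈)))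

-- Double counting of buds and leaves

module _ {n a b} (E : Enumeration n a) (F : Enumeration (suc n) b) (h : List Cell → ℕ) where

  -- Adding a bud and removing a leaf are inverse to each other, so the two sums run over the same
  -- pairs; `leaf-bud-≤` is the other direction.
  bud-leaf-≤ : ∑ (list E) (λ P → ∑ (buds P) (λ s → h (insert s P))) ≤ ∑ (list F) (λ Q → length (leaves Q) * h Q)
  bud-leaf-≤ = subst₂ _≤_ (∑-pairs (list E) buds) (trans (∑-pairs (list F) leaves)
      (∑-cong (list F) (λ {Q} _ → ∑-const (leaves Q) (h Q))))
    (∑-injection (pairs (list E) buds) (pairs (list F) leaves) (λ (P , s) → insert s P , s)
      (unique-pairs (unique E) (λ {P} _ → buds-unique P))
      (λ {(P , s)} p → let P∈ , s∈ = ∈-pairs⁻ (list E) p ; bud = ∈-buds⁻ {P} s∈ in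
        ∈-pairs⁺ (complete F (bud-standard (sound E P∈) bud)) (∈-filter⁺ (leaf? (insert s P)) (∈-insert-here s P) (leaf-of-insert bud)))
      inj
      (λ _ → ℕₚ.≤-refl))
    where
    inj : ∀ {x y} → x ∈ pairs (list E) buds → y ∈ pairs (list E) buds → (insert (proj₂ x) (proj₁ x) , proj₂ x) ≡ (insert (proj₂ y) (proj₁ y) , proj₂ y) → x ≡ y
    inj {P , s} {P′ , s′} p q eq with cong proj₂ eq
    ... | refl = let P∈ , s∈ = ∈-pairs⁻ (list E) p ; P′∈ , s′∈ = ∈-pairs⁻ (list E) q in
      cong (_, s) (trans (sym (remove-insert (Standard.sorted (sound E P∈)) (proj₁ (∈-buds⁻ {P} s∈))))
        (trans (cong (remove s ∘ proj₁) eq) (remove-insert (Standard.sorted (sound E P′∈)) (proj₁ (∈-buds⁻ {P′} s′∈)))))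

  leaf-bud-≤ : ∑ (list F) (λ Q → length (leaves Q) * h Q) ≤ ∑ (list E) (λ P → ∑ (buds P) (λ s → h (insert s P)))
  leaf-bud-≤ = subst₂ _≤_ (trans (∑-pairs (list F) leaves)
      (∑-cong (list F) (λ {Q} _ → ∑-const (leaves Q) (h Q))))
    (∑-pairs (list E) buds)
    (∑-injection (pairs (list F) leaves) (pairs (list E) buds) (λ (Q , c) → remove c Q , c)
      (unique-pairs (unique F) (λ Q∈ → leaves-unique (sound F Q∈)))
      (λ {(Q , c)} p → let Q∈ , c∈ = ∈-pairs⁻ (list F) p ; cQ , leaf = ∈-leaves⁻ {Q} c∈ in
        ∈-pairs⁺ (complete E (remove-standard (sound F Q∈) cQ leaf)) (∈-buds⁺ (bud-of-remove (sound F Q∈) cQ leaf)))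
      inj
      (λ {(Q , c)} p → let Q∈ , c∈ = ∈-pairs⁻ (list F) p ; cQ , _ = ∈-leaves⁻ {Q} c∈ in
        ℕₚ.≤-reflexive (cong h (sym (insert-remove (Standard.sorted (sound F Q∈)) cQ)))))
    where
    inj : ∀ {x y} → x ∈ pairs (list F) leaves → y ∈ pairs (list F) leaves → (remove (proj₂ x) (proj₁ x) , proj₂ x) ≡ (remove (proj₂ y) (proj₁ y) , proj₂ y) → x ≡ y
    inj {Q , c} {Q′ , c′} p q eq with cong proj₂ eq
    ... | refl = let Q∈ , c∈ = ∈-pairs⁻ (list F) p ; Q′∈ , c′∈ = ∈-pairs⁻ (list F) q in
      cong (_, c) (trans (sym (insert-remove (Standard.sorted (sound F Q∈)) (proj₁ (∈-leaves⁻ {Q} c∈))))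
        (trans (cong (insert c ∘ proj₁) eq) (insert-remove (Standard.sorted (sound F Q′∈)) (proj₁ (∈-leaves⁻ {Q′} c′∈)))))

#leaves #buds : List Cell → ℕ
#leaves P = length (leaves P)
#buds P   = length (buds P)

-- Insertion can only raise the degrees of old cells, so the inserted cell is the only possible new
-- leaf.
leaves-insert-≤ : ∀ {n P} s → Standard n P → #leaves (insert s P) ≤ suc (#leaves P)
leaves-insert-≤ {P = P} s std = length-⊆ {ys = s ∷ leaves P}
  (Uniqueₚ.filter⁺ (leaf? (insert s P)) (sorted-unique (insert-sorted s (Standard.sorted std))))
  λ {c} c∈ → let c∈Q , c≢0 , deg = ∈-leaves⁻ {insert s P} c∈ in
    [ here , (λ cP → there (∈-filter⁺ (leaf? P) cP (c≢0 , ℕₚ.≤-trans (degree-mono {P} {insert s P} {c} (λ _ → ∈-insert-there s)) deg))) ]′ (∈-insert⁻ s P c∈Q)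

-- A leaf of P adjacent to the bud s may cease to be a leaf, but there is at most one, and s replaces it.
leaves-≤-insert : ∀ {n P s} → Standard n P → IsBud P s → #leaves P ≤ #leaves (insert s P)
leaves-≤-insert {P = P} {s} std bud@(s∉ , 0<s , deg) = length-injection (leaves P) (leaves (insert s P)) g (leaves-unique std) into inj
  where
  g : Cell → Cell
  g c with c ∈? nbrs s
  ... | yes _ = s
  ... | no  _ = c
  into : ∀ {c} → c ∈ leaves P → g c ∈ leaves (insert s P)
  into {c} c∈ with c ∈? nbrs s | ∈-leaves⁻ {P} c∈
  ... | yes _ | _ = ∈-filter⁺ (leaf? (insert s P)) (∈-insert-here s P) (leaf-of-insert bud)
  ... | no c∉ | cP , c≢0 , deg′ = ∈-filter⁺ (leaf? (insert s P)) (∈-insert-there s cP)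
    (c≢0 , ℕₚ.≤-trans (degree-mono {insert s P} {P} {c} (λ an a∈ → [ (λ { refl → ⊥-elim (c∉ (nbrs-sym {s} {c} an)) }) , id ]′ (∈-insert⁻ s P a∈))) deg′)
  inj : ∀ {c c′} → c ∈ leaves P → c′ ∈ leaves P → g c ≡ g c′ → c ≡ c′
  inj {c} {c′} c∈ c′∈ eq with c ∈? nbrs s | c′ ∈? nbrs s | ∈-leaves⁻ {P} c∈ | ∈-leaves⁻ {P} c′∈
  ... | yes p | yes q | cP , _ | c′P , _ = degree-≤1 {P} {s} (ℕₚ.≤-reflexive deg) p cP q c′P
  ... | yes p | no q  | cP , _ | c′P , _ = ⊥-elim (s∉ (subst (_∈ P) (sym eq) c′P))
  ... | no p  | yes q | cP , _ | c′P , _ = ⊥-elim (s∉ (subst (_∈ P) eq cP))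
  ... | no p  | no q  | _ | _ = eq

-- Only `s` and its six neighbours can cease to be buds; elsewhere the degree is unchanged.
buds-≤-insert : ∀ {P s} → #buds P ≤ 7 + #buds (insert s P)
buds-≤-insert {P} {s} = length-⊆ {ys = s ∷ nbrs s ++ buds (insert s P)} (buds-unique P) into
  where
  into : ∀ {t} → t ∈ buds P → t ∈ s ∷ nbrs s ++ buds (insert s P)
  into {t} t∈ with t ≟ᶜ s | t ∈? nbrs s | ∈-buds⁻ {P} t∈
  ... | yes eq | _     | _ = here eq
  ... | no _   | yes p | _ = there (∈-++⁺ˡ p)
  ... | no t≢s | no t∉ | t∉P , 0<t , deg = there (∈-++⁺ʳ (nbrs s) (∈-buds⁺
    ( [ t≢s , t∉P ]′ ∘ ∈-insert⁻ s P , 0<t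
    , trans (ℕₚ.≤-antisym (degree-mono {insert s P} {P} {t} (λ an a∈ → [ (λ { refl → ⊥-elim (t∉ (nbrs-sym {s} {t} an)) }) , id ]′ (∈-insert⁻ s P a∈)))
                          (degree-mono {P} {insert s P} {t} (λ _ → ∈-insert-there s))) deg)))

-- Approximate log-concavity

module LogConcavity {n a₀ a₁ a₂} (E₀ : Enumeration n a₀) (E₁ : Enumeration (suc n) a₁) (E₂ : Enumeration (suc (suc n)) a₂)
  (D : ℕ) (W : ℕ → ℕ) (W-anti : ∀ {v v′} → v ≤ v′ → W v′ ≤ W v) (W-≤ : ∀ v → v * W v ≤ D)
  (W-≡ : ∀ {v} → 1 ≤ v → v ≤ suc (suc n) → v * W v ≡ D) (K : ℕ) (1≤K : 1 ≤ K) where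

  open ℕₚ.≤-Reasoning

  L₀ = list E₀
  L₁ = list E₁
  L₂ = list E₂

  #leaves-≤ : ∀ {m P} → Standard m P → #leaves P ≤ m
  #leaves-≤ {P = P} std = subst (#leaves P ≤_) (Standard.len std) (Listₚ.length-filter (leaf? P) P)

  ∑-buds-≤ : ∑ L₁ (λ Q → #buds Q * W (suc (#leaves Q))) ≤ a₂ * D
  ∑-buds-≤ = begin
    ∑ L₁ (λ Q → #buds Q * W (suc (#leaves Q)))
      ≤⟨ ∑-mono L₁ (λ {Q} Q∈ → ℕₚ.≤-trans (ℕₚ.≤-reflexive (sym (∑-const (buds Q) _))) (∑-mono (buds Q) (λ {t} _ → W-anti (leaves-insert-≤ t (sound E₁ Q∈))))) ⟩
    ∑ L₁ (λ Q → ∑ (buds Q) (λ t → W (#leaves (insert t Q))))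
      ≤⟨ bud-leaf-≤ E₁ E₂ (λ R → W (#leaves R)) ⟩
    ∑ L₂ (λ R → #leaves R * W (#leaves R))
      ≤⟨ ∑-≤-const L₂ D (λ {R} _ → W-≤ (#leaves R)) ⟩
    length L₂ * D
      ≡⟨ cong (_* D) (card E₂) ⟩
    a₂ * D ∎

  square : List Cell → ℕ
  square P = #buds P * (#buds P ∸ 7) * (W (suc (#leaves P)) * W (suc (suc (#leaves P))))

  -- Two buds are added in succession. At each stage the inverse leaf count makes a result, which
  -- arises once for each of its leaves, count at most once. The subtracted 7 allows for the buds
  -- lost by the first addition.
  ∑-square-≤ : ∑ L₀ square ≤ D * (a₂ * D)
  ∑-square-≤ = begin
    ∑ L₀ square
      ≤⟨ ∑-mono L₀ (λ {P} P∈ → ℕₚ.≤-trans (ℕₚ.≤-reflexive (trans (lem (#buds P) _ (W (suc (#leaves P))) _) (sym (∑-const (buds P) _)))) (∑-mono (buds P) (λ s∈ → each P∈ s∈))) ⟩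
    ∑ L₀ (λ P → ∑ (buds P) (λ s → h (insert s P)))
      ≤⟨ bud-leaf-≤ E₀ E₁ h ⟩
    ∑ L₁ (λ Q → #leaves Q * h Q)
      ≤⟨ ∑-mono L₁ (λ {Q} _ → ℕₚ.≤-trans (ℕₚ.≤-reflexive (sym (ℕₚ.*-assoc (#leaves Q) _ _))) (ℕₚ.*-monoˡ-≤ _ (W-≤ (#leaves Q)))) ⟩
    ∑ L₁ (λ Q → D * (#buds Q * W (suc (#leaves Q))))
      ≡⟨ ∑-*ˡ L₁ D ⟩
    D * ∑ L₁ (λ Q → #buds Q * W (suc (#leaves Q)))
      ≤⟨ ℕₚ.*-monoʳ-≤ D ∑-buds-≤ ⟩
    D * (a₂ * D) ∎
    where
    h : List Cell → ℕ
    h Q = W (#leaves Q) * (#buds Q * W (suc (#leaves Q)))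
    lem : ∀ u u′ w w′ → u * u′ * (w * w′) ≡ u * (w * (u′ * w′))
    lem = solve-∀
    each : ∀ {P s} → P ∈ L₀ → s ∈ buds P → W (suc (#leaves P)) * ((#buds P ∸ 7) * W (suc (suc (#leaves P)))) ≤ h (insert s P)
    each {P} {s} P∈ s∈ = ℕₚ.*-mono-≤ (W-anti le) (ℕₚ.*-mono-≤ (ℕₚ.m≤n+o⇒m∸n≤o (#buds P) 7 (buds-≤-insert {P} {s})) (W-anti (s≤s le)))
      where
      le : #leaves (insert s P) ≤ suc (#leaves P)
      le = leaves-insert-≤ s (sound E₀ P∈)

  few? : Decidable (λ Q → #leaves Q ≤ K)
  few? Q = #leaves Q ≤? K

  #few : ℕ
  #few = length (filter few? L₁)

  linear : List Cell → ℕ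
  linear P = select (K ≤? #leaves P) (#buds P * W (#leaves P))

  -- A polycube with more than `K` leaves is counted with total weight `D` through its leaves, and
  -- removing one of them leaves at least `K`. The remaining polycubes are the term `#few`.
  ∑-linear-≥ : a₁ * D ≤ ∑ L₀ linear + #few * D
  ∑-linear-≥ = begin
    a₁ * D
      ≡⟨ cong (_* D) (sym (card E₁)) ⟩
    length L₁ * D
      ≤⟨ length-filter-split few? D L₁ ⟩
    ∑ L₁ (λ Q → select (¬? (few? Q)) D) + #few * D
      ≤⟨ ℕₚ.+-monoˡ-≤ (#few * D) (begin
        ∑ L₁ (λ Q → select (¬? (few? Q)) D)
          ≤⟨ ∑-mono L₁ (λ Q∈ → each₁ (sound E₁ Q∈)) ⟩
        ∑ L₁ (λ Q → #leaves Q * h Q)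
          ≤⟨ leaf-bud-≤ E₀ E₁ h ⟩
        ∑ L₀ (λ P → ∑ (buds P) (λ s → h (insert s P)))
          ≤⟨ ∑-mono L₀ (λ {P} P∈ → each₂ (sound E₀ P∈)) ⟩
        ∑ L₀ linear ∎) ⟩
    ∑ L₀ linear + #few * D ∎
    where
    h : List Cell → ℕ
    h Q = select (¬? (few? Q)) (W (#leaves Q))
    each₁ : ∀ {Q} → Standard (suc n) Q → select (¬? (few? Q)) D ≤ #leaves Q * h Q
    each₁ {Q} std = by-cases (few? Q)
      where
      by-cases : ∀ d → select (¬? d) D ≤ #leaves Q * select (¬? {A = #leaves Q ≤ K} d) (W (#leaves Q))
      by-cases (yes _)  = z≤n
      by-cases (no ≰K) = ℕₚ.≤-reflexive (sym (W-≡ (ℕₚ.≤-trans (s≤s z≤n) (ℕₚ.≰⇒> ≰K)) (ℕₚ.m≤n⇒m≤1+n (#leaves-≤ std))))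
    each₃ : ∀ {P s} → Standard n P → s ∈ buds P → h (insert s P) ≤ W (#leaves P)
    each₃ {P} {s} std s∈ = select-elim (_≤ W (#leaves P)) (¬? (few? (insert s P))) (λ _ → W-anti (leaves-≤-insert std (∈-buds⁻ {P} s∈))) (λ _ → z≤n)
    each₄ : ∀ {P} s → Standard n P → ¬ K ≤ #leaves P → h (insert s P) ≤ 0
    each₄ {P} s std ≰ = select-elim (_≤ 0) (¬? (few? (insert s P)))
      (λ ≰K → ⊥-elim (≰ (ℕₚ.≤-pred (ℕₚ.≤-trans (ℕₚ.≰⇒> ≰K) (leaves-insert-≤ s std))))) (λ _ → z≤n)
    each₂ : ∀ {P} → Standard n P → ∑ (buds P) (λ s → h (insert s P)) ≤ linear P
    each₂ {P} std = select-elim (∑ (buds P) (λ s → h (insert s P)) ≤_) (K ≤? #leaves P)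
      (λ _ → ∑-≤-const (buds P) (W (#leaves P)) (λ s∈ → each₃ std s∈))
      (λ K≰ → ℕₚ.≤-trans (∑-≤-const (buds P) 0 (λ {s} _ → each₄ s std K≰)) (ℕₚ.≤-reflexive (ℕₚ.*-zeroʳ (#buds P))))

  -- The link between the two estimates: its square is below `square`, and it differs little from
  -- `linear`.
  middle : List Cell → ℕ
  middle P = select (K ≤? #leaves P) ((#buds P ∸ 7) * W (suc (suc (#leaves P))))

  am-gm : ∀ x y → 2 * (x * y) ≤ x * x + y * y
  am-gm x y with ℕₚ.≤-total x y
  ... | inj₁ x≤y = let z = y ∸ x in subst (λ y → 2 * (x * y) ≤ x * x + y * y) (ℕₚ.m+[n∸m]≡n x≤y)
    (ℕₚ.≤-trans (ℕₚ.m≤m+n _ (z * z)) (ℕₚ.≤-reflexive (lem x z)))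
    where
    lem : ∀ x z → 2 * (x * (x + z)) + z * z ≡ x * x + (x + z) * (x + z)
    lem = solve-∀
  ... | inj₂ y≤x = let z = x ∸ y in subst (λ x → 2 * (x * y) ≤ x * x + y * y) (ℕₚ.m+[n∸m]≡n y≤x)
    (ℕₚ.≤-trans (ℕₚ.m≤m+n _ (z * z)) (ℕₚ.≤-reflexive (lem y z)))
    where
    lem : ∀ y z → 2 * ((y + z) * y) + z * z ≡ (y + z) * (y + z) + y * y
    lem = solve-∀

  middle-square : ∀ P → middle P * middle P ≤ square P
  middle-square P = select-elim (λ m → m * m ≤ square P) (K ≤? #leaves P) (λ _ → begin
    u′ * w * (u′ * w)   ≡⟨ lem u′ w ⟩
    u′ * u′ * (w * w)   ≤⟨ ℕₚ.*-mono-≤ (ℕₚ.*-monoˡ-≤ u′ (ℕₚ.m∸n≤m (#buds P) 7)) (ℕₚ.*-monoˡ-≤ w (W-anti (ℕₚ.n≤1+n _))) ⟩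
    square P ∎) (λ _ → z≤n)
    where
    u′ = #buds P ∸ 7
    w = W (suc (suc (#leaves P)))
    lem : ∀ a w → a * w * (a * w) ≡ a * a * (w * w)
    lem = solve-∀

  -- For v ≥ K one has 1/v ≤ (1 + 2/K)/(v + 2); the seven lost buds add a term of order 1/K, since
  -- K/(v + 2) ≤ 1.
  linear-middle : ∀ {P} → Standard n P → K * K * linear P ≤ K * (2 + K) * middle P + 7 * (2 + K) * D
  linear-middle {P} std = by-cases (K ≤? #leaves P)
    where
    u = #buds P
    u′ = u ∸ 7
    v = #leaves P
    w = W (2 + v)
    by-cases : ∀ d → K * K * select {K ≤ v} d (u * W v) ≤ K * (2 + K) * select d (u′ * w) + 7 * (2 + K) * D
    by-cases (no _)   = subst (_≤ K * (2 + K) * 0 + 7 * (2 + K) * D) (sym (ℕₚ.*-zeroʳ (K * K))) z≤n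
    by-cases (yes K≤) = begin
      K * K * (u * W v)                         ≡⟨ lem₁ K u (W v) ⟩
      K * u * (K * W v)                         ≤⟨ ℕₚ.*-monoʳ-≤ (K * u) ratio ⟩
      K * u * ((2 + K) * w)                     ≤⟨ ℕₚ.*-monoˡ-≤ _ (ℕₚ.*-monoʳ-≤ K (ℕₚ.m≤n+m∸n u 7)) ⟩
      K * (7 + u′) * ((2 + K) * w)              ≡⟨ lem₂ K u′ w ⟩
      K * (2 + K) * (u′ * w) + 7 * (2 + K) * (K * w)
        ≤⟨ ℕₚ.+-monoʳ-≤ (K * (2 + K) * (u′ * w)) (ℕₚ.*-monoʳ-≤ (7 * (2 + K)) (ℕₚ.≤-trans (ℕₚ.*-monoˡ-≤ w (ℕₚ.≤-trans K≤ (ℕₚ.m≤n+m v 2))) (W-≤ (2 + v)))) ⟩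
      K * (2 + K) * (u′ * w) + 7 * (2 + K) * D  ∎
      where
      1≤v : 1 ≤ v
      1≤v = ℕₚ.≤-trans 1≤K K≤
      v≤n : v ≤ n
      v≤n = #leaves-≤ std
      lem₁ : ∀ k u w → k * k * (u * w) ≡ k * u * (k * w)
      lem₁ = solve-∀
      lem₂ : ∀ k u w → k * (7 + u) * ((2 + k) * w) ≡ k * (2 + k) * (u * w) + 7 * (2 + k) * (k * w)
      lem₂ = solve-∀
      ratio : K * W v ≤ (2 + K) * w
      ratio = ℕₚ.*-cancelˡ-≤ v {{>-nonZero 1≤v}} (begin
        v * (K * W v)         ≡⟨ lem₃ v K (W v) ⟩
        K * (v * W v)         ≡⟨ cong (K *_) (trans (W-≡ 1≤v (ℕₚ.≤-trans v≤n (ℕₚ.m≤n+m n 2))) (sym (W-≡ (s≤s z≤n) (s≤s (s≤s v≤n))))) ⟩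
        K * ((2 + v) * w)     ≡⟨ lem₄ K v w ⟩
        (2 * K + K * v) * w   ≤⟨ ℕₚ.*-monoˡ-≤ w (ℕₚ.+-monoˡ-≤ (K * v) (ℕₚ.*-monoʳ-≤ 2 K≤)) ⟩
        (2 * v + K * v) * w   ≡⟨ lem₅ K v w ⟩
        v * ((2 + K) * w)     ∎)
        where
        lem₃ : ∀ v k w → v * (k * w) ≡ k * (v * w)
        lem₃ = solve-∀
        lem₄ : ∀ k v w → k * ((2 + v) * w) ≡ (2 * k + k * v) * w
        lem₄ = solve-∀
        lem₅ : ∀ k v w → (2 * v + k * v) * w ≡ v * ((2 + k) * w)
        lem₅ = solve-∀

  -- Says that a ratio of at least R/S is followed by one of at least (R - 1)/S. Cauchy-Schwarz is
  -- used termwise as 2xy ≤ x² + y² with x = S · `middle` and y = R · D, tuned to the expected mean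
  -- R/S of `middle` / D; this keeps everything linear in the counts. The errors add up to 6RK +
  -- 14(2 + K)S, and R ≤ 10S turns this into the constant 74 = 6 · 10 + 14.
  log-concave : ∀ {R S} → 1 ≤ D → 1 ≤ S → 74 * S ≤ K → R ≤ 10 * S → R * a₀ ≤ S * a₁ → K * #few ≤ a₁ → R * a₁ ≤ S * a₂ + a₁
  log-concave {R} {S} 1≤D 1≤S 74S≤K R≤10S Ra₀≤ few≤ = ℕₚ.*-cancelˡ-≤ (K * (2 + K)) {{>-nonZero (ℕₚ.*-mono-≤ 1≤K (s≤s (z≤n {1 + K})))}}
    (ℕₚ.+-cancelʳ-≤ (T * a₁) _ _ (begin
      K * (2 + K) * (R * a₁) + T * a₁                       ≡⟨ lem₁ K R S a₁ ⟩
      (6 * (R * K) + 14 * ((2 + K) * S)) * a₁ + 2 * (R * (K * (K * a₁)))  ≤⟨ ℕₚ.+-mono-≤ (ℕₚ.*-monoˡ-≤ a₁ small) main ⟩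
      K * (2 + K) * a₁ + (K * (2 + K) * (S * a₂) + T * a₁)  ≡⟨ lem₂ (K * (2 + K)) a₁ (S * a₂) (T * a₁) ⟩
      K * (2 + K) * (S * a₂ + a₁) + T * a₁                  ∎))
    where
    T = K * (2 + K) * R + 14 * ((2 + K) * S) + 2 * (R * K)
    M = ∑ L₀ middle
    G = ∑ L₀ linear
    lem₁ : ∀ K R S a → K * (2 + K) * (R * a) + (K * (2 + K) * R + 14 * ((2 + K) * S) + 2 * (R * K)) * a
      ≡ (6 * (R * K) + 14 * ((2 + K) * S)) * a + 2 * (R * (K * (K * a)))
    lem₁ = solve-∀
    lem₂ : ∀ k a b t → k * a + (k * b + t) ≡ k * (b + a) + t
    lem₂ = solve-∀
    small : 6 * (R * K) + 14 * ((2 + K) * S) ≤ K * (2 + K)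
    small = begin
      6 * (R * K) + 14 * ((2 + K) * S)           ≤⟨ ℕₚ.+-monoˡ-≤ _ (ℕₚ.*-monoʳ-≤ 6 (ℕₚ.*-mono-≤ R≤10S (ℕₚ.m≤n+m K 2))) ⟩
      6 * (10 * S * (2 + K)) + 14 * ((2 + K) * S) ≡⟨ lem S (2 + K) ⟩
      74 * S * (2 + K)                           ≤⟨ ℕₚ.*-monoˡ-≤ (2 + K) 74S≤K ⟩
      K * (2 + K) ∎
      where
      lem : ∀ s k → 6 * (10 * s * k) + 14 * (k * s) ≡ 74 * s * k
      lem = solve-∀
    sum-middle : 2 * (R * D * (S * M)) ≤ S * S * (D * (a₂ * D)) + R * D * (R * D) * a₀
    sum-middle = begin
      2 * (R * D * (S * M))                       ≡⟨ lem R D S M ⟩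
      2 * (R * D * S) * M                         ≡⟨ sym (∑-*ˡ L₀ (2 * (R * D * S))) ⟩
      ∑ L₀ (λ P → 2 * (R * D * S) * middle P)     ≤⟨ ∑-mono L₀ (λ {P} _ → each P) ⟩
      ∑ L₀ (λ P → S * S * square P + R * D * (R * D)) ≡⟨ ∑-+ L₀ ⟩
      ∑ L₀ (λ P → S * S * square P) + ∑ L₀ (λ _ → R * D * (R * D))
        ≡⟨ cong₂ _+_ (∑-*ˡ L₀ (S * S)) (trans (∑-const L₀ _) (trans (cong (_* _) (card E₀)) (ℕₚ.*-comm a₀ _))) ⟩
      S * S * ∑ L₀ square + R * D * (R * D) * a₀  ≤⟨ ℕₚ.+-monoˡ-≤ _ (ℕₚ.*-monoʳ-≤ (S * S) ∑-square-≤) ⟩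
      S * S * (D * (a₂ * D)) + R * D * (R * D) * a₀ ∎
      where
      lem : ∀ r d s m → 2 * (r * d * (s * m)) ≡ 2 * (r * d * s) * m
      lem = solve-∀
      each : ∀ P → 2 * (R * D * S) * middle P ≤ S * S * square P + R * D * (R * D)
      each P = begin
        2 * (R * D * S) * middle P                   ≡⟨ lem′ (R * D) S (middle P) ⟩
        2 * (S * middle P * (R * D))                 ≤⟨ am-gm (S * middle P) (R * D) ⟩
        S * middle P * (S * middle P) + R * D * (R * D) ≡⟨ cong (_+ R * D * (R * D)) (lem″ S (middle P)) ⟩
        S * S * (middle P * middle P) + R * D * (R * D) ≤⟨ ℕₚ.+-monoˡ-≤ _ (ℕₚ.*-monoʳ-≤ (S * S) (middle-square P)) ⟩
        S * S * square P + R * D * (R * D) ∎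
        where
        lem′ : ∀ x s m → 2 * (x * s) * m ≡ 2 * (s * m * x)
        lem′ = solve-∀
        lem″ : ∀ s m → s * m * (s * m) ≡ s * s * (m * m)
        lem″ = solve-∀
    sum-linear : K * K * G ≤ K * (2 + K) * M + 7 * (2 + K) * D * a₀
    sum-linear = begin
      K * K * G                                   ≡⟨ sym (∑-*ˡ L₀ (K * K)) ⟩
      ∑ L₀ (λ P → K * K * linear P)               ≤⟨ ∑-mono L₀ (λ P∈ → linear-middle (sound E₀ P∈)) ⟩
      ∑ L₀ (λ P → K * (2 + K) * middle P + 7 * (2 + K) * D) ≡⟨ ∑-+ L₀ ⟩
      ∑ L₀ (λ P → K * (2 + K) * middle P) + ∑ L₀ (λ _ → 7 * (2 + K) * D)
        ≡⟨ cong₂ _+_ (∑-*ˡ L₀ (K * (2 + K))) (trans (∑-const L₀ _) (trans (cong (_* _) (card E₀)) (ℕₚ.*-comm a₀ _))) ⟩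
      K * (2 + K) * M + 7 * (2 + K) * D * a₀ ∎
    scaled : D * D * S * (2 * (R * (K * (K * a₁)))) ≤ D * D * S * (K * (2 + K) * (S * a₂) + T * a₁)
    scaled = begin
      D * D * S * (2 * (R * (K * (K * a₁))))
        ≡⟨ e₁ D S R K a₁ ⟩
      2 * (R * (D * S)) * (K * K) * (a₁ * D)
        ≤⟨ ℕₚ.*-monoʳ-≤ (2 * (R * (D * S)) * (K * K)) ∑-linear-≥ ⟩
      2 * (R * (D * S)) * (K * K) * (G + #few * D)
        ≡⟨ e₂ (2 * (R * (D * S))) K G (#few) D ⟩
      2 * (R * (D * S)) * (K * K * G) + 2 * (R * (D * S)) * K * D * (K * #few)
        ≤⟨ ℕₚ.+-mono-≤ (ℕₚ.*-monoʳ-≤ (2 * (R * (D * S))) sum-linear) (ℕₚ.*-monoʳ-≤ (2 * (R * (D * S)) * K * D) few≤) ⟩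
      2 * (R * (D * S)) * (K * (2 + K) * M + 7 * (2 + K) * D * a₀) + 2 * (R * (D * S)) * K * D * a₁
        ≡⟨ e₃ R D S K M a₀ a₁ ⟩
      K * (2 + K) * (2 * (R * D * (S * M))) + 14 * (2 + K) * (D * D * S) * (R * a₀) + 2 * (R * (D * S)) * K * D * a₁
        ≤⟨ ℕₚ.+-monoˡ-≤ _ (ℕₚ.+-mono-≤ (ℕₚ.*-monoʳ-≤ (K * (2 + K)) sum-middle) (ℕₚ.*-monoʳ-≤ (14 * (2 + K) * (D * D * S)) Ra₀≤)) ⟩
      K * (2 + K) * (S * S * (D * (a₂ * D)) + R * D * (R * D) * a₀) + 14 * (2 + K) * (D * D * S) * (S * a₁) + 2 * (R * (D * S)) * K * D * a₁
        ≡⟨ e₄ K S D a₂ R a₀ a₁ ⟩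
      K * (2 + K) * (R * (D * D)) * (R * a₀) + (K * (2 + K) * (S * S * (D * (a₂ * D))) + 14 * (2 + K) * (D * D * S) * (S * a₁) + 2 * (R * (D * S)) * K * D * a₁)
        ≤⟨ ℕₚ.+-monoˡ-≤ _ (ℕₚ.*-monoʳ-≤ (K * (2 + K) * (R * (D * D))) Ra₀≤) ⟩
      K * (2 + K) * (R * (D * D)) * (S * a₁) + (K * (2 + K) * (S * S * (D * (a₂ * D))) + 14 * (2 + K) * (D * D * S) * (S * a₁) + 2 * (R * (D * S)) * K * D * a₁)
        ≡⟨ e₅ K S D a₂ R a₁ ⟩
      D * D * S * (K * (2 + K) * (S * a₂) + T * a₁) ∎
      where
      e₁ : ∀ D S R K a → D * D * S * (2 * (R * (K * (K * a)))) ≡ 2 * (R * (D * S)) * (K * K) * (a * D)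
      e₁ = solve-∀
      e₂ : ∀ x K G f D → x * (K * K) * (G + f * D) ≡ x * (K * K * G) + x * K * D * (K * f)
      e₂ = solve-∀
      e₃ : ∀ R D S K M a b → 2 * (R * (D * S)) * (K * (2 + K) * M + 7 * (2 + K) * D * a) + 2 * (R * (D * S)) * K * D * b
        ≡ K * (2 + K) * (2 * (R * D * (S * M))) + 14 * (2 + K) * (D * D * S) * (R * a) + 2 * (R * (D * S)) * K * D * b
      e₃ = solve-∀
      e₄ : ∀ K S D c R a b → K * (2 + K) * (S * S * (D * (c * D)) + R * D * (R * D) * a) + 14 * (2 + K) * (D * D * S) * (S * b) + 2 * (R * (D * S)) * K * D * b
        ≡ K * (2 + K) * (R * (D * D)) * (R * a) + (K * (2 + K) * (S * S * (D * (c * D))) + 14 * (2 + K) * (D * D * S) * (S * b) + 2 * (R * (D * S)) * K * D * b)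
      e₄ = solve-∀
      e₅ : ∀ K S D c R b → K * (2 + K) * (R * (D * D)) * (S * b) + (K * (2 + K) * (S * S * (D * (c * D))) + 14 * (2 + K) * (D * D * S) * (S * b) + 2 * (R * (D * S)) * K * D * b)
        ≡ D * D * S * (K * (2 + K) * (S * c) + (K * (2 + K) * R + 14 * ((2 + K) * S) + 2 * (R * K)) * b)
      e₅ = solve-∀
    main : 2 * (R * (K * (K * a₁))) ≤ K * (2 + K) * (S * a₂) + T * a₁
    main = ℕₚ.*-cancelˡ-≤ (D * D * S) {{>-nonZero (ℕₚ.*-mono-≤ (ℕₚ.*-mono-≤ 1≤D 1≤D) 1≤S)}} scaled

-- Polycubes with few leaves

Near : ℤ → ℤ → Set
Near i j = i ≡ j ⊎ i ≡ j Z.+ Z.1ℤ ⊎ i ≡ j Z.+ Z.-1ℤ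

near? : ∀ i j → Dec (Near i j)
near? i j with i Z.≟ j | i Z.≟ j Z.+ Z.1ℤ | i Z.≟ j Z.+ Z.-1ℤ
... | yes p | _     | _     = yes (inj₁ p)
... | no _  | yes p | _     = yes (inj₂ (inj₁ p))
... | no _  | no _  | yes p = yes (inj₂ (inj₂ p))
... | no p  | no q  | no r  = no [ p , [ q , r ]′ ]′

-- α cuts a polycube into slabs and η measures heights inside them.
record Frame : Set₁ where
  field
    α η         : Cell → ℤ
    up fwd bwd  : Dir
    Admissible  : ℤ → Set
    admissible? : Decidable Admissible
    α-up  : ∀ c → α (move up c) ≡ α c
    η-up  : ∀ c → η c Z.< η (move up c)
    α-fwd : ∀ c → α (move fwd c) ≡ α c Z.+ Z.1ℤ
    α-bwd : ∀ c → α (move bwd c) ≡ α c Z.+ Z.-1ℤ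
    η-fwd : ∀ c → η (move fwd c) ≡ η c
    η-bwd : ∀ c → η (move bwd c) ≡ η c
    near-move : ∀ d c → Near (α c) (α (move d c))
    rise      : ∀ d c → d ≡ opp up ⊎ η c Z.≤ η (move d c)
    -- Ensures that the cells placed on top of a slab come after the origin, so the enlarged
    -- polycube is still in normal form.
    positive  : ∀ {n P c d} → Standard n P → c ∈ P → Admissible (α d) → η c Z.< η d → 0ᶜ <ᶜ d

maximum : ∀ (f : Cell → ℤ) {c xs} → c ∈ xs → ∃ λ m → m ∈ xs × ∀ {a} → a ∈ xs → f a Z.≤ f m
maximum f {xs = x ∷ []} _ = x , here refl , λ { (here refl) → ℤₚ.≤-refl }
maximum f {xs = x ∷ y ∷ ys} _ with maximum f {y} {y ∷ ys} (here refl)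
... | m , m∈ , max with ℤₚ.≤-total (f x) (f m)
...   | inj₁ x≤m = m , there m∈ , λ { (here refl) → x≤m ; (there a∈) → max a∈ }
...   | inj₂ m≤x = x , here refl , λ { (here refl) → ℤₚ.≤-refl ; (there a∈) → ℤₚ.≤-trans (max a∈) m≤x }

degree-≤1⁺ : ∀ {P c s} → (∀ {a} → a ∈ nbrs c → a ∈ P → a ≡ s) → degree P c ≤ 1
degree-≤1⁺ {P} {c} {s} h = length-⊆ {ys = s ∷ []} (Uniqueₚ.filter⁺ (_∈? P) (nbrs-unique c))
  (λ a∈ → let p , q = ∈-filter⁻ (_∈? P) {xs = nbrs c} a∈ in here (h p q))

module Slabs (Φ : Frame) where
  open Frame Φ

  slabs : List Cell → List ℤ
  slabs P = filter admissible? (deduplicate Z._≟_ (map α P))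

  #slabs : List Cell → ℕ
  #slabs P = length (slabs P)

  slabs-unique : ∀ P → Unique (slabs P)
  slabs-unique P = Uniqueₚ.filter⁺ admissible? (DecUnique.deduplicate-! Z._≟_ (map α P))

  ∈-slabs⁺ : ∀ {P c} → c ∈ P → Admissible (α c) → α c ∈ slabs P
  ∈-slabs⁺ c∈ adm = ∈-filter⁺ admissible? (∈-deduplicate⁺ Z._≟_ (∈-map⁺ α c∈)) adm

  ∈-slabs⁻ : ∀ {P i} → i ∈ slabs P → Admissible i × ∃ λ c → c ∈ P × i ≡ α c
  ∈-slabs⁻ {P} i∈ = let p , adm = ∈-filter⁻ admissible? {xs = deduplicate Z._≟_ (map α P)} i∈ in
    adm , ∈-map⁻ α (∈-deduplicate⁻ Z._≟_ (map α P) p)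

  #slabs-mono : ∀ {P Q} → (∀ {a} → a ∈ P → a ∈ Q) → #slabs P ≤ #slabs Q
  #slabs-mono {P} s = length-⊆ (slabs-unique P) λ i∈ → let adm , c , c∈ , eq = ∈-slabs⁻ {P} i∈ in
    subst (_∈ _) (sym eq) (∈-slabs⁺ (s c∈) (subst Admissible eq adm))

  -- A site `s` in slab `i`, occupied or attachable, at least as high as all cells of this slab and
  -- of the two adjacent ones. The cell above `s` can then touch nothing but `s`, so it becomes a
  -- leaf.
  record Top (P : List Cell) (i : ℤ) : Set where
    constructor top
    field
      s     : Cell
      slab  : α s ≡ i
      high  : ∀ {a} → a ∈ P → Near i (α a) → η a Z.≤ η s
      joint : s ∈ P ⊎ (s ∉ P × (∃ λ a → a ∈ nbrs s × a ∈ P) × (∀ {a} → a ∈ P → α a ≡ i → η a Z.< η s))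

  -- Take a highest cell `m` of the three slabs. If it lies in an adjacent slab, step sideways from
  -- it into the slab of `c`. Should that site be empty, either some cell of the slab has the same
  -- height and serves instead, or all of them are strictly lower.
  topmost : ∀ {P c} → c ∈ P → Top P (α c)
  topmost {P} {c} c∈ with maximum η (∈-filter⁺ (λ a → near? (α c) (α a)) c∈ (inj₁ refl))
  ... | m , m∈ , max with ∈-filter⁻ (λ a → near? (α c) (α a)) {xs = P} m∈
  ... | mP , near = go near
    where
    max′ : ∀ {a} → a ∈ P → Near (α c) (α a) → η a Z.≤ η m
    max′ a∈ nr = max (∈-filter⁺ (λ a → near? (α c) (α a)) a∈ nr)
    beside : ∀ s → α s ≡ α c → η s ≡ η m → m ∈ nbrs s → Top P (α c)
    beside s slab same m∈n with s ∈? P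
    ... | yes s∈ = top s slab (λ a∈ nr → subst (η _ Z.≤_) (sym same) (max′ a∈ nr)) (inj₁ s∈)
    ... | no s∉ with All.all? (λ a → ¬? (α a Z.≟ α c ×-dec η a Z.≟ η m)) P
    ...   | yes all = top s slab (λ a∈ nr → subst (η _ Z.≤_) (sym same) (max′ a∈ nr)) (inj₂ (s∉ , (m , m∈n , mP) ,
              λ {a} a∈ eq → subst (η a Z.<_) (sym same) (ℤₚ.≤∧≢⇒< (max′ a∈ (inj₁ (sym eq))) (λ eq′ → All.lookup all a∈ (eq , eq′)))))
    ...   | no ¬all = find (Allₚ.¬All⇒Any¬ (λ a → ¬? (α a Z.≟ α c ×-dec η a Z.≟ η m)) P ¬all)
      where
      find : Any (λ a → ¬ ¬ (α a ≡ α c × η a ≡ η m)) P → Top P (α c)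
      find p with pick p
        where
        pick : ∀ {P} → Any (λ a → ¬ ¬ (α a ≡ α c × η a ≡ η m)) P → ∃ λ a → a ∈ P × α a ≡ α c × η a ≡ η m
        pick {a ∷ _} (here nn) with α a Z.≟ α c | η a Z.≟ η m
        ... | yes e | yes e′ = a , here refl , e , e′
        ... | no ne | _      = ⊥-elim (nn (ne ∘ proj₁))
        ... | _     | no ne  = ⊥-elim (nn (ne ∘ proj₂))
        pick (there p) = let a , a∈ , e = pick p in a , there a∈ , e
      ... | a , a∈ , e , e′ = top a e (λ b∈ nr → subst (η _ Z.≤_) (sym e′) (max′ b∈ nr)) (inj₁ a∈)
    go : Near (α c) (α m) → Top P (α c)
    go (inj₁ eq)        = top m (sym eq) max′ (inj₁ mP)
    go (inj₂ (inj₁ eq)) = beside (move fwd m) (trans (α-fwd m) (sym eq)) (η-fwd m) (nbrs-sym {move fwd m} {m} (move-∈-nbrs fwd m))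
    go (inj₂ (inj₂ eq)) = beside (move bwd m) (trans (α-bwd m) (sym eq)) (η-bwd m) (nbrs-sym {move bwd m} {m} (move-∈-nbrs bwd m))

  Few : ℕ → ℕ → List Cell → Set
  Few v w Q = #leaves Q ≤ v × w ≤ #slabs Q

  few? : ∀ v w → Decidable (Few v w)
  few? v w Q = (#leaves Q ≤? v) ×-dec (w ≤? #slabs Q)

  few : ℕ → ℕ → List (List Cell) → List (List Cell)
  few v w = filter (few? v w)

  SpotCode : Set
  SpotCode = List Cell × Cell ⊎ List Cell × Cell

  -- The marked leaf tells everything: its slab, and the place just below it of the other new cell
  -- if the tag says that there are two.
  undo : SpotCode → List Cell × ℤ
  undo (inj₁ (R , t)) = remove t R , α t
  undo (inj₂ (R , t)) = remove (move (opp up) t) (remove t R) , α t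

  module _ {n a₀ a₁ a₂} (E₀ : Enumeration n a₀) (E₁ : Enumeration (suc n) a₁) (E₂ : Enumeration (suc (suc n)) a₂) (v w : ℕ) where

    spot-codes : List SpotCode
    spot-codes = map inj₁ (pairs (few (2 + v) w (list E₁)) leaves) ++ map inj₂ (pairs (few (2 + v) w (list E₂)) leaves)

    spot-code : ∀ {Q i} → Q ∈ few v w (list E₀) → i ∈ slabs Q → ∃ λ y → y ∈ spot-codes × undo y ≡ (Q , i)
    spot-code {Q} {i} Q∈ i∈ with ∈-filter⁻ (few? v w) {xs = list E₀} Q∈ | ∈-slabs⁻ {Q} i∈
    ... | Q∈L , leaves≤ , slabs≥ | adm , c , c∈ , refl with topmost c∈
    ... | top s slab high joint = spot joint
      where
      std : Standard n Q
      std = sound E₀ Q∈L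
      t = move up s
      αt : α t ≡ α c
      αt = trans (α-up s) slab
      adm-t : Admissible (α t)
      adm-t = subst Admissible (sym αt) adm
      down : move (opp up) t ≡ s
      down = move-opp up s
      c≤s : η c Z.≤ η s
      c≤s = high c∈ (inj₁ refl)
      0<t : 0ᶜ <ᶜ t
      0<t = positive std c∈ adm-t (ℤₚ.≤-<-trans c≤s (η-up s))
      t∉ : t ∉ Q
      t∉ t∈ = ℤₚ.<⇒≱ (η-up s) (high t∈ (inj₁ (sym αt)))
      t-nbr : ∀ {a} → a ∈ nbrs t → a ∈ Q → a ≡ s
      t-nbr an aQ with adj-dir (∈-nbrs⁻ {t} an)
      ... | d , refl with rise d t
      ...   | inj₁ refl = down
      ...   | inj₂ t≤a = ⊥-elim (ℤₚ.<⇒≱ (ℤₚ.<-≤-trans (η-up s) t≤a)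
                (high aQ (subst (λ i → Near i (α (move d t))) αt (near-move d t))))
      s∈n : s ∈ nbrs t
      s∈n = nbrs-sym {t} {s} (move-∈-nbrs up s)
      t≢0 : t ≢ 0ᶜ
      t≢0 eq = <ᶜ-irrefl (subst (0ᶜ <ᶜ_) eq 0<t)
      spot : s ∈ Q ⊎ (s ∉ Q × (∃ λ a → a ∈ nbrs s × a ∈ Q) × (∀ {a} → a ∈ Q → α a ≡ α c → η a Z.< η s)) →
        ∃ λ y → y ∈ spot-codes × undo y ≡ (Q , α c)
      spot (inj₁ s∈) = inj₁ (R , t) , ∈-++⁺ˡ (∈-map⁺ inj₁ (∈-pairs⁺ R∈ t-leaf)) , cong₂ _,_ (remove-insert (Standard.sorted std) t∉) αt
        where
        R = insert t Q
        R∈ : R ∈ few (2 + v) w (list E₁)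
        R∈ = ∈-filter⁺ (few? (2 + v) w) (complete E₁ (insert-standard std t∉ 0<t (s , s∈n , s∈)))
          (ℕₚ.≤-trans (leaves-insert-≤ t std) (s≤s (ℕₚ.m≤n⇒m≤1+n leaves≤)) , ℕₚ.≤-trans slabs≥ (#slabs-mono {Q} {R} (∈-insert-there t)))
        t-leaf : t ∈ leaves R
        t-leaf = ∈-filter⁺ (leaf? R) (∈-insert-here t Q) (t≢0 , degree-≤1⁺ {R} {t} {s}
          (λ an a∈ → [ (λ { refl → ⊥-elim (move-≢ t an) }) , t-nbr an ]′ (∈-insert⁻ t Q a∈)))
      spot (inj₂ (s∉ , nb , s-high)) = inj₂ (R , t) , ∈-++⁺ʳ (map inj₁ (pairs (few (2 + v) w (list E₁)) leaves)) (∈-map⁺ inj₂ (∈-pairs⁺ R∈ t-leaf)) ,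
          cong₂ _,_ (trans (cong₂ remove down (remove-insert (Standard.sorted stdS) t∉S)) (remove-insert (Standard.sorted std) s∉)) αt
        where
        S = insert s Q
        R = insert t S
        -- An empty site must itself come after the origin, which is why `joint` records strict
        -- height over its slab.
        0<s : 0ᶜ <ᶜ s
        0<s = positive std c∈ (subst Admissible (sym slab) adm) (s-high c∈ refl)
        stdS : Standard (suc n) S
        stdS = insert-standard std s∉ 0<s nb
        t∉S : t ∉ S
        t∉S t∈ with ∈-insert⁻ s Q t∈
        ... | inj₁ eq = ℤₚ.<-irrefl (cong η (sym eq)) (η-up s)
        ... | inj₂ p  = t∉ p
        R∈ : R ∈ few (2 + v) w (list E₂)
        R∈ = ∈-filter⁺ (few? (2 + v) w) (complete E₂ (insert-standard stdS t∉S 0<t (s , s∈n , ∈-insert-here s Q)))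
          (ℕₚ.≤-trans (leaves-insert-≤ t stdS) (s≤s (ℕₚ.≤-trans (leaves-insert-≤ s std) (s≤s leaves≤))) ,
           ℕₚ.≤-trans slabs≥ (#slabs-mono {Q} {R} (∈-insert-there t ∘ ∈-insert-there s)))
        t-leaf : t ∈ leaves R
        t-leaf = ∈-filter⁺ (leaf? R) (∈-insert-here t S) (t≢0 , degree-≤1⁺ {R} {t} {s}
          (λ an a∈ → [ (λ { refl → ⊥-elim (move-≢ t an) }) , (λ a∈S → [ id , t-nbr an ]′ (∈-insert⁻ s Q a∈S)) ]′ (∈-insert⁻ t S a∈)))

    -- Every polycube offers at least `w` slabs, while an enlarged one with at most 2 + v leaves
    -- carries at most 2 + v marks. Up to two insertions account for the two sizes and for the shift
    -- of `v` by 2.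
    few-step : w * length (few v w (list E₀)) ≤ (2 + v) * (length (few (2 + v) w (list E₁)) + length (few (2 + v) w (list E₂)))
    few-step = begin
      w * length F₀                            ≡⟨ trans (ℕₚ.*-comm w _) (sym (∑-const F₀ w)) ⟩
      ∑ F₀ (λ _ → w)                           ≤⟨ ∑-mono F₀ (λ {Q} Q∈ → ℕₚ.≤-trans (proj₂ (proj₂ (∈-filter⁻ (few? v w) {xs = list E₀} Q∈))) (ℕₚ.≤-reflexive (sym (∑-1 (slabs Q))))) ⟩
      ∑ F₀ (λ Q → ∑ (slabs Q) (λ _ → 1))       ≡⟨ trans (sym (∑-pairs F₀ slabs)) (∑-1 (pairs F₀ slabs)) ⟩
      length (pairs F₀ slabs)                  ≤⟨ length-cover spot-codes undo (unique-pairs (Uniqueₚ.filter⁺ (few? v w) (unique E₀)) (λ {Q} _ → slabs-unique Q))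
                                                    (λ p → let Q∈ , i∈ = ∈-pairs⁻ F₀ p in spot-code Q∈ i∈) ⟩
      length spot-codes                             ≡⟨ trans (Listₚ.length-++ (map inj₁ (pairs F₁ leaves))) (cong₂ _+_ (Listₚ.length-map inj₁ (pairs F₁ leaves)) (Listₚ.length-map inj₂ (pairs F₂ leaves))) ⟩
      length (pairs F₁ leaves) + length (pairs F₂ leaves) ≤⟨ ℕₚ.+-mono-≤ (count (list E₁)) (count (list E₂)) ⟩
      length F₁ * (2 + v) + length F₂ * (2 + v) ≡⟨ trans (sym (ℕₚ.*-distribʳ-+ (2 + v) (length F₁) (length F₂))) (ℕₚ.*-comm (length F₁ + length F₂) (2 + v)) ⟩
      (2 + v) * (length F₁ + length F₂) ∎
      where
      open ℕₚ.≤-Reasoning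
      F₀ = few v w (list E₀)
      F₁ = few (2 + v) w (list E₁)
      F₂ = few (2 + v) w (list E₂)
      count : ∀ L → length (pairs (few (2 + v) w L) leaves) ≤ length (few (2 + v) w L) * (2 + v)
      count L = ℕₚ.≤-trans (ℕₚ.≤-reflexive (trans (sym (∑-1 (pairs (few (2 + v) w L) leaves))) (∑-pairs (few (2 + v) w L) leaves)))
        (∑-≤-const (few (2 + v) w L) (2 + v) (λ {Q} Q∈ → ℕₚ.≤-trans (ℕₚ.≤-reflexive (∑-1 (leaves Q))) (proj₁ (proj₂ (∈-filter⁻ (few? (2 + v) w) {xs = L} Q∈)))))

  -- Iterates `few-step`: each of the `k` rounds costs at most `V` for the marked leaf and 2 for the
  -- two possible sizes, both replaced by the larger by monotonicity.
  few-bound : ∀ {b} (E : ∀ n → Enumeration (suc n) (b n)) (mono : ∀ n → b n ≤ b (suc n)) w k N v V → v + 2 * k ≤ V →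
    w ^ k * length (few v w (list (E N))) ≤ (2 * V) ^ k * b (N + 2 * k)
  few-bound {b} E mono w zero N v V _ = ℕₚ.*-monoʳ-≤ 1 (ℕₚ.≤-trans (Listₚ.length-filter (few? v w) (list (E N)))
    (ℕₚ.≤-reflexive (trans (card (E N)) (cong b (sym (ℕₚ.+-identityʳ N))))))
  few-bound {b} E mono w (suc k) N v V le = begin
    w * w ^ k * F₀                        ≡⟨ lem₁ w (w ^ k) F₀ ⟩
    w ^ k * (w * F₀)                      ≤⟨ ℕₚ.*-monoʳ-≤ (w ^ k) (few-step (E N) (E (suc N)) (E (suc (suc N))) v w) ⟩
    w ^ k * ((2 + v) * (F₁ + F₂))         ≡⟨ lem₂ (w ^ k) (2 + v) F₁ F₂ ⟩
    (2 + v) * (w ^ k * F₁ + w ^ k * F₂)   ≤⟨ ℕₚ.*-mono-≤ (ℕₚ.≤-trans (ℕₚ.m≤m+n (2 + v) (2 * k)) le′)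
                                              (ℕₚ.+-mono-≤ (few-bound E mono w k (suc N) (2 + v) V le′) (few-bound E mono w k (suc (suc N)) (2 + v) V le′)) ⟩
    V * ((2 * V) ^ k * b (suc N + 2 * k) + (2 * V) ^ k * b (suc (suc N) + 2 * k))
                                          ≤⟨ ℕₚ.*-monoʳ-≤ V (ℕₚ.+-monoˡ-≤ _ (ℕₚ.*-monoʳ-≤ ((2 * V) ^ k) (mono (suc N + 2 * k)))) ⟩
    V * ((2 * V) ^ k * b (suc (suc N) + 2 * k) + (2 * V) ^ k * b (suc (suc N) + 2 * k))
                                          ≡⟨ trans (lem₃ V ((2 * V) ^ k) _) (cong (λ m → 2 * V * (2 * V) ^ k * b m) (lem₄ N k)) ⟩
    2 * V * (2 * V) ^ k * b (N + 2 * suc k) ∎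
    where
    open ℕₚ.≤-Reasoning
    F₀ = length (few v w (list (E N)))
    F₁ = length (few (2 + v) w (list (E (suc N))))
    F₂ = length (few (2 + v) w (list (E (suc (suc N)))))
    lem₁ : ∀ w p f → w * p * f ≡ p * (w * f)
    lem₁ = solve-∀
    lem₂ : ∀ p v f g → p * (v * (f + g)) ≡ v * (p * f + p * g)
    lem₂ = solve-∀
    lem₃ : ∀ v p b → v * (p * b + p * b) ≡ 2 * v * p * b
    lem₃ = solve-∀
    lem₄ : ∀ N k → suc (suc N) + 2 * k ≡ N + 2 * suc k
    lem₄ = solve-∀
    le′ : 2 + v + 2 * k ≤ V
    le′ = ℕₚ.≤-trans (ℕₚ.≤-reflexive (lem₅ v k)) le
      where
      lem₅ : ∀ v k → 2 + v + 2 * k ≡ v + 2 * suc k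
      lem₅ = solve-∀

private
  pred-suc : ∀ i → i ≡ (i Z.+ Z.1ℤ) Z.+ Z.-1ℤ
  pred-suc i = sym (trans (ℤₚ.+-assoc i Z.1ℤ Z.-1ℤ) (ℤₚ.+-identityʳ i))
  suc-pred : ∀ i → i ≡ (i Z.+ Z.-1ℤ) Z.+ Z.1ℤ
  suc-pred i = sym (trans (ℤₚ.+-assoc i Z.-1ℤ Z.1ℤ) (ℤₚ.+-identityʳ i))
  i<i+1 : ∀ i → i Z.< i Z.+ Z.1ℤ
  i<i+1 i = subst (Z._< i Z.+ Z.1ℤ) (ℤₚ.+-identityʳ i) (ℤₚ.+-monoʳ-< i (Z.+<+ (s≤s z≤n)))
  i≤i+0 : ∀ i → i Z.≤ i Z.+ Z.0ℤ
  i≤i+0 i = ℤₚ.≤-reflexive (sym (ℤₚ.+-identityʳ i))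
  near-0 : ∀ i → Near i (i Z.+ Z.0ℤ)
  near-0 i = inj₁ (sym (ℤₚ.+-identityʳ i))
  near-suc : ∀ i → Near i (i Z.+ Z.1ℤ)
  near-suc i = inj₂ (inj₂ (pred-suc i))
  near-pred : ∀ i → Near i (i Z.+ Z.-1ℤ)
  near-pred i = inj₂ (inj₁ (suc-pred i))

x-nonneg : ∀ {n P c} → Standard n P → c ∈ P → Z.0ℤ Z.≤ proj₁ c
x-nonneg std c∈ = ℤₚ.≮⇒≥ (λ x<0 → Standard.0≤ std c∈ (inj₁ x<0))

-- Here the slab coordinate is the leading one, so admitting only positive slabs puts every new cell
-- after the origin.
x-frame : Frame
x-frame = record
  { α = proj₁ ; η = proj₁ ∘ proj₂ ; up = y⁺ ; fwd = x⁺ ; bwd = x⁻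
  ; Admissible = λ i → Z.0ℤ Z.< i ; admissible? = λ i → Z.0ℤ ℤₚ.<? i
  ; α-up = λ c → ℤₚ.+-identityʳ (proj₁ c) ; η-up = λ c → i<i+1 (proj₁ (proj₂ c))
  ; α-fwd = λ _ → refl ; α-bwd = λ _ → refl
  ; η-fwd = λ c → ℤₚ.+-identityʳ (proj₁ (proj₂ c)) ; η-bwd = λ c → ℤₚ.+-identityʳ (proj₁ (proj₂ c))
  ; near-move = near ; rise = rise′
  ; positive = λ _ _ 0<x _ → inj₁ 0<x
  }
  where
  near : ∀ d c → Near (proj₁ c) (proj₁ (move d c))
  near x⁺ c = near-suc (proj₁ c)
  near x⁻ c = near-pred (proj₁ c)
  near y⁺ c = near-0 (proj₁ c)
  near y⁻ c = near-0 (proj₁ c)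
  near z⁺ c = near-0 (proj₁ c)
  near z⁻ c = near-0 (proj₁ c)
  rise′ : ∀ d c → d ≡ y⁻ ⊎ proj₁ (proj₂ c) Z.≤ proj₁ (proj₂ (move d c))
  rise′ x⁺ c = inj₂ (i≤i+0 (proj₁ (proj₂ c)))
  rise′ x⁻ c = inj₂ (i≤i+0 (proj₁ (proj₂ c)))
  rise′ y⁺ c = inj₂ (ℤₚ.<⇒≤ (i<i+1 (proj₁ (proj₂ c))))
  rise′ y⁻ c = inj₁ refl
  rise′ z⁺ c = inj₂ (i≤i+0 (proj₁ (proj₂ c)))
  rise′ z⁻ c = inj₂ (i≤i+0 (proj₁ (proj₂ c)))

rise-x : ∀ d c → d ≡ x⁻ ⊎ proj₁ c Z.≤ proj₁ (move d c)
rise-x x⁺ c = inj₂ (ℤₚ.<⇒≤ (i<i+1 (proj₁ c)))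
rise-x x⁻ c = inj₁ refl
rise-x y⁺ c = inj₂ (i≤i+0 (proj₁ c))
rise-x y⁻ c = inj₂ (i≤i+0 (proj₁ c))
rise-x z⁺ c = inj₂ (i≤i+0 (proj₁ c))
rise-x z⁻ c = inj₂ (i≤i+0 (proj₁ c))

-- Here `up` increases x, which is nonnegative on a normal form, so all slabs are admissible;
-- `z-frame` works in the same way.
y-frame : Frame
y-frame = record
  { α = proj₁ ∘ proj₂ ; η = proj₁ ; up = x⁺ ; fwd = y⁺ ; bwd = y⁻
  ; Admissible = λ _ → ⊤ ; admissible? = λ _ → yes tt
  ; α-up = λ c → ℤₚ.+-identityʳ (proj₁ (proj₂ c)) ; η-up = λ c → i<i+1 (proj₁ c)
  ; α-fwd = λ _ → refl ; α-bwd = λ _ → refl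
  ; η-fwd = λ c → ℤₚ.+-identityʳ (proj₁ c) ; η-bwd = λ c → ℤₚ.+-identityʳ (proj₁ c)
  ; near-move = near ; rise = rise-x
  ; positive = λ std c∈ _ lt → inj₁ (ℤₚ.≤-<-trans (x-nonneg std c∈) lt)
  }
  where
  near : ∀ d c → Near (proj₁ (proj₂ c)) (proj₁ (proj₂ (move d c)))
  near x⁺ c = near-0 (proj₁ (proj₂ c))
  near x⁻ c = near-0 (proj₁ (proj₂ c))
  near y⁺ c = near-suc (proj₁ (proj₂ c))
  near y⁻ c = near-pred (proj₁ (proj₂ c))
  near z⁺ c = near-0 (proj₁ (proj₂ c))
  near z⁻ c = near-0 (proj₁ (proj₂ c))

z-frame : Frame
z-frame = record
  { α = proj₂ ∘ proj₂ ; η = proj₁ ; up = x⁺ ; fwd = z⁺ ; bwd = z⁻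
  ; Admissible = λ _ → ⊤ ; admissible? = λ _ → yes tt
  ; α-up = λ c → ℤₚ.+-identityʳ (proj₂ (proj₂ c)) ; η-up = λ c → i<i+1 (proj₁ c)
  ; α-fwd = λ _ → refl ; α-bwd = λ _ → refl
  ; η-fwd = λ c → ℤₚ.+-identityʳ (proj₁ c) ; η-bwd = λ c → ℤₚ.+-identityʳ (proj₁ c)
  ; near-move = near ; rise = rise-x
  ; positive = λ std c∈ _ lt → inj₁ (ℤₚ.≤-<-trans (x-nonneg std c∈) lt)
  }
  where
  near : ∀ d c → Near (proj₂ (proj₂ c)) (proj₂ (proj₂ (move d c)))
  near x⁺ c = near-0 (proj₂ (proj₂ c))
  near x⁻ c = near-0 (proj₂ (proj₂ c))
  near y⁺ c = near-0 (proj₂ (proj₂ c))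
  near y⁻ c = near-0 (proj₂ (proj₂ c))
  near z⁺ c = near-suc (proj₂ (proj₂ c))
  near z⁻ c = near-pred (proj₂ (proj₂ c))

module X = Slabs x-frame
module Y = Slabs y-frame
module Zs = Slabs z-frame

-- A polycube fits in the product of its three projections, whence one of them is large.
size-≤-slabs : ∀ {n P} → Standard n P → n ≤ suc (X.#slabs P) * (Y.#slabs P * Zs.#slabs P)
size-≤-slabs {n} {P} std = begin
  n              ≡⟨ sym (Standard.len std) ⟩
  length P       ≤⟨ length-⊆ (sorted-unique (Standard.sorted std)) into ⟩
  length box     ≡⟨ trans (length-pairs xs (pairs ys (λ _ → zs))) (cong (length xs *_) (length-pairs ys zs)) ⟩
  length xs * (length ys * length zs) ∎
  where
  open ℕₚ.≤-Reasoning
  xs = Z.0ℤ ∷ X.slabs P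
  ys = Y.slabs P
  zs = Zs.slabs P
  box : List Cell
  box = pairs xs (λ _ → pairs ys (λ _ → zs))
  in-xs : ∀ {c} → c ∈ P → proj₁ c ∈ xs
  in-xs {c} c∈ with ℤₚ.<-cmp Z.0ℤ (proj₁ c)
  ... | tri< 0<x _ _ = there (X.∈-slabs⁺ c∈ 0<x)
  ... | tri≈ _ eq _  = here (sym eq)
  ... | tri> _ _ x<0 = ⊥-elim (ℤₚ.<⇒≱ x<0 (x-nonneg std c∈))
  into : ∀ {c} → c ∈ P → c ∈ box
  into {x , y , z} c∈ = ∈-pairs⁺ (in-xs c∈) (∈-pairs⁺ (Y.∈-slabs⁺ c∈ tt) (Zs.∈-slabs⁺ c∈ tt))

module _ {b : ℕ → ℕ} (E : ∀ n → Enumeration (suc n) (b n)) (mono : ∀ n → b n ≤ b (suc n)) where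

  few-leaves-bound : ∀ w k N v V → v + 2 * k ≤ V → w * (w * w) < suc N →
    w ^ k * length (filter (λ Q → #leaves Q ≤? v) (list (E N))) ≤ 3 * ((2 * V) ^ k * b (N + 2 * k))
  few-leaves-bound w k N v V le large = begin
    w ^ k * length F
      ≤⟨ ℕₚ.*-monoʳ-≤ (w ^ k) (length-⊆ {ys = FX ++ FY ++ FZ} (Uniqueₚ.filter⁺ (λ Q → #leaves Q ≤? v) (unique (E N))) into) ⟩
    w ^ k * length (FX ++ FY ++ FZ)
      ≡⟨ cong (w ^ k *_) (trans (Listₚ.length-++ FX) (cong (length FX +_) (Listₚ.length-++ FY))) ⟩
    w ^ k * (length FX + (length FY + length FZ))
      ≡⟨ lem (w ^ k) (length FX) (length FY) (length FZ) ⟩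
    w ^ k * length FX + (w ^ k * length FY + (w ^ k * length FZ + 0))
      ≤⟨ ℕₚ.+-mono-≤ (X.few-bound E mono w k N v V le) (ℕₚ.+-mono-≤ (Y.few-bound E mono w k N v V le) (ℕₚ.+-monoˡ-≤ 0 (Zs.few-bound E mono w k N v V le))) ⟩
    3 * ((2 * V) ^ k * b (N + 2 * k)) ∎
    where
    open ℕₚ.≤-Reasoning
    F = filter (λ Q → #leaves Q ≤? v) (list (E N))
    FX = X.few v w (list (E N))
    FY = Y.few v w (list (E N))
    FZ = Zs.few v w (list (E N))
    lem : ∀ p a b c → p * (a + (b + c)) ≡ p * a + (p * b + (p * c + 0))
    lem = solve-∀
    into : ∀ {Q} → Q ∈ F → Q ∈ FX ++ FY ++ FZ
    into {Q} Q∈ with ∈-filter⁻ (λ Q → #leaves Q ≤? v) {xs = list (E N)} Q∈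
    ... | Q∈L , leaves≤ = by-cases (w ≤? X.#slabs Q) (w ≤? Y.#slabs Q) (w ≤? Zs.#slabs Q)
      where
      by-cases : Dec (w ≤ X.#slabs Q) → Dec (w ≤ Y.#slabs Q) → Dec (w ≤ Zs.#slabs Q) → Q ∈ FX ++ FY ++ FZ
      by-cases (yes p) _ _ = ∈-++⁺ˡ (∈-filter⁺ (X.few? v w) Q∈L (leaves≤ , p))
      by-cases _ (yes p) _ = ∈-++⁺ʳ FX (∈-++⁺ˡ (∈-filter⁺ (Y.few? v w) Q∈L (leaves≤ , p)))
      by-cases _ _ (yes p) = ∈-++⁺ʳ FX (∈-++⁺ʳ FY (∈-filter⁺ (Zs.few? v w) Q∈L (leaves≤ , p)))
      by-cases (no p) (no q) (no r) = ⊥-elim (ℕₚ.<⇒≱ large (ℕₚ.≤-trans (size-≤-slabs (sound (E N) Q∈L))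
        (ℕₚ.*-mono-≤ (ℕₚ.≰⇒> p) (ℕₚ.*-mono-≤ (ℕₚ.<⇒≤ (ℕₚ.≰⇒> q)) (ℕₚ.<⇒≤ (ℕₚ.≰⇒> r))))))

-- Ratios of consecutive terms

open ℕₚ.≤-Reasoning hiding (stop)

-- The value at 0 keeps the function antitone there as well.
reciprocal : ℕ → ℕ → ℕ
reciprocal D zero    = D
reciprocal D (suc v) = D / suc v

reciprocal-anti : ∀ D {v v′} → v ≤ v′ → reciprocal D v′ ≤ reciprocal D v
reciprocal-anti D {zero}  {zero}   _  = ℕₚ.≤-refl
reciprocal-anti D {zero}  {suc v′} _  = m/n≤m D (suc v′)
reciprocal-anti D {suc v} {suc v′} le = /-monoʳ-≤ D le

reciprocal-≤ : ∀ D v → v * reciprocal D v ≤ D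
reciprocal-≤ D zero    = z≤n
reciprocal-≤ D (suc v) = subst (_≤ D) (ℕₚ.*-comm (D / suc v) (suc v)) (m/n*n≤m D (suc v))

reciprocal-! : ∀ n {v} → 1 ≤ v → v ≤ n → v * reciprocal (n !) v ≡ n !
reciprocal-! n {suc v} _ le = m*[n/m]≡n (∣-trans (m∣m*n (v !)) (m≤n⇒m!∣n! le))

^-distrib-* : ∀ n x y → (x * y) ^ n ≡ x ^ n * y ^ n
^-distrib-* zero    x y = refl
^-distrib-* (suc n) x y = trans (cong (x * y *_) (^-distrib-* n x y)) (lem x y (x ^ n) (y ^ n))
  where
  lem : ∀ x y p q → x * y * (p * q) ≡ x * p * (y * q)
  lem = solve-∀

bernoulli : ∀ x n → (x + n) * x ^ n ≤ x * suc x ^ n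
bernoulli x zero    = ℕₚ.≤-reflexive (cong (_* 1) (ℕₚ.+-identityʳ x))
bernoulli x (suc n) = begin
  (x + suc n) * (x * x ^ n)          ≤⟨ ℕₚ.m≤m+n _ (n * x ^ n) ⟩
  (x + suc n) * (x * x ^ n) + n * x ^ n ≡⟨ lem x n (x ^ n) ⟩
  suc x * ((x + n) * x ^ n)          ≤⟨ ℕₚ.*-monoʳ-≤ (suc x) (bernoulli x n) ⟩
  suc x * (x * suc x ^ n)            ≡⟨ lem′ x (suc x ^ n) ⟩
  x * (suc x * suc x ^ n) ∎
  where
  lem : ∀ x n p → (x + suc n) * (x * p) + n * p ≡ suc x * ((x + n) * p)
  lem = solve-∀
  lem′ : ∀ x p → suc x * (x * p) ≡ x * (suc x * p)
  lem′ = solve-∀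

-- Bernoulli with n = x gives (1 + 1/x)^x ≥ 2; raise this to the power `t`.
doubling : ∀ x t → .{{_ : NonZero x}} → 2 ^ t * x ^ (x * t) ≤ suc x ^ (x * t)
doubling x t = begin
  2 ^ t * x ^ (x * t)     ≡⟨ cong (2 ^ t *_) (sym (ℕₚ.^-*-assoc x x t)) ⟩
  2 ^ t * (x ^ x) ^ t     ≡⟨ sym (^-distrib-* t 2 (x ^ x)) ⟩
  (2 * x ^ x) ^ t         ≤⟨ ℕₚ.^-monoˡ-≤ t (ℕₚ.*-cancelˡ-≤ x (ℕₚ.≤-trans (ℕₚ.≤-reflexive (lem x (x ^ x))) (bernoulli x x))) ⟩
  (suc x ^ x) ^ t         ≡⟨ ℕₚ.^-*-assoc (suc x) x t ⟩
  suc x ^ (x * t) ∎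
  where
  lem : ∀ x p → x * (2 * p) ≡ (x + x) * p
  lem = solve-∀

n<2^n : ∀ n → n < 2 ^ n
n<2^n zero    = s≤s z≤n
n<2^n (suc n) = begin-strict
  1 + n          ≤⟨ ℕₚ.+-mono-≤ (ℕₚ.m^n>0 2 n) ℕₚ.≤-refl ⟩
  2 ^ n + n      <⟨ ℕₚ.+-monoʳ-< (2 ^ n) (n<2^n n) ⟩
  2 ^ n + 2 ^ n  ≡⟨ cong (2 ^ n +_) (sym (ℕₚ.+-identityʳ _)) ⟩
  2 * 2 ^ n ∎

log₂ : ∀ j → 1 ≤ j → ∃ λ l → 2 ^ l ≤ j × j < 2 ^ suc l
log₂ (suc zero)    _ = 0 , s≤s z≤n , s≤s (s≤s z≤n)
log₂ (suc (suc j)) _ with log₂ (suc j) (s≤s z≤n)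
... | l , lo , hi with suc (suc j) <? 2 ^ suc l
...   | yes lt = l , ℕₚ.m≤n⇒m≤1+n lo , lt
...   | no ≮   = suc l , ℕₚ.≮⇒≥ ≮ , ℕₚ.≤-<-trans hi (ℕₚ.^-monoʳ-< 2 (s≤s (s≤s z≤n)) {suc l} {suc (suc l)} ℕₚ.≤-refl)

-- With h the integer part of l/7, six of the seven factors of (h + 1)^7 absorb (l + 2)^6 and the
-- last one absorbs the constant; then h + 1 ≤ 2^h.
polynomial-≤-exponential : ∀ C l → 7 * (C * 8 ^ 6) ≤ l → C * (l + 2) ^ 6 ≤ 2 ^ l
polynomial-≤-exponential C l le = begin
  C * (l + 2) ^ 6                 ≤⟨ ℕₚ.*-monoʳ-≤ C (ℕₚ.^-monoˡ-≤ 6 l+2≤) ⟩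
  C * (8 * suc h) ^ 6             ≡⟨ cong (C *_) (^-distrib-* 6 8 (suc h)) ⟩
  C * (8 ^ 6 * suc h ^ 6)         ≡⟨ sym (ℕₚ.*-assoc C (8 ^ 6) (suc h ^ 6)) ⟩
  C * 8 ^ 6 * suc h ^ 6           ≤⟨ ℕₚ.*-monoˡ-≤ (suc h ^ 6) (ℕₚ.m≤n⇒m≤1+n C≤h) ⟩
  suc h ^ 7                       ≤⟨ ℕₚ.^-monoˡ-≤ 7 (n<2^n h) ⟩
  (2 ^ h) ^ 7                     ≡⟨ ℕₚ.^-*-assoc 2 h 7 ⟩
  2 ^ (h * 7)                     ≤⟨ ℕₚ.^-monoʳ-≤ 2 (m/n*n≤m l 7) ⟩
  2 ^ l ∎
  where
  h = l / 7
  C≤h : C * 8 ^ 6 ≤ h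
  C≤h = subst (_≤ h) (trans (cong (_/ 7) (ℕₚ.*-comm 7 (C * 8 ^ 6))) (m*n/n≡m (C * 8 ^ 6) 7)) (/-monoˡ-≤ 7 le)
  l+2≤ : l + 2 ≤ 8 * suc h
  l+2≤ = begin
    l + 2                ≡⟨ cong (_+ 2) (m≡m%n+[m/n]*n l 7) ⟩
    l % 7 + h * 7 + 2    ≤⟨ ℕₚ.+-monoˡ-≤ 2 (ℕₚ.+-monoˡ-≤ (h * 7) (ℕₚ.≤-pred (m%n<n l 7))) ⟩
    6 + h * 7 + 2        ≤⟨ ℕₚ.m≤m+n _ h ⟩
    6 + h * 7 + 2 + h    ≡⟨ lem h ⟩
    8 * suc h ∎
    where
    lem : ∀ h → 6 + h * 7 + 2 + h ≡ 8 * suc h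
    lem = solve-∀

module Ratio {b : ℕ → ℕ} (E : ∀ n → Enumeration (suc n) (b n)) where

  domino : Standard 2 (0ᶜ ∷ vec x⁺ ∷ [])
  domino = standard ((inj₁ (Z.+<+ (s≤s z≤n)) ∷ []) ∷ [] ∷ []) (here refl)
    (λ { (here refl) → <ᶜ-irrefl ; (there (here refl)) p → <ᶜ-irrefl (<ᶜ-trans p (inj₁ (Z.+<+ (s≤s z≤n)))) })
    (connected-from 0ᶜ (here refl) (λ { (here refl) → stop ; (there (here refl)) → step (move-adj x⁺ 0ᶜ) (there (here refl)) stop }))
    refl

  b1-positive : 1 ≤ b 1
  b1-positive = subst (1 ≤_) (card (E 1)) (∈-length (complete (E 1) domino))

  mono : ∀ n → b n ≤ b (suc n)
  mono n = begin
    b n          ≡⟨ sym (ℕₚ.*-identityʳ (b n)) ⟩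
    b n * 1      ≤⟨ ℕₚ.*-monoʳ-≤ (b n) b1-positive ⟩
    b n * b 1    ≤⟨ supermult E n 1 ⟩
    b (n + 1)    ≡⟨ cong b (ℕₚ.+-comm n 1) ⟩
    b (suc n) ∎

  positive : ∀ n → 1 ≤ b n
  positive zero    = b0-positive E
  positive (suc n) = ℕₚ.≤-trans (positive n) (mono n)

  growth : ∀ m → b m * 4 ^ m ≤ 39 ^ m * 56 ^ 6
  growth m = ℕₚ.≤-trans (ℕₚ.*-monoʳ-≤ (b m) (ℕₚ.m≤m*n (4 ^ m) (39 ^ 6))) (growth-bound (E m))

  -- Takes `K` = 2^(3l), a bound for the cube of the size, and `d` = 2l, enough because 2^l · 4^l =
  -- 8^l ≤ 9^l. The loss `K ^ d` has exponent 3l · 2l.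
  sub : ∀ l p q → p + q < 2 ^ l → b (p + q) ≤ 2 ^ (6 * (l * l)) * (b p * b q)
  sub l p q lt = subst (λ c → b (p + q) ≤ c * (b p * b q)) (trans (ℕₚ.^-*-assoc 2 (3 * l) (2 * l)) (cong (2 ^_) (lem l)))
    (submult E (2 ^ (3 * l)) (2 * l) (p + q) small cube p q refl)
    where
    lem : ∀ l → 3 * l * (2 * l) ≡ 6 * (l * l)
    lem = solve-∀
    small : (p + q) * 2 ^ (2 * l) ≤ 3 ^ (2 * l)
    small = begin
      (p + q) * 2 ^ (2 * l)   ≤⟨ ℕₚ.*-monoˡ-≤ _ (ℕₚ.<⇒≤ lt) ⟩
      2 ^ l * 2 ^ (2 * l)     ≡⟨ cong (2 ^ l *_) (sym (ℕₚ.^-*-assoc 2 2 l)) ⟩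
      2 ^ l * 4 ^ l           ≡⟨ sym (^-distrib-* l 2 4) ⟩
      8 ^ l                   ≤⟨ ℕₚ.^-monoˡ-≤ l (ℕₚ.n≤1+n 8) ⟩
      9 ^ l                   ≡⟨ ℕₚ.^-*-assoc 3 2 l ⟩
      3 ^ (2 * l) ∎
    cube : suc (p + q) * (suc (p + q) * suc (p + q)) ≤ 2 ^ (3 * l)
    cube = begin
      suc (p + q) * (suc (p + q) * suc (p + q)) ≤⟨ ℕₚ.*-mono-≤ lt (ℕₚ.*-mono-≤ lt lt) ⟩
      2 ^ l * (2 ^ l * 2 ^ l)                   ≡⟨ cong (λ z → 2 ^ l * (2 ^ l * z)) (sym (ℕₚ.*-identityʳ (2 ^ l))) ⟩
      (2 ^ l) ^ 3                               ≡⟨ trans (ℕₚ.^-*-assoc 2 l 3) (cong (2 ^_) (ℕₚ.*-comm l 3)) ⟩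
      2 ^ (3 * l) ∎

  fewLeaves : ℕ → ℕ → ℕ
  fewLeaves K N = length (filter (λ Q → #leaves Q ≤? K) (list (E N)))

  ratio-step : ∀ n {K R S} → 1 ≤ S → 74 * S ≤ K → R ≤ 10 * S → R * b n ≤ S * b (suc n) →
    K * fewLeaves K (suc n) ≤ b (suc n) → R * b (suc n) ≤ S * b (suc (suc n)) + b (suc n)
  ratio-step n {K} 1≤S le = LogConcavity.log-concave (E n) (E (suc n)) (E (suc (suc n))) D (reciprocal D) (reciprocal-anti D) (reciprocal-≤ D)
    (reciprocal-! (suc (suc (suc n)))) K (ℕₚ.≤-trans 1≤S (ℕₚ.≤-trans (ℕₚ.m≤n*m _ 74) le)) (ℕₚ.1≤n! (suc (suc (suc n)))) 1≤S le
    where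
    -- The largest polycubes involved have n + 3 cells, and this factorial is divisible by every
    -- positive leaf count up to that.
    D = suc (suc (suc n)) !

  -- Passing from size `N` to `N + 2 * k` costs the loss of `sub` and a factor at most 100 per
  -- round, since 39/4 ≤ 10. With 400V slabs each round gains 400V / 2V = 200, so a factor 2^k is
  -- left over to beat all constants.
  few-small : ∀ l k K N → N + 2 * k < 2 ^ l →
    400 * (K + 2 * k) * (400 * (K + 2 * k) * (400 * (K + 2 * k))) < suc N →
    3 * (2 ^ (6 * (l * l)) * 56 ^ 6) * K ≤ 2 ^ k → K * fewLeaves K N ≤ b N
  few-small l k zero          N lt large le = z≤n
  few-small l k K@(suc _) N lt large le = bound (2 ^ (6 * (l * l))) (56 ^ 6) (sub l N (2 * k) lt) (growth (2 * k)) le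
    where
    V = K + 2 * k
    f = fewLeaves K N
    bound : ∀ c g → b (N + 2 * k) ≤ c * (b N * b (2 * k)) → b (2 * k) * 4 ^ (2 * k) ≤ 39 ^ (2 * k) * g →
      3 * (c * g) * K ≤ 2 ^ k → K * f ≤ b N
    bound c g sub≤ grow le = ℕₚ.*-cancelˡ-≤ (2 ^ k) {{ℕₚ.m^n≢0 2 k}} (begin
      2 ^ k * (K * f)             ≡⟨ lem₁ (2 ^ k) K f ⟩
      K * (2 ^ k * f)             ≤⟨ ℕₚ.*-monoʳ-≤ K cancelled ⟩
      K * (3 * (c * g) * b N)     ≡⟨ lem₂ K (3 * (c * g)) (b N) ⟩
      3 * (c * g) * K * b N       ≤⟨ ℕₚ.*-monoˡ-≤ (b N) le ⟩
      2 ^ k * b N ∎)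
      where
      lem₁ : ∀ p K f → p * (K * f) ≡ K * (p * f)
      lem₁ = solve-∀
      lem₂ : ∀ K x b → K * (x * b) ≡ x * K * b
      lem₂ = solve-∀
      lem₃ : ∀ V → 16 * (400 * V) ≡ 2 * (2 * V * 1600)
      lem₃ = solve-∀
      lem₄ : ∀ p c n m q → q * (3 * (p * (c * (n * m)))) ≡ 3 * (p * (c * n)) * (m * q)
      lem₄ = solve-∀
      lem₅ : ∀ p c n r g → 3 * (p * (c * n)) * (r * g) ≡ p * r * (3 * (c * g) * n)
      lem₅ = solve-∀
      cancelled : 2 ^ k * f ≤ 3 * (c * g) * b N
      cancelled = ℕₚ.*-cancelˡ-≤ ((2 * V * 1600) ^ k) {{ℕₚ.m^n≢0 (2 * V * 1600) k}} (begin
        (2 * V * 1600) ^ k * (2 ^ k * f)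
          ≡⟨ trans (sym (ℕₚ.*-assoc ((2 * V * 1600) ^ k) (2 ^ k) f)) (cong (_* f) (trans (ℕₚ.*-comm ((2 * V * 1600) ^ k) (2 ^ k)) (sym (^-distrib-* k 2 (2 * V * 1600))))) ⟩
        (2 * (2 * V * 1600)) ^ k * f
          ≡⟨ cong (λ x → x ^ k * f) (sym (lem₃ V)) ⟩
        (16 * (400 * V)) ^ k * f
          ≡⟨ trans (cong (_* f) (^-distrib-* k 16 (400 * V))) (ℕₚ.*-assoc (16 ^ k) _ f) ⟩
        16 ^ k * ((400 * V) ^ k * f)
          ≤⟨ ℕₚ.*-monoʳ-≤ (16 ^ k) (few-leaves-bound E mono (400 * V) k N K V ℕₚ.≤-refl large) ⟩
        16 ^ k * (3 * ((2 * V) ^ k * b (N + 2 * k)))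
          ≤⟨ ℕₚ.*-monoʳ-≤ (16 ^ k) (ℕₚ.*-monoʳ-≤ 3 (ℕₚ.*-monoʳ-≤ ((2 * V) ^ k) sub≤)) ⟩
        16 ^ k * (3 * ((2 * V) ^ k * (c * (b N * b (2 * k)))))
          ≡⟨ lem₄ ((2 * V) ^ k) c (b N) (b (2 * k)) (16 ^ k) ⟩
        3 * ((2 * V) ^ k * (c * b N)) * (b (2 * k) * 16 ^ k)
          ≤⟨ ℕₚ.*-monoʳ-≤ (3 * ((2 * V) ^ k * (c * b N))) (begin
              b (2 * k) * 16 ^ k        ≡⟨ cong (b (2 * k) *_) (ℕₚ.^-*-assoc 4 2 k) ⟩
              b (2 * k) * 4 ^ (2 * k)   ≤⟨ grow ⟩
              39 ^ (2 * k) * g          ≤⟨ ℕₚ.*-monoˡ-≤ g (ℕₚ.^-monoˡ-≤ (2 * k) (ℕₚ.n≤1+n 39)) ⟩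
              40 ^ (2 * k) * g          ≡⟨ cong (_* g) (sym (ℕₚ.^-*-assoc 40 2 k)) ⟩
              1600 ^ k * g              ∎) ⟩
        3 * ((2 * V) ^ k * (c * b N)) * (1600 ^ k * g)
          ≡⟨ trans (lem₅ ((2 * V) ^ k) c (b N) (1600 ^ k) g) (cong (_* (3 * (c * g) * b N)) (sym (^-distrib-* k (2 * V) 1600))) ⟩
        (2 * V * 1600) ^ k * (3 * (c * g) * b N) ∎)

  -- Log-concavity lets the ratio, once at least 9.8, decrease by at most 1/(100 M) per step, so it stays above 9.78 for 2 M steps.
  ratio-persists : ∀ j M K → 1 ≤ M → 74 * (100 * M) ≤ K → (∀ i → i < 2 * M → K * fewLeaves K (suc (i + j)) ≤ b (suc (i + j))) →
    49 * b j ≤ 5 * b (suc j) →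
    ∀ i R → R + i ≡ 980 * M → i ≤ 2 * M → R * b (i + j) ≤ 100 * M * b (suc (i + j))
  ratio-persists j M K 1≤M 74S≤K few start zero R eq _ = begin
    R * b j                ≡⟨ cong (_* b j) (trans (sym (ℕₚ.+-identityʳ R)) eq) ⟩
    980 * M * b j          ≡⟨ lem M (b j) ⟩
    20 * M * (49 * b j)    ≤⟨ ℕₚ.*-monoʳ-≤ (20 * M) start ⟩
    20 * M * (5 * b (suc j)) ≡⟨ lem′ M (b (suc j)) ⟩
    100 * M * b (suc j) ∎
    where
    lem : ∀ M x → 980 * M * x ≡ 20 * M * (49 * x)
    lem = solve-∀
    lem′ : ∀ M x → 20 * M * (5 * x) ≡ 100 * M * x
    lem′ = solve-∀
  ratio-persists j M K 1≤M 74S≤K few start (suc i) R eq i< = ℕₚ.+-cancelʳ-≤ (b (suc (i + j))) _ _ (begin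
    R * b (suc (i + j)) + b (suc (i + j))   ≡⟨ ℕₚ.+-comm (R * b (suc (i + j))) _ ⟩
    suc R * b (suc (i + j))                 ≤⟨ ratio-step (i + j) {K} {suc R} {100 * M} (ℕₚ.*-mono-≤ (s≤s (z≤n {99})) 1≤M)
                                                 74S≤K R≤
                                                 (ratio-persists j M K 1≤M 74S≤K few start i (suc R) (trans (sym (ℕₚ.+-suc R i)) eq) (ℕₚ.<⇒≤ i<)) (few i i<) ⟩
    100 * M * b (suc (suc (i + j))) + b (suc (i + j)) ∎)
    where
    R≤ : suc R ≤ 10 * (100 * M)
    R≤ = begin
      suc R             ≤⟨ ℕₚ.m≤m+n (suc R) i ⟩
      suc R + i         ≡⟨ trans (sym (ℕₚ.+-suc R i)) eq ⟩
      980 * M           ≤⟨ ℕₚ.*-monoˡ-≤ M (ℕₚ.≤ᵇ⇒≤ 980 1000 tt) ⟩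
      1000 * M          ≡⟨ ℕₚ.*-assoc 10 100 M ⟩
      10 * (100 * M) ∎

  powers : ∀ j M → 1 ≤ M → (∀ i R → R + i ≡ 980 * M → i ≤ 2 * M → R * b (i + j) ≤ 100 * M * b (suc (i + j))) →
    ∀ i → i ≤ 2 * M → 978 ^ i * b j ≤ 100 ^ i * b (i + j)
  powers j M 1≤M ratio zero    _  = ℕₚ.≤-refl
  powers j M 1≤M ratio (suc i) i< = begin
    978 * 978 ^ i * b j            ≡⟨ ℕₚ.*-assoc 978 (978 ^ i) (b j) ⟩
    978 * (978 ^ i * b j)          ≤⟨ ℕₚ.*-monoʳ-≤ 978 (powers j M 1≤M ratio i (ℕₚ.<⇒≤ i<)) ⟩
    978 * (100 ^ i * b (i + j))    ≡⟨ lem 978 (100 ^ i) (b (i + j)) ⟩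
    100 ^ i * (978 * b (i + j))    ≤⟨ ℕₚ.*-monoʳ-≤ (100 ^ i) one ⟩
    100 ^ i * (100 * b (suc (i + j))) ≡⟨ lem′ (100 ^ i) 100 (b (suc (i + j))) ⟩
    100 * 100 ^ i * b (suc (i + j)) ∎
    where
    lem : ∀ x p y → x * (p * y) ≡ p * (x * y)
    lem = solve-∀
    lem′ : ∀ p x y → p * (x * y) ≡ x * p * y
    lem′ = solve-∀
    i≤ : i ≤ 980 * M
    i≤ = ℕₚ.≤-trans (ℕₚ.<⇒≤ i<) (ℕₚ.*-monoˡ-≤ M (ℕₚ.≤ᵇ⇒≤ 2 980 tt))
    978M≤ : 978 * M ≤ 980 * M ∸ i
    978M≤ = ℕₚ.+-cancelʳ-≤ i _ _ (begin
      978 * M + i           ≤⟨ ℕₚ.+-monoʳ-≤ (978 * M) (ℕₚ.<⇒≤ i<) ⟩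
      978 * M + 2 * M       ≡⟨ sym (ℕₚ.*-distribʳ-+ M 978 2) ⟩
      980 * M               ≡⟨ sym (ℕₚ.m∸n+n≡m i≤) ⟩
      980 * M ∸ i + i ∎)
    one : 978 * b (i + j) ≤ 100 * b (suc (i + j))
    one = ℕₚ.*-cancelˡ-≤ M {{>-nonZero 1≤M}} (begin
      M * (978 * b (i + j))         ≡⟨ lem′ M 978 (b (i + j)) ⟩
      978 * M * b (i + j)           ≤⟨ ℕₚ.*-monoˡ-≤ (b (i + j)) 978M≤ ⟩
      (980 * M ∸ i) * b (i + j)     ≤⟨ ratio i (980 * M ∸ i) (ℕₚ.m∸n+n≡m i≤) (ℕₚ.<⇒≤ i<) ⟩
      100 * M * b (suc (i + j))     ≡⟨ sym (lem′ M 100 (b (suc (i + j)))) ⟩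
      M * (100 * b (suc (i + j))) ∎)

  -- 978 · 4 = 12 · 326 and 100 · 39 = 12 · 325, so `doubling` applies with x = 325; the gain 2^t
  -- exceeds the combined constants of submultiplicativity and growth.
  too-fast : ∀ j l t → 325 * t + j < 2 ^ l → 2 ^ (6 * (l * l)) * 56 ^ 6 < 2 ^ t → ¬ (978 ^ (325 * t) * b j ≤ 100 ^ (325 * t) * b (325 * t + j))
  too-fast j l t lt = go (325 * t) (2 ^ (6 * (l * l))) (56 ^ 6) (sub l (325 * t) j lt) (growth (325 * t)) (doubling 325 t)
    where
    go : ∀ w c g → b (w + j) ≤ c * (b w * b j) → b w * 4 ^ w ≤ 39 ^ w * g → 2 ^ t * 325 ^ w ≤ 326 ^ w → c * g < 2 ^ t →
      ¬ (978 ^ w * b j ≤ 100 ^ w * b (w + j))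
    go w c g sub≤ grow dbl cg< le = ℕₚ.<⇒≱ cg< (ℕₚ.*-cancelʳ-≤ (2 ^ t) (c * g) (12 ^ w * 325 ^ w) {{>-nonZero (ℕₚ.*-mono-≤ (ℕₚ.m^n>0 12 w) (ℕₚ.m^n>0 325 w))}} (begin
      2 ^ t * (12 ^ w * 325 ^ w)      ≡⟨ lem (2 ^ t) (12 ^ w) (325 ^ w) ⟩
      12 ^ w * (2 ^ t * 325 ^ w)      ≤⟨ ℕₚ.*-monoʳ-≤ (12 ^ w) dbl ⟩
      12 ^ w * 326 ^ w                ≡⟨ trans (sym (^-distrib-* w 12 326)) (^-distrib-* w 978 4) ⟩
      978 ^ w * 4 ^ w                 ≤⟨ ℕₚ.*-monoˡ-≤ (4 ^ w) cancelled ⟩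
      100 ^ w * (c * b w) * 4 ^ w     ≡⟨ lem′ (100 ^ w) c (b w) (4 ^ w) ⟩
      100 ^ w * c * (b w * 4 ^ w)     ≤⟨ ℕₚ.*-monoʳ-≤ (100 ^ w * c) grow ⟩
      100 ^ w * c * (39 ^ w * g)      ≡⟨ lem″ (100 ^ w) c (39 ^ w) g ⟩
      c * g * (100 ^ w * 39 ^ w)      ≡⟨ cong (c * g *_) (trans (sym (^-distrib-* w 100 39)) (^-distrib-* w 12 325)) ⟩
      c * g * (12 ^ w * 325 ^ w) ∎))
      where
      lem : ∀ a b c → a * (b * c) ≡ b * (a * c)
      lem = solve-∀
      lem′ : ∀ h c b f → h * (c * b) * f ≡ h * c * (b * f)
      lem′ = solve-∀
      lem″ : ∀ h c n g → h * c * (n * g) ≡ c * g * (h * n)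
      lem″ = solve-∀
      lem‴ : ∀ h c b x → h * (c * (b * x)) ≡ h * (c * b) * x
      lem‴ = solve-∀
      cancelled : 978 ^ w ≤ 100 ^ w * (c * b w)
      cancelled = ℕₚ.*-cancelʳ-≤ _ _ (b j) {{>-nonZero (positive j)}} (begin
        978 ^ w * b j                    ≤⟨ le ⟩
        100 ^ w * b (w + j)              ≤⟨ ℕₚ.*-monoʳ-≤ (100 ^ w) sub≤ ⟩
        100 ^ w * (c * (b w * b j))      ≡⟨ lem‴ (100 ^ w) c (b w) (b j) ⟩
        100 ^ w * (c * b w) * b j ∎)

  -- Here 2^l ≤ j < 2^(l + 1). By `room`, the window and the 2k additional cells stay within 2^l, so
  -- every index that occurs is below 2^h with h = l + 2.
  module Scale (l h j : ℕ) (h≡ : h ≡ 2 + l) (lo : 2 ^ l ≤ j) (hi : j < 2 ^ suc l) (T M K k : ℕ)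
    (2M≡ : 325 * (2 * T) ≡ 2 * M) (1≤M : 1 ≤ M) (74S≤K : 74 * (100 * M) ≤ K)
    (C< : 2 ^ (6 * (h * h)) * 56 ^ 6 < 2 ^ (2 * T))
    (few-weight : 3 * (2 ^ (6 * (h * h)) * 56 ^ 6) * K ≤ 2 ^ k)
    (width : 400 * (K + 2 * k) * (400 * (K + 2 * k) * (400 * (K + 2 * k))) ≤ 2 ^ l)
    (room : 2 * M + 2 * k ≤ 2 ^ l) where

    within : ∀ {x} → x ≤ 2 * M + 2 * k → x + j < 2 ^ h
    within {x} le = begin-strict
      x + j                      ≤⟨ ℕₚ.+-monoˡ-≤ j (ℕₚ.≤-trans le room) ⟩
      2 ^ l + j                  <⟨ ℕₚ.+-mono-≤-< (ℕₚ.m≤m+n (2 ^ l) (2 ^ l + 0)) hi ⟩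
      2 ^ suc l + 2 ^ suc l      ≡⟨ cong (2 ^ suc l +_) (sym (ℕₚ.+-identityʳ (2 ^ suc l))) ⟩
      2 ^ (2 + l)                ≡⟨ cong (2 ^_) (sym h≡) ⟩
      2 ^ h ∎

    few-ok : ∀ i → i < 2 * M → K * fewLeaves K (suc (i + j)) ≤ b (suc (i + j))
    few-ok i i< = few-small h k K (suc (i + j))
      (subst (_< 2 ^ h) (lem (suc i) j (2 * k)) (within (ℕₚ.+-monoˡ-≤ (2 * k) i<)))
      (s≤s (ℕₚ.≤-trans width (ℕₚ.≤-trans lo (ℕₚ.m≤n+m j (suc i))))) few-weight
      where
      lem : ∀ a b c → a + c + b ≡ a + b + c
      lem = solve-∀

    ratio-bounded : 5 * b (suc j) ≤ 49 * b j
    ratio-bounded with 5 * b (suc j) ≤? 49 * b j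
    ... | yes le = le
    ... | no ≰ = ⊥-elim (too-fast j h (2 * T) (within (ℕₚ.≤-trans (ℕₚ.≤-reflexive 2M≡) (ℕₚ.m≤m+n (2 * M) (2 * k)))) C<
          (subst (λ w → 978 ^ w * b j ≤ 100 ^ w * b (w + j)) (sym 2M≡)
            (powers j M 1≤M (ratio-persists j M K 1≤M 74S≤K few-ok (ℕₚ.<⇒≤ (ℕₚ.≰⇒> ≰))) (2 * M) ℕₚ.≤-refl)))

-- Choice of the constants

module Parameters (p q r c : ℕ) (1≤p : 1 ≤ p) (1≤q : 1 ≤ q) (r-large : 3 * (q * p) ≤ 2 ^ r) (c-large : 400 * (q * p + 2 * (r + 3)) ≤ c)
  (T : ℕ) (1≤T : 1 ≤ T) where

  weight-bound : ∀ C → C < 2 ^ (2 * T) → 3 * C * (q * (p * T)) ≤ 2 ^ (r + 3 * T)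
  weight-bound C C< = begin
    3 * C * (q * (p * T))            ≡⟨ lem C p q T ⟩
    3 * (q * p) * (C * T)            ≤⟨ ℕₚ.*-mono-≤ r-large (ℕₚ.*-mono-≤ (ℕₚ.<⇒≤ C<) (ℕₚ.<⇒≤ (n<2^n T))) ⟩
    2 ^ r * (2 ^ (2 * T) * 2 ^ T)    ≡⟨ cong (2 ^ r *_) (sym (ℕₚ.^-distribˡ-+-* 2 (2 * T) T)) ⟩
    2 ^ r * 2 ^ (2 * T + T)          ≡⟨ sym (ℕₚ.^-distribˡ-+-* 2 r (2 * T + T)) ⟩
    2 ^ (r + (2 * T + T))            ≡⟨ cong (λ n → 2 ^ (r + n)) (lem′ T) ⟩
    2 ^ (r + 3 * T) ∎
    where
    lem : ∀ C p q T → 3 * C * (q * (p * T)) ≡ 3 * (q * p) * (C * T)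
    lem = solve-∀
    lem′ : ∀ T → 2 * T + T ≡ 3 * T
    lem′ = solve-∀

  width-bound : 400 * (q * (p * T) + 2 * (r + 3 * T)) ≤ c * T
  width-bound = begin
    400 * (q * (p * T) + 2 * (r + 3 * T))       ≤⟨ ℕₚ.*-monoʳ-≤ 400 (ℕₚ.+-monoʳ-≤ (q * (p * T)) (ℕₚ.*-monoʳ-≤ 2 (ℕₚ.+-monoˡ-≤ (3 * T) (ℕₚ.m≤m*n r T {{>-nonZero 1≤T}})))) ⟩
    400 * (q * (p * T) + 2 * (r * T + 3 * T))   ≡⟨ lem 400 p q r T ⟩
    400 * (q * p + 2 * (r + 3)) * T             ≤⟨ ℕₚ.*-monoˡ-≤ T c-large ⟩
    c * T ∎
    where
    lem : ∀ a p q r T → a * (q * (p * T) + 2 * (r * T + 3 * T)) ≡ a * (q * p + 2 * (r + 3)) * T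
    lem = solve-∀

  room-bound : 2 * (p * T) + 2 * (r + 3 * T) ≤ c * T
  room-bound = begin
    2 * (p * T) + 2 * (r + 3 * T)               ≤⟨ ℕₚ.+-mono-≤ (ℕₚ.*-monoʳ-≤ 2 (ℕₚ.m≤n*m (p * T) q {{>-nonZero 1≤q}})) (ℕₚ.m≤n*m (2 * (r + 3 * T)) 2) ⟩
    2 * (q * (p * T)) + 2 * (2 * (r + 3 * T))   ≡⟨ sym (ℕₚ.*-distribˡ-+ 2 (q * (p * T)) (2 * (r + 3 * T))) ⟩
    2 * (q * (p * T) + 2 * (r + 3 * T))         ≤⟨ ℕₚ.*-monoˡ-≤ (q * (p * T) + 2 * (r + 3 * T)) (ℕₚ.≤ᵇ⇒≤ 2 400 tt) ⟩
    400 * (q * (p * T) + 2 * (r + 3 * T))       ≤⟨ width-bound ⟩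
    c * T ∎

record Constants (c T : ℕ) : Set where
  constructor constants
  field
    M K k  : ℕ
    2M≡    : 325 * (2 * T) ≡ 2 * M
    1≤M    : 1 ≤ M
    74S≤K  : 74 * (100 * M) ≤ K
    weight≤ : ∀ C → C < 2 ^ (2 * T) → 3 * C * K ≤ 2 ^ k
    width≤ : 400 * (K + 2 * k) ≤ c * T
    room≤  : 2 * M + 2 * k ≤ c * T

-- M = 325 T makes the window 2M = 325 · 2T; 7400 = 74 · 100 is the ratio K / M that log-concavity
-- asks for; 23 is chosen because 3 · 7400 · 325 ≤ 2^23. All lengths are then linear in `T`.
constants-exist : ∃ λ c → ∀ T → 1 ≤ T → Constants c T
constants-exist = 400 * (7400 * 325 + 2 * (23 + 3)) , λ T 1≤T →
  choose 325 7400 23 (400 * (7400 * 325 + 2 * (23 + 3))) (ℕₚ.≤ᵇ⇒≤ 1 325 tt) (ℕₚ.≤ᵇ⇒≤ 7400 7400 tt) (ℕₚ.≤ᵇ⇒≤ (3 * (7400 * 325)) (2 ^ 23) tt) ℕₚ.≤-refl refl T 1≤T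
  where
  choose : ∀ p q r c → 1 ≤ p → 74 * 100 ≤ q → 3 * (q * p) ≤ 2 ^ r → 400 * (q * p + 2 * (r + 3)) ≤ c → p ≡ 325 → ∀ T → 1 ≤ T → Constants c T
  choose p q r c 1≤p q-large r-large c-large p≡ T 1≤T = constants (p * T) (q * (p * T)) (r + 3 * T)
    (trans (cong (_* (2 * T)) (sym p≡)) (lem p T)) (ℕₚ.*-mono-≤ 1≤p 1≤T)
    (ℕₚ.≤-trans (ℕₚ.≤-reflexive (sym (ℕₚ.*-assoc 74 100 (p * T)))) (ℕₚ.*-monoˡ-≤ (p * T) q-large))
    weight-bound width-bound room-bound
    where
    open Parameters p q r c 1≤p (ℕₚ.≤-trans (ℕₚ.≤ᵇ⇒≤ 1 7400 tt) q-large) r-large c-large T 1≤T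
    lem : ∀ p T → p * (2 * T) ≡ 2 * (p * T)
    lem = solve-∀

-- `T` is quadratic in `l`, so its cube is of degree six, which 2^l eventually exceeds.
threshold : ∀ c → ∃ λ l₀ → ∀ l → l₀ ≤ l → ∀ h T → h ≡ 2 + l → T ≡ 18 + 3 * (h * h) → c * T * (c * T * (c * T)) ≤ 2 ^ l
threshold c = 7 * (c ^ 3 * 8 ^ 3 * 8 ^ 6) , λ { l le h T refl T≡ → begin
  c * T * (c * T * (c * T))      ≤⟨ ℕₚ.*-mono-≤ (t≤ l T T≡) (ℕₚ.*-mono-≤ (t≤ l T T≡) (t≤ l T T≡)) ⟩
  u l * (u l * u l)              ≡⟨ cubic c 8 (l + 2) ⟩
  c ^ 3 * 8 ^ 3 * (l + 2) ^ 6    ≤⟨ polynomial-≤-exponential (c ^ 3 * 8 ^ 3) l le ⟩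
  2 ^ l ∎ }
  where
  u : ℕ → ℕ
  u l = c * (8 * (l + 2) ^ 2)
  T-bound : ∀ l → 18 + 3 * ((2 + l) * (2 + l)) ≤ 8 * (l + 2) ^ 2
  T-bound l = ℕₚ.≤-trans (ℕₚ.m≤m+n _ (5 * (l * l) + 20 * l + 2)) (ℕₚ.≤-reflexive (lem l))
    where
    lem : ∀ l → 18 + 3 * ((2 + l) * (2 + l)) + (5 * (l * l) + 20 * l + 2) ≡ 8 * ((l + 2) * ((l + 2) * 1))
    lem = solve-∀
  t≤ : ∀ l T → T ≡ 18 + 3 * ((2 + l) * (2 + l)) → c * T ≤ u l
  t≤ l T T≡ = ℕₚ.*-monoʳ-≤ c (ℕₚ.≤-trans (ℕₚ.≤-reflexive T≡) (T-bound l))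
  cubic : ∀ c d x → c * (d * x ^ 2) * (c * (d * x ^ 2) * (c * (d * x ^ 2))) ≡ c ^ 3 * d ^ 3 * x ^ 6
  cubic c d x = lem c d x
    where
    lem : ∀ c d x → c * (d * (x * (x * 1))) * (c * (d * (x * (x * 1))) * (c * (d * (x * (x * 1)))))
      ≡ c * (c * (c * 1)) * (d * (d * (d * 1))) * (x * (x * (x * (x * (x * (x * 1))))))
    lem = solve-∀

-- The origin of T = 18 + 3h²: twice this is 36 + 6h², where 6h² is the loss exponent of `sub` and
-- 56^6 < 2^36.
constant-bound : ∀ h T → T ≡ 18 + 3 * (h * h) → 2 ^ (6 * (h * h)) * 56 ^ 6 < 2 ^ (2 * T)
constant-bound h T T≡ = go (6 * (h * h)) (2 * T) 36 (56 ^ 6) (ℕₚ.<ᵇ⇒< (56 ^ 6) (2 ^ 36) tt)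
  (trans (lem (h * h)) (cong (2 *_) (sym T≡)))
  where
  lem : ∀ e → 36 + 6 * e ≡ 2 * (18 + 3 * e)
  lem = solve-∀
  go : ∀ e f a g → g < 2 ^ a → a + e ≡ f → 2 ^ e * g < 2 ^ f
  go e f a g g< eq = begin-strict
    2 ^ e * g         <⟨ ℕₚ.*-monoʳ-< (2 ^ e) {{ℕₚ.m^n≢0 2 e}} g< ⟩
    2 ^ e * 2 ^ a     ≡⟨ trans (ℕₚ.*-comm (2 ^ e) (2 ^ a)) (sym (ℕₚ.^-distribˡ-+-* 2 a e)) ⟩
    2 ^ (a + e)       ≡⟨ cong (2 ^_) eq ⟩
    2 ^ f ∎

module _ {b : ℕ → ℕ} (E : ∀ n → Enumeration (suc n) (b n)) where

  abstract
    ratio-eventually : (∃ λ c → ∀ T → 1 ≤ T → Constants c T) → ∃ λ N → ∀ j → N ≤ j → 5 * b (suc j) ≤ 49 * b j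
    ratio-eventually (c , choose) with threshold c
    ... | l₀ , cube≤ = 2 ^ l₀ , bounded
      where
      bounded : ∀ j → 2 ^ l₀ ≤ j → 5 * b (suc j) ≤ 49 * b j
      bounded j le with log₂ j (ℕₚ.≤-trans (ℕₚ.m^n>0 2 l₀) le)
      ... | l , lo , hi = at-scale (2 + l) (18 + 3 * ((2 + l) * (2 + l))) refl refl (s≤s z≤n)
        where
        l₀≤l : l₀ ≤ l
        l₀≤l with l₀ ≤? l
        ... | yes p = p
        ... | no ≰ = ⊥-elim (ℕₚ.<⇒≱ hi (ℕₚ.≤-trans (ℕₚ.^-monoʳ-≤ 2 (ℕₚ.≰⇒> ≰)) le))
        cube : ∀ x → 1 ≤ x → x ≤ x * (x * x)
        cube x 1≤x = ℕₚ.m≤m*n x (x * x) {{>-nonZero (ℕₚ.*-mono-≤ 1≤x 1≤x)}}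
        apply : ∀ h T → h ≡ 2 + l → 2 ^ (6 * (h * h)) * 56 ^ 6 < 2 ^ (2 * T) → c * T * (c * T * (c * T)) ≤ 2 ^ l →
          Constants c T → 5 * b (suc j) ≤ 49 * b j
        apply h T h≡ C< big (constants M K k 2M≡ 1≤M 74S≤K weight≤ width≤ room≤) = Ratio.Scale.ratio-bounded E l h j h≡ lo hi T M K k 2M≡ 1≤M 74S≤K C<
          (weight≤ (2 ^ (6 * (h * h)) * 56 ^ 6) C<) (ℕₚ.≤-trans (ℕₚ.*-mono-≤ width≤ (ℕₚ.*-mono-≤ width≤ width≤)) big)
          (ℕₚ.≤-trans room≤ (ℕₚ.≤-trans (cube (c * T) (ℕₚ.≤-trans (ℕₚ.≤-trans 1≤M (ℕₚ.≤-trans (ℕₚ.m≤n*m M 2) (ℕₚ.m≤m+n (2 * M) (2 * k)))) room≤)) big))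
        at-scale : ∀ h T → h ≡ 2 + l → T ≡ 18 + 3 * (h * h) → 1 ≤ T → 5 * b (suc j) ≤ 49 * b j
        at-scale h T h≡ T≡ 1≤T = apply h T h≡ (constant-bound h T T≡) (cube≤ l l₀≤l h T h≡ T≡) (choose T 1≤T)

clear-denominators : ∀ α β u s t x y m → α * x ≤ β * y → u * α ≡ s → u * β ≤ t → x * (s * m) ≤ (t * m + s) * y
clear-denominators α β u s t x y m ratio refl uβ≤t = begin
  x * (u * α * m)      ≡⟨ lem x u α m ⟩
  u * m * (α * x)      ≤⟨ ℕₚ.*-monoʳ-≤ (u * m) ratio ⟩
  u * m * (β * y)      ≡⟨ lem′ u m β y ⟩
  u * β * m * y        ≤⟨ ℕₚ.*-monoˡ-≤ y (ℕₚ.≤-trans (ℕₚ.*-monoˡ-≤ m uβ≤t) (ℕₚ.m≤m+n (t * m) (u * α))) ⟩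
  (t * m + u * α) * y ∎
  where
  lem : ∀ x u α m → x * (u * α * m) ≡ u * m * (α * x)
  lem = solve-∀
  lem′ : ∀ u m β y → u * m * (β * y) ≡ u * β * m * y
  lem′ = solve-∀

theorem3 : (A : ℕ → ℕ) → (∀ n → IsA3 n (A n)) →
    ∀ (m : ℕ) → ∃ λ N → ∀ n → n ≥ N →
    A (suc n) * (10000 * suc m) ≤ (98073 * suc m + 10000) * A n
theorem3 A isA m = suc (proj₁ eventually) , bound
  where
  eventually : ∃ λ N → ∀ j → N ≤ j → 5 * A (suc (suc j)) ≤ 49 * A (suc j)
  eventually = ratio-eventually (λ n → enumeration (isA (suc n))) constants-exist
  bound : ∀ n → n ≥ suc (proj₁ eventually) → A (suc n) * (10000 * suc m) ≤ (98073 * suc m + 10000) * A n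
  -- The ratio 49/5 scaled by 2000 is 98000/10000, just below 98073/10000.
  bound (suc j) (s≤s le) = clear-denominators 5 49 2000 10000 98073 (A (suc (suc j))) (A (suc j)) (suc m)
    (proj₂ eventually j le) refl (ℕₚ.≤ᵇ⇒≤ (2000 * 49) 98073 tt)
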